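{- Let $\Xi$ be an associative strict clan and $q\in\mathbb R$. Let $\tau=(\{\mathbf H_a\mid a\in A\},\mathbf H)\in\Xi$, $a_0\in A$, and $\tau'=(\{\mathbf H_{(a_0,a')}\mid a'\in A'\},\mathbf H_{a_0})\in\Xi$; let $A''=(A\setminus\{a_0\})\cup\{(a_0,a')\mid a'\in A'\}$ and let $\tau''=(\{\mathbf H_{a''}\mid a''\in A''\},\mathbf H)$ be the grafting of $\tau'$ to $\tau$ along $a_0$. Let constructs $C_a$ of $\mathbf H_a$ ($a\in A\setminus\{a_0\}$) and $C_{(a_0,a')}$ of $\mathbf H_{(a_0,a')}$ ($a'\in A'$) be given, and set $\delta''=(\{C_{a''}\mid a''\in A''\},\mathbf H)$ (support $\tau''$) and $\delta'=(\{C_{(a_0,a')}\mid a'\in A'\},\mathbf H_{a_0})$ (support $\tau'$). For a linear construct $\mathbf D$ of $\mathbf H_{a_0}$ write $\delta[\mathbf D]$ for the linear delegation of support $\tau$ with $C_a$ at each $a\in A\setminus\{a_0\}$ and $\mathbf D$ at $a_0$. Then for every $\emptyset\neq B''\subseteq A''$ the polydendriform equation holds: $$\ast^{\tau''}_{B''}(\delta'')=\begin{cases}\ast^{\tau}_{B''}\big(\delta[\ast^{\tau'}(\delta')]\big)&\text{if }B''\subseteq A\setminus\{a_0\},\\ \ast^{\tau}_{B}\big(\delta[\ast^{\tau'}_{B'}(\delta')]\big)&\text{if }B''\not\subseteq A\setminus\{a_0\},\end{cases}$$ where in the second case $B=(B''\cap(A\setminus\{a_0\}))\cup\{a_0\}$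 and $B'=\{a'\in A'\mid (a_0,a')\in B''\}$ (both nonempty). Moreover, $\ast^{\tau''}(\delta'')=\ast^{\tau}\big(\delta[\ast^{\tau'}(\delta')]\big)$.
   Context: Hypergraphs. A (finite) hypergraph $\mathbf H$ on a finite carrier $H$ is a set $\mathbf H\subseteq\mathcal P(H)\setminus\{\emptyset\}$ with $\bigcup\mathbf H=H$ and $\{x\}\in\mathbf H$ for all $x\in H$. For $X\subseteq H$, $\mathbf H_X=\{Z\in\mathbf H:Z\subseteq X\}$, $\mathbf H\setminus X=\mathbf H_{H\setminus X}$. $\mathbf H$ is connected if there is no partition $H=X_1\sqcup X_2$ into nonempty sets with $\mathbf H=\mathbf H_{X_1}\cup\mathbf H_{X_2}$. Every finite hypergraph is uniquely $\bigcup_i\mathbf H_{X_i}$ for a partition $H=\bigsqcup X_i$ with each $\mathbf H_{X_i}$ connected (its connected components); $\mathbf H,X\leadsto\mathbf H_1,\dots,\mathbf H_n$ means that these are the connected components of $\mathbf H\setminus X$. Constructs. Constructs of $\mathbf H$ are non-planar rooted trees with nodes labelled by nonempty subsets of $H$, defined recursively: if $\emptyset\neq Y\subseteq H$, $\mathbf H,Y\leadsto\mathbf H_1,\dots,\mathbf H_n$ and $T_i$ is a construct of $\mathbf H_i$, then $Y(T_1,\dots,T_n)$ (root $Y$, subtrees $T_i$) is a construct of $\mathbf H$, with $\mathrm{root}=Y$ (if $Y=H$, $n=0$). A linear construct of $\mathbf H$ is a real linear combination of constructs of $\mathbf H$; $Y(\mathbf C_1,\dots,\mathbf C_n)$ is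 extended multilinearly. Teams and clans. Fix a universe $\mathfrak U$ (a collection of finite connected hypergraphs). A preteam is $\tau=(\{\mathbf H_a\mid a\in A\},\mathbf H)$ with $A$ finite, all $\mathbf H_a,\mathbf H\in\mathfrak U$, $H=\bigsqcup_a H_a$. For $\emptyset\ne B\subseteq A$ and nonempty $X_b\subseteq H_b$ ($b\in B$), write $\mathbf H_b,X_b\leadsto\mathbf H_{(b,1)},\dots,\mathbf H_{(b,n_b)}$, $\mathbf H,\bigcup_{b\in B}X_b\leadsto\mathbf H^B_1,\dots,\mathbf H^B_{n_B}$, $\tilde A=(A\setminus B)\cup\{(b,i)\mid b\in B,1\le i\le n_b\}$. $\tau$ is a strict team if for all such choices and all $\tilde a\in\tilde A$, $\mathbf H_{\tilde a}\in\mathfrak U$ and $H_{\tilde a}$ lies in a connected component of $\mathbf H\setminus\bigcup_bX_b$; $\varphi^B_\tau(\tilde a)$ is the index $i$ with $H_{\tilde a}\subseteq H^B_i$, and $\tau_i=(\{\mathbf H_{\tilde a}\mid\varphi^B_\tau(\tilde a)=i\},\mathbf H^B_i)$. A strict clan is a set $\Xi$ of strict teams such that all such $\tau_i$ lie in $\Xi$ whenever $\tau\in\Xi$. It is associative if whenever $\tau=(\{\mathbf H_a\mid a\in A\},\mathbf H)\in\Xi$, $a_0\in A$, $\tau'=(\{\mathbf H_{(a_0,a')}\mid a'\in A'\},\mathbf H_{a_0})\in\Xi$, the grafting $(\{\mathbf H_a\mid a\in A\setminus\{a_0\}\}\cup\{\mathbf H_{(a_0,a')}\mid a'\in A'\},\mathbf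 H)$ is in $\Xi$. Shuffle product. Fix $q\in\mathbb R$. A delegation is $\delta=(\{C_a\mid a\in A\},\mathbf H)$ with $C_a$ a construct of $\mathbf H_a$ and support $\tau=(\{\mathbf H_a\},\mathbf H)\in\Xi$. With $X_a=\mathrm{root}(C_a)$ and $\emptyset\ne B\subseteq A$, write $C_b=X_b(C_{(b,1)},\dots,C_{(b,n_b)})$, $C_{(b,i)}$ a construct of $\mathbf H_{(b,i)}$, so a construct $C_{\tilde a}$ is given for every $\tilde a\in\tilde A$, and set $\delta^B_i=(\{C_{\tilde a}\mid\varphi^B_\tau(\tilde a)=i\},\mathbf H^B_i)$. Recursively, $\ast(\delta)=\sum_{\emptyset\ne B\subseteq A}q^{|B|-1}\ast_B(\delta)$ and $\ast_B(\delta)=(\bigcup_{b\in B}X_b)(\ast(\delta^B_1),\dots,\ast(\delta^B_{n_B}))$, a linear construct of $\mathbf H$. Superscripts $\ast^\tau,\ast^\tau_B$ record the support. Both are extended multilinearly to linear delegations (families of linear constructs of the $\mathbf H_a$ with support in $\Xi$). -}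

module Defs where

open import Level using (Level)
open import Data.Bool using (Bool; true; false; _∧_; _∨_; not; if_then_else_; T)
open import Data.Bool.Properties using (T?)
import Data.Bool as Bool
open import Data.Unit using (tt)
open import Data.Nat using (ℕ; zero; suc; _∸_)
open import Data.Fin using (Fin)
import Data.Fin as Fin
open import Data.Vec using (Vec; []; _∷_; zipWith; replicate; lookup)
open import Data.Vec.Properties using (≡-dec)
open import Data.List using (List; []; _∷_; _++_; map; concatMap; foldr; length; allFin)
open import Data.Product using (Σ; ∃; _×_; _,_; proj₁; proj₂)
open import Relation.Binary.PropositionalEquality using (_≡_; _≢_; refl; subst; sym)
open import Relation.Nullary using (yes; no)
open import Relation.Nullary.Decidable using (⌊_⌋)
open import Algebra.Bundles using (CommutativeRing)

-- Finite sets: subsets of an ambient finite set Fin n, as bit vectors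
-- (canonical representation, decidable equality).

Sub : ℕ → Set
Sub n = Vec Bool n

∅ˢ : ∀ {n} → Sub n
∅ˢ {n} = replicate n false

_∪ˢ_ : ∀ {n} → Sub n → Sub n → Sub n
_∪ˢ_ = zipWith _∨_

_∩ˢ_ : ∀ {n} → Sub n → Sub n → Sub n
_∩ˢ_ = zipWith _∧_

_−ˢ_ : ∀ {n} → Sub n → Sub n → Sub n
_−ˢ_ = zipWith (λ x y → x ∧ not y)

⁅_⁆ˢ : ∀ {n} → Fin n → Sub n
⁅ Fin.zero ⁆ˢ = true ∷ ∅ˢ
⁅ Fin.suc x ⁆ˢ = false ∷ ⁅ x ⁆ˢ

nonemptyᵇ : ∀ {n} → Sub n → Bool
nonemptyᵇ [] = false
nonemptyᵇ (x ∷ p) = x ∨ nonemptyᵇ p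

_⊆ᵇ_ : ∀ {n} → Sub n → Sub n → Bool
[] ⊆ᵇ [] = true
(x ∷ p) ⊆ᵇ (y ∷ r) = (not x ∨ y) ∧ (p ⊆ᵇ r)

meetsᵇ : ∀ {n} → Sub n → Sub n → Bool
meetsᵇ p r = nonemptyᵇ (p ∩ˢ r)

_==ᵇ_ : ∀ {n} → Sub n → Sub n → Bool
p ==ᵇ r = ⌊ ≡-dec Bool._≟_ p r ⌋

countˢ : ∀ {n} → Sub n → ℕ
countˢ [] = zero
countˢ (true ∷ p) = suc (countˢ p)
countˢ (false ∷ p) = countˢ p

allSubsets : (n : ℕ) → List (Sub n)
allSubsets zero = [] ∷ []
allSubsets (suc n) = map (true ∷_) (allSubsets n) ++ map (false ∷_) (allSubsets n)

allᵇ : ∀ {a} {A : Set a} → (A → Bool) → List A → Bool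
allᵇ P [] = true
allᵇ P (x ∷ xs) = P x ∧ allᵇ P xs

anyᵇ : ∀ {a} {A : Set a} → (A → Bool) → List A → Bool
anyᵇ P [] = false
anyᵇ P (x ∷ xs) = P x ∨ anyᵇ P xs

keep : ∀ {a} {A : Set a} → (A → Bool) → List A → List A
keep P [] = []
keep P (x ∷ xs) = if P x then x ∷ keep P xs else keep P xs

bigUnion : ∀ {n} → List (Sub n) → Sub n
bigUnion = foldr _∪ˢ_ ∅ˢ

record HG (n : ℕ) : Set where
  constructor hg
  field
    carrier : Sub n
    edge    : Sub n → Bool
open HG public

-- well-formedness: edges are nonempty subsets of the carrier, and all
-- singletons of the carrier are edges (so the union of the edges is the carrier)
wfᵇ : ∀ {n} → HG n → Bool
wfᵇ {n} G =
  allᵇ (λ W → not (edge G W) ∨ (nonemptyᵇ W ∧ (W ⊆ᵇ carrier G))) (allSubsets n)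
  ∧ allᵇ (λ x → not (lookup (carrier G) x) ∨ edge G ⁅ x ⁆ˢ) (allFin n)

restrict : ∀ {n} → HG n → Sub n → HG n
restrict G X = hg (X ∩ˢ carrier G) (λ W → edge G W ∧ (W ⊆ᵇ X))

_∖ʰ_ : ∀ {n} → HG n → Sub n → HG n
G ∖ʰ X = restrict G (carrier G −ˢ X)

connectedᵇ : ∀ {n} → HG n → Bool
connectedᵇ {n} G = not (anyᵇ split (allSubsets n))
  where
  split : Sub n → Bool
  split X₁ = (X₁ ⊆ᵇ carrier G) ∧ nonemptyᵇ X₁ ∧ nonemptyᵇ (carrier G −ˢ X₁)
             ∧ allᵇ (λ W → not (edge G W) ∨ (W ⊆ᵇ X₁) ∨ (W ⊆ᵇ (carrier G −ˢ X₁)))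
                    (allSubsets n)

isCompᵇ : ∀ {n} → HG n → Sub n → Bool
isCompᵇ {n} G K =
  nonemptyᵇ K ∧ (K ⊆ᵇ carrier G) ∧ connectedᵇ (restrict G K)
  ∧ allᵇ (λ W → not (edge G W ∧ meetsᵇ W K) ∨ (W ⊆ᵇ K)) (allSubsets n)

-- Constructs.  Y(T_1,…,T_k): the subtrees are indexed by the connected
-- components K of H ∖ Y (so the tree is non-planar by construction).

data Construct {n : ℕ} : HG n → Set where
  node : {H : HG n} (Y : Sub n) → .(T (nonemptyᵇ Y ∧ (Y ⊆ᵇ carrier H))) →
         ((K : Sub n) → .(T (isCompᵇ (H ∖ʰ Y) K)) → Construct (restrict (H ∖ʰ Y) K)) →
         Construct H

root : ∀ {n} {H : HG n} → Construct H → Sub n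
root (node Y _ _) = Y

mutual
  eqC : ∀ {n} {H : HG n} → Construct H → Construct H → Bool
  eqC {n} {H} (node Y p f) (node Y' p' f') with ≡-dec Bool._≟_ Y Y'
  ... | no _ = false
  ... | yes refl = eqKids H Y f f' (allSubsets n)

  eqKids : ∀ {n} (H : HG n) (Y : Sub n) →
           (f f' : (K : Sub n) → .(T (isCompᵇ (H ∖ʰ Y) K)) → Construct (restrict (H ∖ʰ Y) K)) →
           List (Sub n) → Bool
  eqKids H Y f f' [] = true
  eqKids H Y f f' (K ∷ Ks) with T? (isCompᵇ (H ∖ʰ Y) K)
  ... | yes r = eqC (f K r) (f' K r) ∧ eqKids H Y f f' Ks
  ... | no _ = eqKids H Y f f' Ks

-- Teams.  Since the carriers H_a of a team are pairwise disjoint, a family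
-- {H_a | a ∈ A} is encoded by the set of its carriers (blk) together with
-- the edge set of the member on each carrier (mem Z); index a ↔ carrier H_a.

record Team (n : ℕ) : Set where
  constructor team
  field
    tgt : HG n
    blk : Sub n → Bool
    mem : Sub n → Sub n → Bool
open Team public

member : ∀ {n} → Team n → Sub n → HG n
member τ Z = hg Z (mem τ Z)

-- a universe: a collection of finite connected hypergraphs (a set of
-- hypergraphs, hence invariant under equality of hypergraphs)
record Universe {n : ℕ} (𝔘 : HG n → Set) : Set where
  field
    wf-conn : ∀ G → 𝔘 G → T (wfᵇ G ∧ connectedᵇ G)
    ext     : ∀ G G' → carrier G ≡ carrier G' → (∀ W → edge G W ≡ edge G' W) → 𝔘 G → 𝔘 G'

record Preteam {n : ℕ} (𝔘 : HG n → Set) (τ : Team n) : Set where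
  field
    tgt∈𝔘    : 𝔘 (tgt τ)
    mem∈𝔘    : ∀ Z → T (blk τ Z) → 𝔘 (member τ Z)
    disjoint : ∀ Z Z' → T (blk τ Z) → T (blk τ Z') → Z ≢ Z' → T (not (meetsᵇ Z Z'))
    cover    : carrier (tgt τ) ≡ bigUnion (keep (blk τ) (allSubsets n))

record Choice {n : ℕ} (τ : Team n) (B : Sub n → Bool) (X : Sub n → Sub n) : Set where
  field
    B-ne  : ∃ λ b → T (blk τ b) × T (B b)
    B⊆A   : ∀ b → T (B b) → T (blk τ b)
    X-ok  : ∀ b → T (B b) → T (nonemptyᵇ (X b) ∧ (X b ⊆ᵇ b))

Yof : ∀ {n} → Team n → (Sub n → Bool) → (Sub n → Sub n) → Sub n
Yof {n} τ B X = bigUnion (map X (keep (λ b → blk τ b ∧ B b) (allSubsets n)))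

InComp : ∀ {n} → Team n → (Sub n → Bool) → (Sub n → Sub n) → Sub n → Set
InComp τ B X Z = ∃ λ K → T (isCompᵇ (tgt τ ∖ʰ Yof τ B X) K) × T (Z ⊆ᵇ K)

record Strict {n : ℕ} (𝔘 : HG n → Set) (τ : Team n) : Set where
  field
    preteam : Preteam 𝔘 τ
    unchosen : ∀ B X → Choice τ B X → ∀ a → T (blk τ a) → T (not (B a)) →
               𝔘 (member τ a) × InComp τ B X a
    chosen   : ∀ B X → Choice τ B X → ∀ b → T (B b) →
               ∀ K → T (isCompᵇ (member τ b ∖ʰ X b) K) →
               𝔘 (restrict (member τ b ∖ʰ X b) K)
               × InComp τ B X (carrier (restrict (member τ b ∖ʰ X b) K))

subteam : ∀ {n} → Team n → (Sub n → Bool) → (Sub n → Sub n) → Sub n → Team n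
subteam {n} τ B X K =
  team (restrict (tgt τ ∖ʰ Yof τ B X) K)
       (λ Z → ((blk τ Z ∧ not (B Z)) ∨ anyᵇ (isNew Z) (allSubsets n)) ∧ (Z ⊆ᵇ K))
       (λ Z W → if blk τ Z ∧ not (B Z) then mem τ Z W
                else anyᵇ (λ b → isNew Z b ∧ edge (restrict (member τ b ∖ʰ X b) Z) W)
                          (allSubsets n))
  where
  isNew : Sub n → Sub n → Bool
  isNew Z b = blk τ b ∧ B b ∧ isCompᵇ (member τ b ∖ʰ X b) Z

record StrictClan {n : ℕ} (𝔘 : HG n → Set) (Ξ : Team n → Set) : Set where
  field
    strict : ∀ τ → Ξ τ → Strict 𝔘 τ
    closed : ∀ τ B X → Ξ τ → Choice τ B X →
             ∀ K → T (isCompᵇ (tgt τ ∖ʰ Yof τ B X) K) → Ξ (subteam τ B X K)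

restᵇ : ∀ {n} → Team n → Sub n → Sub n → Bool
restᵇ τ a₀ Z = blk τ Z ∧ not (Z ==ᵇ a₀)

-- grafting of τ' = ({H_(a₀,a')}, H_a₀) (given by blk', mem') to τ along a₀
graft : ∀ {n} → Team n → Sub n → (Sub n → Bool) → (Sub n → Sub n → Bool) → Team n
graft τ a₀ blk' mem' =
  team (tgt τ) (λ Z → restᵇ τ a₀ Z ∨ blk' Z)
       (λ Z → if blk' Z then mem' Z else mem τ Z)

Associative : ∀ {n} → (Team n → Set) → Set
Associative {n} Ξ = ∀ τ (a₀ : Sub n) blk' mem' → Ξ τ → T (blk τ a₀) →
  Ξ (team (member τ a₀) blk' mem') → Ξ (graft τ a₀ blk' mem')

-- Ξ is a set of teams: invariant under equality of the encoded teams
RespectsTeamEq : ∀ {n} → (Team n → Set) → Set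
RespectsTeamEq {n} Ξ = ∀ τ σ →
  carrier (tgt τ) ≡ carrier (tgt σ) → (∀ W → edge (tgt τ) W ≡ edge (tgt σ) W) →
  (∀ Z → blk τ Z ≡ blk σ Z) → (∀ Z → T (blk τ Z) → ∀ W → mem τ Z W ≡ mem σ Z W) →
  Ξ τ → Ξ σ

Ent : ℕ → Set
Ent n = Σ (HG n) Construct

ents : ∀ {n} (P : Sub n → Bool) (G : Sub n → HG n) →
       ((Z : Sub n) → .(T (P Z)) → Construct (G Z)) → List (Ent n)
ents {n} P G C = concatMap one (allSubsets n)
  where
  one : Sub n → List (Ent n)
  one Z with T? (P Z)
  ... | yes r = (G Z , C Z r) ∷ []
  ... | no _ = []

splits : ∀ {a} {A : Set a} → List A → List (List A × List A)
splits [] = ([] , []) ∷ []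
splits (x ∷ xs) = concatMap (λ { (s , r) → (x ∷ s , r) ∷ (s , x ∷ r) ∷ [] }) (splits xs)

neSplits : ∀ {a} {A : Set a} → List A → List (List A × List A)
neSplits xs = keep (λ { ([] , _) → false ; (_ ∷ _ , _) → true }) (splits xs)

kidsOf : ∀ {n} (G : HG n) (X : Sub n) →
         ((K : Sub n) → .(T (isCompᵇ (G ∖ʰ X) K)) → Construct (restrict (G ∖ʰ X) K)) →
         List (Ent n)
kidsOf {n} G X f = ents (isCompᵇ (G ∖ʰ X)) (restrict (G ∖ʰ X)) f

kids : ∀ {n} → List (Ent n) → List (Ent n)
kids [] = []
kids ((G , node X p f) ∷ es) = kidsOf G X f ++ kids es

rootsU : ∀ {n} → List (Ent n) → Sub n
rootsU es = bigUnion (map (λ e → root (proj₂ e)) es)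

module Shuffle {c ℓ} (R : CommutativeRing c ℓ) (q : CommutativeRing.Carrier R) where
  open CommutativeRing R using (Carrier; _+_; _*_; 0#; 1#; _≈_)

  Lin : ∀ {n} → HG n → Set c
  Lin H = List (Carrier × Construct H)

  coef : ∀ {n} {H : HG n} → Construct H → Lin H → Carrier
  coef C = foldr (λ { (a , C') s → if eqC C C' then a + s else s }) 0#

  _≋_ : ∀ {n} {H : HG n} → Lin H → Lin H → Set ℓ
  L ≋ M = ∀ C → coef C L ≈ coef C M

  scale : ∀ {n} {H : HG n} → Carrier → Lin H → Lin H
  scale a = map (λ { (b , C) → (a * b , C) })

  pow : Carrier → ℕ → Carrier
  pow x zero = 1#
  pow x (suc k) = x * pow x k

  expandAll : ∀ m {F : Sub m → Set} → ((K : Sub m) → List (Carrier × F K)) →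
              List (Carrier × ((K : Sub m) → F K))
  expandAll zero f = map (λ { (a , x) → (a , λ { [] → x }) }) (f [])
  expandAll (suc m) f =
    concatMap (λ { (a , g) → map (λ { (b , h) → (a * b , λ { (true ∷ K) → g K ; (false ∷ K) → h K }) })
                                 (expandAll m (λ K → f (false ∷ K))) })
              (expandAll m (λ K → f (true ∷ K)))

  Kid : ∀ {n} → HG n → Sub n → Sub n → Set
  Kid H Y K = .(T (isCompᵇ (H ∖ʰ Y) K)) → Construct (restrict (H ∖ʰ Y) K)

  slot : ∀ {n} (H : HG n) (Y : Sub n) →
         ((K : Sub n) → .(T (isCompᵇ (H ∖ʰ Y) K)) → Lin (restrict (H ∖ʰ Y) K)) →
         (K : Sub n) → List (Carrier × Kid H Y K)
  slot H Y ch K with isCompᵇ (H ∖ʰ Y) K in eq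
  ... | true = map (λ { (a , C) → (a , λ _ → C) }) (ch K (subst T (sym eq) tt))
  ... | false = (1# , λ ()) ∷ []

  nodeL : ∀ {n} (H : HG n) (Y : Sub n) → .(T (nonemptyᵇ Y ∧ (Y ⊆ᵇ carrier H))) →
          ((K : Sub n) → .(T (isCompᵇ (H ∖ʰ Y) K)) → Lin (restrict (H ∖ʰ Y) K)) → Lin H
  nodeL {n} H Y p ch = map (λ { (a , g) → (a , node Y p g) }) (expandAll n (slot H Y ch))

  -- ∗ and ∗_B, by recursion with fuel (the carrier strictly shrinks at each step;
  -- fuel = |H| suffices)
  mutual
    starF : ∀ {n} → ℕ → (H : HG n) → List (Ent n) → Lin H
    starF k H es = concatMap (λ { (s , r) → scale (pow q (length s ∸ 1)) (splitF k H s r) }) (neSplits es)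

    -- ∗_B(δ) where s = (C_b)_{b∈B}, r = (C_a)_{a∉B}
    splitF : ∀ {n} → ℕ → (H : HG n) → List (Ent n) → List (Ent n) → Lin H
    splitF zero H s r = []
    splitF (suc k) H s r with T? (nonemptyᵇ (rootsU s) ∧ (rootsU s ⊆ᵇ carrier H))
    ... | no _ = []
    ... | yes p = nodeL H (rootsU s) p
          (λ K _ → starF k (restrict (H ∖ʰ rootsU s) K)
                           (keep (λ e → carrier (proj₁ e) ⊆ᵇ K) (r ++ kids s)))

  star : ∀ {n} (H : HG n) → List (Ent n) → Lin H
  star H es = starF (countˢ (carrier H)) H es

  starB : ∀ {n} (H : HG n) → (Sub n → Bool) → List (Ent n) → Lin H
  starB H B es = splitF (countˢ (carrier H)) H
                   (keep (λ e → B (carrier (proj₁ e))) es)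
                   (keep (λ e → not (B (carrier (proj₁ e)))) es)

  LEnt : ℕ → Set c
  LEnt n = Σ (HG n) Lin

  lift : ∀ {n} → Ent n → LEnt n
  lift (G , C) = (G , (1# , C) ∷ [])

  expandEnts : ∀ {n} → List (LEnt n) → List (Carrier × List (Ent n))
  expandEnts [] = (1# , []) ∷ []
  expandEnts ((G , L) ∷ es) =
    concatMap (λ { (a , C) → map (λ { (b , es') → (a * b , (G , C) ∷ es') }) (expandEnts es) }) L

  starL : ∀ {n} (H : HG n) → List (LEnt n) → Lin H
  starL H les = concatMap (λ { (a , es) → scale a (star H es) }) (expandEnts les)

  starBL : ∀ {n} (H : HG n) → (Sub n → Bool) → List (LEnt n) → Lin H
  starBL H B les = concatMap (λ { (a , es) → scale a (starB H B es) }) (expandEnts les)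

  plug : ∀ {n} (τ : Team n) (a₀ : Sub n) → List (Ent n) → Lin (member τ a₀) → List (LEnt n)
  plug τ a₀ rest D = map lift rest ++ (member τ a₀ , D) ∷ []

{-# OPTIONS --safe #-}
module Submission where

open import Defs
open import Function using (_∘_; id)
open import Function.Bundles using (Equivalence)
open import Data.Bool using (Bool; true; false; T; not; _∧_; _∨_; if_then_else_)
import Data.Bool as Bool
open import Data.Bool.Properties using (T?; T-∧; T-∨; T-≡)
open import Data.Unit using (tt)
open import Data.Empty using (⊥; ⊥-elim)
open import Data.Nat using (ℕ; zero; suc; _≤_; _<_; z≤n; s≤s)
import Data.Nat as ℕ
open import Data.Nat.Properties using (m≤n⇒m≤1+n; ≤-trans; ≤-pred; ≤-refl; n≮0; +-suc; suc-injective)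
open import Data.Fin using (Fin; zero; suc)
open import Data.Vec using ([]; _∷_; lookup)
open import Data.Vec.Properties using (≡-dec; lookup-zipWith; lookup-replicate)
open import Data.List using (List; []; _∷_; _++_; map; concatMap; length)
open import Data.List.Properties using (++-assoc; ++-identityʳ; length-++; map-++; map-concatMap; concatMap-map; concatMap-++; concatMap-cong)
open import Data.List.Membership.Propositional using (_∈_)
open import Data.List.Membership.Propositional.Properties using (∈-map⁺; ∈-map⁻; ∈-++⁺ˡ; ∈-++⁺ʳ; ∈-++⁻)
open import Data.List.Relation.Unary.Any using (here; there)
open import Data.List.Relation.Unary.All using ([]; _∷_)
import Data.List.Relation.Unary.All as All
open import Data.List.Relation.Unary.AllPairs using (AllPairs; []; _∷_)
import Data.List.Relation.Unary.AllPairs as AllPairs′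
import Data.List.Relation.Unary.AllPairs.Properties as AllPairs
open import Data.List.Relation.Unary.Unique.Propositional using (Unique)
import Data.List.Relation.Unary.Unique.Propositional.Properties as Unique
open import Data.List.Relation.Binary.Permutation.Propositional using (_↭_; refl; prep; swap; trans; ↭-sym; ↭-reflexive; ↭-trans)
open import Data.List.Relation.Binary.Permutation.Propositional.Properties using (++⁺; ++⁺ˡ; ++⁺ʳ; shift; ++-comm; ∈-resp-↭; map⁺; ↭-length)
open import Data.Product using (∃; _×_; _,_; proj₁; proj₂)
open import Data.Sum using (_⊎_; inj₁; inj₂)
open import Relation.Nullary using (¬_; Dec; yes; no)
open import Relation.Nullary.Decidable using (recompute)
open import Relation.Binary.PropositionalEquality using (_≡_; _≢_; cong; cong₂; sym; subst; subst₂) renaming (refl to ≡-refl; trans to ≡-trans)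
open import Algebra.Bundles using (CommutativeRing)

-- The coefficient of a construct C in ∗(δ) can be computed by recursion on C: the root of C has to be the union of the
-- chosen roots, and the kids of C contribute one factor per connected component.  In this form the target C is fixed and
-- the theorem follows by induction on C.  If B″ avoids the grafted block a₀, then a₀ lies in a single component, only the
-- factor of that component depends on the value plugged in at a₀, and the induction hypothesis applies to it.  If B″ meets
-- the grafted members, then every component of 𝐇_{a₀} minus the chosen roots lies in one component of 𝐇 minus all chosen
-- roots, and the induction hypothesis is applied to these components of 𝐇_{a₀} one after the other.  The powers of q match
-- because |B″| - 1 = (|B| - 1) + (|B′| - 1).


-- The value plugged in at a₀ is a formal sum, and each of its constructs enters the product through
-- its whole tree. It is therefore kept as the list `L` produced by `starF`, and everything around
-- it becomes a scalar function φ of one construct D. Both sides are compared as `⟨ L , φ ⟩`,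
-- through which sums over choices and products over components can be moved. The recursion leaves
-- τ, τ′ and their grafting after one step. What must survive is that a family of hypergraphs still
-- forms a team of Ξ. `Supports` records this; it is stable under opening chosen members (clan) and
-- under replacing a member by a team over it (associativity). `Layer` imposes it on all components
-- below a root at once, also for mixed families, in which some components of a₀ minus its roots are
-- already replaced by their finer members while others still carry a single construct. Nothing in
-- the definition of a team forbids an empty block. If a₀ is empty, ∗(δ′) vanishes, and strictness
-- has to show that δ″ has no members.

T-∧⁺ : ∀ {x y} → T x → T y → T (x ∧ y)
T-∧⁺ p r = Equivalence.from T-∧ (p , r)

T-∧⁻ : ∀ {x y} → T (x ∧ y) → T x × T y
T-∧⁻ = Equivalence.to T-∧

T-∨⁻ : ∀ {x y} → T (x ∨ y) → T x ⊎ T y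
T-∨⁻ = Equivalence.to T-∨

T-∨⁺ˡ : ∀ {x y} → T x → T (x ∨ y)
T-∨⁺ˡ = Equivalence.from T-∨ ∘ inj₁

T-∨⁺ʳ : ∀ {x y} → T y → T (x ∨ y)
T-∨⁺ʳ {x} = Equivalence.from (T-∨ {x}) ∘ inj₂

T-not⁺ : ∀ {x} → ¬ T x → T (not x)
T-not⁺ {true} ¬p = ⊥-elim (¬p tt)
T-not⁺ {false} _ = tt

T-not⁻ : ∀ {x} → T (not x) → ¬ T x
T-not⁻ {false} _ ()

T⇒≡ : ∀ {x} → T x → x ≡ true
T⇒≡ = Equivalence.to T-≡

¬T⇒≡ : ∀ {x} → ¬ T x → x ≡ false
¬T⇒≡ {true} ¬p = ⊥-elim (¬p tt)
¬T⇒≡ {false} _ = ≡-refl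

T-⇔-≡ : ∀ {x y} → (T x → T y) → (T y → T x) → x ≡ y
T-⇔-≡ {true} {y} f g = sym (T⇒≡ (f tt))
T-⇔-≡ {false} {true} f g = ⊥-elim (g tt)
T-⇔-≡ {false} {false} f g = ≡-refl

-- Boolean quantifiers, filters and permutations of lists.

allᵇ⁻ : ∀ {a} {A : Set a} (P : A → Bool) (xs : List A) → T (allᵇ P xs) → ∀ {x} → x ∈ xs → T (P x)
allᵇ⁻ P (x ∷ xs) p (here ≡-refl) = proj₁ (T-∧⁻ p)
allᵇ⁻ P (x ∷ xs) p (there i) = allᵇ⁻ P xs (proj₂ (T-∧⁻ {P x} p)) i

allᵇ⁺ : ∀ {a} {A : Set a} (P : A → Bool) (xs : List A) → (∀ x → x ∈ xs → T (P x)) → T (allᵇ P xs)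
allᵇ⁺ P [] h = tt
allᵇ⁺ P (x ∷ xs) h = T-∧⁺ (h x (here ≡-refl)) (allᵇ⁺ P xs (λ y → h y ∘ there))

anyᵇ⁻ : ∀ {a} {A : Set a} (P : A → Bool) (xs : List A) → T (anyᵇ P xs) → ∃ λ x → x ∈ xs × T (P x)
anyᵇ⁻ P (x ∷ xs) p with T-∨⁻ {P x} p
... | inj₁ q = x , here ≡-refl , q
... | inj₂ q with anyᵇ⁻ P xs q
...   | y , i , r = y , there i , r

anyᵇ⁺ : ∀ {a} {A : Set a} (P : A → Bool) {xs : List A} {x} → x ∈ xs → T (P x) → T (anyᵇ P xs)
anyᵇ⁺ P (here ≡-refl) p = T-∨⁺ˡ p
anyᵇ⁺ P {y ∷ _} (there i) p = T-∨⁺ʳ {P y} (anyᵇ⁺ P i p)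

allᵇ-cong : ∀ {a} {A : Set a} {P Q : A → Bool} → (∀ x → P x ≡ Q x) → ∀ xs → allᵇ P xs ≡ allᵇ Q xs
allᵇ-cong h [] = ≡-refl
allᵇ-cong h (x ∷ xs) = cong₂ _∧_ (h x) (allᵇ-cong h xs)

anyᵇ-cong : ∀ {a} {A : Set a} {P Q : A → Bool} → (∀ x → P x ≡ Q x) → ∀ xs → anyᵇ P xs ≡ anyᵇ Q xs
anyᵇ-cong h [] = ≡-refl
anyᵇ-cong h (x ∷ xs) = cong₂ _∨_ (h x) (anyᵇ-cong h xs)

module _ {a} {A : Set a} (P : A → Bool) where

  ∈-keep⁺ : ∀ {xs x} → x ∈ xs → T (P x) → x ∈ keep P xs
  ∈-keep⁺ {y ∷ _} (here ≡-refl) p with P y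
  ... | true = here ≡-refl
  ∈-keep⁺ {y ∷ _} (there i) p with P y
  ... | true = there (∈-keep⁺ i p)
  ... | false = ∈-keep⁺ i p

  ∈-keep⁻ : ∀ xs {x} → x ∈ keep P xs → x ∈ xs × T (P x)
  ∈-keep⁻ (y ∷ xs) i with P y in eq
  ∈-keep⁻ (y ∷ xs) (here ≡-refl) | true = here ≡-refl , subst T (sym eq) tt
  ∈-keep⁻ (y ∷ xs) (there i) | true with ∈-keep⁻ xs i
  ... | j , p = there j , p
  ∈-keep⁻ (y ∷ xs) i | false with ∈-keep⁻ xs i
  ... | j , p = there j , p

  keep-++ : ∀ xs ys → keep P (xs ++ ys) ≡ keep P xs ++ keep P ys
  keep-++ [] ys = ≡-refl
  keep-++ (x ∷ xs) ys with P x
  ... | true = cong (x ∷_) (keep-++ xs ys)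
  ... | false = keep-++ xs ys

  keep-all : ∀ xs → (∀ x → x ∈ xs → T (P x)) → keep P xs ≡ xs
  keep-all [] h = ≡-refl
  keep-all (x ∷ xs) h rewrite T⇒≡ (h x (here ≡-refl)) = cong (x ∷_) (keep-all xs (λ y → h y ∘ there))

  keep-none : ∀ xs → (∀ x → x ∈ xs → ¬ T (P x)) → keep P xs ≡ []
  keep-none [] h = ≡-refl
  keep-none (x ∷ xs) h rewrite ¬T⇒≡ (h x (here ≡-refl)) = keep-none xs (λ y → h y ∘ there)

  keep-↭ : ∀ {xs ys} → xs ↭ ys → keep P xs ↭ keep P ys
  keep-↭ refl = refl
  keep-↭ (prep x p) with P x
  ... | true = prep x (keep-↭ p)
  ... | false = keep-↭ p
  keep-↭ (swap x y p) with P x | P y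
  ... | true | true = swap x y (keep-↭ p)
  ... | true | false = prep x (keep-↭ p)
  ... | false | true = prep y (keep-↭ p)
  ... | false | false = keep-↭ p
  keep-↭ (trans p r) = trans (keep-↭ p) (keep-↭ r)

  keep-complement-↭ : ∀ xs → keep P xs ++ keep (not ∘ P) xs ↭ xs
  keep-complement-↭ [] = refl
  keep-complement-↭ (x ∷ xs) with P x
  ... | true = prep x (keep-complement-↭ xs)
  ... | false = trans (shift x (keep P xs) _) (prep x (keep-complement-↭ xs))

  keep-AllPairs : ∀ {r} {S : A → A → Set r} {xs} → AllPairs S xs → AllPairs S (keep P xs)
  keep-AllPairs [] = []
  keep-AllPairs {xs = x ∷ xs} (p ∷ ps) with P x
  ... | true = All.tabulate (λ i → All.lookup p (proj₁ (∈-keep⁻ xs i))) ∷ keep-AllPairs ps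
  ... | false = keep-AllPairs ps

keep-cong : ∀ {a} {A : Set a} {P Q : A → Bool} xs → (∀ x → x ∈ xs → P x ≡ Q x) → keep P xs ≡ keep Q xs
keep-cong [] h = ≡-refl
keep-cong {P = P} {Q} (x ∷ xs) h with P x | Q x | h x (here ≡-refl)
... | true | .true | ≡-refl = cong (x ∷_) (keep-cong xs (λ y → h y ∘ there))
... | false | .false | ≡-refl = keep-cong xs (λ y → h y ∘ there)

keep-map : ∀ {a b} {A : Set a} {B : Set b} (P : B → Bool) (f : A → B) xs → keep P (map f xs) ≡ map f (keep (P ∘ f) xs)
keep-map P f [] = ≡-refl
keep-map P f (x ∷ xs) with P (f x)
... | true = cong (f x ∷_) (keep-map P f xs)
... | false = keep-map P f xs

module _ {a} {A : Set a} where

  -- Of two different positions the earlier is related to the later, so failure in both directions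
  -- leaves a single position.
  AllPairs-sym-unique : ∀ {r} {S : A → A → Set r} {xs x y} → AllPairs S xs → x ∈ xs → y ∈ xs → ¬ S x y → ¬ S y x → x ≡ y
  AllPairs-sym-unique (p ∷ ps) (here ≡-refl) (here ≡-refl) _ _ = ≡-refl
  AllPairs-sym-unique (p ∷ ps) (here ≡-refl) (there j) ¬s _ = ⊥-elim (¬s (All.lookup p j))
  AllPairs-sym-unique (p ∷ ps) (there i) (here ≡-refl) _ ¬s = ⊥-elim (¬s (All.lookup p i))
  AllPairs-sym-unique (p ∷ ps) (there i) (there j) ¬s ¬s′ = AllPairs-sym-unique ps i j ¬s ¬s′

  AllPairs-++⁻ : ∀ {r} {S : A → A → Set r} xs {ys} → AllPairs S (xs ++ ys) →
                 AllPairs S xs × AllPairs S ys × (∀ {x y} → x ∈ xs → y ∈ ys → S x y)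
  AllPairs-++⁻ [] ps = [] , ps , λ ()
  AllPairs-++⁻ (x ∷ xs) (p ∷ ps) with AllPairs-++⁻ xs ps
  ... | l , r , c = All.tabulate (λ i → All.lookup p (∈-++⁺ˡ i)) ∷ l , r ,
        λ { (here ≡-refl) j → All.lookup p (∈-++⁺ʳ xs j) ; (there i) j → c i j }

  AllPairs-++⁺ : ∀ {r} {S : A → A → Set r} {xs ys} → AllPairs S xs → AllPairs S ys →
                 (∀ {x y} → x ∈ xs → y ∈ ys → S x y) → AllPairs S (xs ++ ys)
  AllPairs-++⁺ ps qs c = AllPairs.++⁺ ps qs (All.tabulate (λ i → All.tabulate (c i)))

  AllPairs-↭ : ∀ {r} {S : A → A → Set r} → (∀ {x y} → S x y → S y x) →
               ∀ {xs ys} → xs ↭ ys → AllPairs S xs → AllPairs S ys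
  AllPairs-↭ s refl ps = ps
  AllPairs-↭ s (prep x π) (p ∷ ps) = All.tabulate (λ i → All.lookup p (∈-resp-↭ (↭-sym π) i)) ∷ AllPairs-↭ s π ps
  AllPairs-↭ s (swap x y π) ((p ∷ ps) ∷ (p′ ∷ ps′)) =
    (s p ∷ All.tabulate (λ i → All.lookup p′ (∈-resp-↭ (↭-sym π) i)))
    ∷ All.tabulate (λ i → All.lookup ps (∈-resp-↭ (↭-sym π) i)) ∷ AllPairs-↭ s π ps′
  AllPairs-↭ s (trans π ρ) ps = AllPairs-↭ s ρ (AllPairs-↭ s π ps)

module _ {a b} {A : Set a} {B : Set b} where

  ∈-concatMap⁺ : ∀ (f : A → List B) {xs x y} → x ∈ xs → y ∈ f x → y ∈ concatMap f xs
  ∈-concatMap⁺ f (here ≡-refl) j = ∈-++⁺ˡ j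
  ∈-concatMap⁺ f {z ∷ _} (there i) j = ∈-++⁺ʳ (f z) (∈-concatMap⁺ f i j)

  ∈-concatMap⁻ : ∀ (f : A → List B) xs {y} → y ∈ concatMap f xs → ∃ λ x → x ∈ xs × y ∈ f x
  ∈-concatMap⁻ f (x ∷ xs) i with ∈-++⁻ (f x) i
  ... | inj₁ j = x , here ≡-refl , j
  ... | inj₂ j with ∈-concatMap⁻ f xs j
  ...   | z , k , l = z , there k , l

  concatMap-[] : ∀ (f : A → List B) xs → (∀ x → x ∈ xs → f x ≡ []) → concatMap f xs ≡ []
  concatMap-[] f [] h = ≡-refl
  concatMap-[] f (x ∷ xs) h rewrite h x (here ≡-refl) = concatMap-[] f xs (λ y → h y ∘ there)

  concatMap-++-↭ : ∀ (f g : A → List B) xs → concatMap (λ x → f x ++ g x) xs ↭ concatMap f xs ++ concatMap g xs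
  concatMap-++-↭ f g [] = refl
  concatMap-++-↭ f g (x ∷ xs) =
    ↭-trans (↭-reflexive (++-assoc (f x) (g x) _))
    (↭-trans (++⁺ˡ (f x) (↭-trans (++⁺ˡ (g x) (concatMap-++-↭ f g xs)) (middle (g x) (concatMap f xs) (concatMap g xs))))
    (↭-reflexive (sym (++-assoc (f x) _ _))))
    where
    middle : ∀ (us vs ws : List B) → us ++ vs ++ ws ↭ vs ++ us ++ ws
    middle us vs ws = ↭-trans (↭-reflexive (sym (++-assoc us vs ws)))
                     (↭-trans (++⁺ʳ ws (++-comm us vs)) (↭-reflexive (++-assoc vs us ws)))

  concatMap-single : ∀ (f : A → List B) {xs x} → Unique xs → x ∈ xs → (∀ y → y ≢ x → f y ≡ []) → concatMap f xs ≡ f x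
  concatMap-single f {y ∷ ys} (p ∷ ps) (here ≡-refl) h
    rewrite concatMap-[] f ys (λ z i → h z (λ e → All.lookup p i (sym e))) = ++-identityʳ (f y)
  concatMap-single f {y ∷ ys} (p ∷ ps) (there i) h rewrite h y (All.lookup p i) = concatMap-single f ps i h

  concatMap-AllPairs : ∀ {r} {S : B → B → Set r} (f : A → List B) {xs} → (∀ {x} → x ∈ xs → AllPairs S (f x)) →
    AllPairs (λ x y → ∀ u v → u ∈ f x → v ∈ f y → S u v) xs → AllPairs S (concatMap f xs)
  concatMap-AllPairs f h [] = []
  concatMap-AllPairs f {x ∷ xs} h (p ∷ ps) =
    AllPairs-++⁺ (h (here ≡-refl)) (concatMap-AllPairs f (h ∘ there) ps) cross
    where
    cross : ∀ {u v} → u ∈ f x → v ∈ concatMap f xs → _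
    cross i j with ∈-concatMap⁻ f xs j
    ... | y , k , l = All.lookup p k _ _ i l

-- Every entry falls into exactly one bucket. Later the buckets are the components of an opened
-- member, and the entries are the members to be distributed over them.
concatMap-keep-↭ : ∀ {a b} {A : Set a} {B : Set b} (P : B → A → Bool) (ks : List B) → Unique ks → ∀ (xs : List A) →
  (∀ x → x ∈ xs → ∃ λ k → k ∈ ks × T (P k x) × (∀ l → T (P l x) → l ≡ k)) →
  concatMap (λ k → keep (P k) xs) ks ↭ xs
concatMap-keep-↭ P ks u [] h = ↭-reflexive (concatMap-[] _ ks (λ _ _ → ≡-refl))
concatMap-keep-↭ P ks u (x ∷ xs) h with h x (here ≡-refl)
... | k , k∈ks , Pk , only =
  ↭-trans (↭-reflexive (cong-concatMap ks (λ l → keep-++ (P l) (x ∷ []) xs)))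
  (↭-trans (concatMap-++-↭ (λ l → keep (P l) (x ∷ [])) (λ l → keep (P l) xs) ks)
  (++⁺ (↭-reflexive (≡-trans (concatMap-single (λ l → keep (P l) (x ∷ [])) u k∈ks empty)
                              (keep-all (P k) (x ∷ []) λ { y (here ≡-refl) → Pk })))
       (concatMap-keep-↭ P ks u xs (λ y → h y ∘ there))))
  where
  cong-concatMap : ∀ {f g} ls → (∀ l → f l ≡ g l) → concatMap f ls ≡ concatMap g ls
  cong-concatMap [] e = ≡-refl
  cong-concatMap (l ∷ ls) e = cong₂ _++_ (e l) (cong-concatMap ls e)
  empty : ∀ l → l ≢ k → keep (P l) (x ∷ []) ≡ []
  empty l l≢k = keep-none (P l) (x ∷ []) λ { y (here ≡-refl) p → l≢k (only l p) }

-- Subsets of the ambient finite set as bit vectors.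

infix 4 _∈ˢ_

_∈ˢ_ : ∀ {n} → Fin n → Sub n → Set
x ∈ˢ p = T (lookup p x)

module _ {n : ℕ} (p r : Sub n) {x : Fin n} where

  ∈-∩⁺ : x ∈ˢ p → x ∈ˢ r → x ∈ˢ (p ∩ˢ r)
  ∈-∩⁺ i j = subst T (sym (lookup-zipWith _∧_ x p r)) (T-∧⁺ i j)

  ∈-∩⁻ : x ∈ˢ (p ∩ˢ r) → x ∈ˢ p × x ∈ˢ r
  ∈-∩⁻ i = T-∧⁻ (subst T (lookup-zipWith _∧_ x p r) i)

  ∈-∪⁺ : x ∈ˢ p ⊎ x ∈ˢ r → x ∈ˢ (p ∪ˢ r)
  ∈-∪⁺ i = subst T (sym (lookup-zipWith _∨_ x p r)) (Equivalence.from T-∨ i)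

  ∈-∪⁻ : x ∈ˢ (p ∪ˢ r) → x ∈ˢ p ⊎ x ∈ˢ r
  ∈-∪⁻ i = T-∨⁻ (subst T (lookup-zipWith _∨_ x p r) i)

  ∈-−⁺ : x ∈ˢ p → ¬ x ∈ˢ r → x ∈ˢ (p −ˢ r)
  ∈-−⁺ i j = subst T (sym (lookup-zipWith (λ u v → u ∧ not v) x p r)) (T-∧⁺ i (T-not⁺ j))

  ∈-−⁻ : x ∈ˢ (p −ˢ r) → x ∈ˢ p × ¬ x ∈ˢ r
  ∈-−⁻ i with T-∧⁻ {lookup p x} (subst T (lookup-zipWith (λ u v → u ∧ not v) x p r) i)
  ... | j , k = j , T-not⁻ k

∉-∅ˢ : ∀ {n} (x : Fin n) → ¬ x ∈ˢ ∅ˢ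
∉-∅ˢ x i = subst T (lookup-replicate x false) i

⊆ᵇ⁻ : ∀ {n} (p r : Sub n) → T (p ⊆ᵇ r) → ∀ {x} → x ∈ˢ p → x ∈ˢ r
⊆ᵇ⁻ (true ∷ p) (b ∷ r) h {zero} i = proj₁ (T-∧⁻ h)
⊆ᵇ⁻ (a ∷ p) (b ∷ r) h {suc x} i = ⊆ᵇ⁻ p r (proj₂ (T-∧⁻ {not a ∨ b} h)) i

⊆ᵇ⁺ : ∀ {n} (p r : Sub n) → (∀ x → x ∈ˢ p → x ∈ˢ r) → T (p ⊆ᵇ r)
⊆ᵇ⁺ [] [] h = tt
⊆ᵇ⁺ (a ∷ p) (b ∷ r) h = T-∧⁺ (head a (h zero)) (⊆ᵇ⁺ p r (h ∘ suc))
  where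
  head : ∀ a → (T a → T b) → T (not a ∨ b)
  head true f = f tt
  head false f = tt

nonempty⁻ : ∀ {n} (p : Sub n) → T (nonemptyᵇ p) → ∃ (_∈ˢ p)
nonempty⁻ (true ∷ p) h = zero , tt
nonempty⁻ (false ∷ p) h with nonempty⁻ p h
... | x , i = suc x , i

nonempty⁺ : ∀ {n} (p : Sub n) {x} → x ∈ˢ p → T (nonemptyᵇ p)
nonempty⁺ (a ∷ p) {zero} i = T-∨⁺ˡ i
nonempty⁺ (a ∷ p) {suc x} i = T-∨⁺ʳ {a} (nonempty⁺ p i)

∈ˢ-ext : ∀ {n} (p r : Sub n) → (∀ x → x ∈ˢ p → x ∈ˢ r) → (∀ x → x ∈ˢ r → x ∈ˢ p) → p ≡ r
∈ˢ-ext [] [] f g = ≡-refl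
∈ˢ-ext (a ∷ p) (b ∷ r) f g = cong₂ _∷_ (T-⇔-≡ (f zero) (g zero)) (∈ˢ-ext p r (f ∘ suc) (g ∘ suc))

==ᵇ⁻ : ∀ {n} (p r : Sub n) → T (p ==ᵇ r) → p ≡ r
==ᵇ⁻ p r h with ≡-dec Bool._≟_ p r
... | yes e = e

==ᵇ⁺ : ∀ {n} {p r : Sub n} → p ≡ r → T (p ==ᵇ r)
==ᵇ⁺ {p = p} ≡-refl with ≡-dec Bool._≟_ p p
... | yes _ = tt
... | no ¬e = ¬e ≡-refl

∈-bigUnion⁺ : ∀ {n} {L : List (Sub n)} {Z x} → Z ∈ L → x ∈ˢ Z → x ∈ˢ bigUnion L
∈-bigUnion⁺ {L = Z ∷ L} (here ≡-refl) i = ∈-∪⁺ Z (bigUnion L) (inj₁ i)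
∈-bigUnion⁺ {L = Z ∷ L} (there j) i = ∈-∪⁺ Z (bigUnion L) (inj₂ (∈-bigUnion⁺ j i))

∈-bigUnion⁻ : ∀ {n} (L : List (Sub n)) {x} → x ∈ˢ bigUnion L → ∃ λ Z → Z ∈ L × x ∈ˢ Z
∈-bigUnion⁻ [] {x} i = ⊥-elim (∉-∅ˢ x i)
∈-bigUnion⁻ (Z ∷ L) i with ∈-∪⁻ Z (bigUnion L) i
... | inj₁ j = Z , here ≡-refl , j
... | inj₂ j with ∈-bigUnion⁻ L j
...   | Z′ , k , l = Z′ , there k , l

∈-allSubsets : ∀ {n} (Z : Sub n) → Z ∈ allSubsets n
∈-allSubsets [] = here ≡-refl
∈-allSubsets (true ∷ Z) = ∈-++⁺ˡ (∈-map⁺ (true ∷_) (∈-allSubsets Z))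
∈-allSubsets {suc n} (false ∷ Z) = ∈-++⁺ʳ (map (true ∷_) (allSubsets n)) (∈-map⁺ (false ∷_) (∈-allSubsets Z))

allSubsets-unique : ∀ n → Unique (allSubsets n)
allSubsets-unique zero = [] ∷ []
allSubsets-unique (suc n) =
  AllPairs-++⁺ (Unique.map⁺ (λ { ≡-refl → ≡-refl }) (allSubsets-unique n))
               (Unique.map⁺ (λ { ≡-refl → ≡-refl }) (allSubsets-unique n)) cross
  where
  cross : ∀ {x y} → x ∈ map (true ∷_) (allSubsets n) → y ∈ map (false ∷_) (allSubsets n) → x ≢ y
  cross i j e with ∈-map⁻ (true ∷_) i | ∈-map⁻ (false ∷_) j
  cross i j () | _ , _ , ≡-refl | _ , _ , ≡-refl

countˢ-mono : ∀ {n} (p r : Sub n) → (∀ x → x ∈ˢ p → x ∈ˢ r) → countˢ p ≤ countˢ r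
countˢ-mono [] [] h = z≤n
countˢ-mono (true ∷ p) (true ∷ r) h = s≤s (countˢ-mono p r (h ∘ suc))
countˢ-mono (true ∷ p) (false ∷ r) h = ⊥-elim (h zero tt)
countˢ-mono (false ∷ p) (true ∷ r) h = m≤n⇒m≤1+n (countˢ-mono p r (h ∘ suc))
countˢ-mono (false ∷ p) (false ∷ r) h = countˢ-mono p r (h ∘ suc)

countˢ-strict : ∀ {n} (p r : Sub n) → (∀ x → x ∈ˢ p → x ∈ˢ r) → ∀ {x} → x ∈ˢ r → ¬ x ∈ˢ p → countˢ p < countˢ r
countˢ-strict (true ∷ p) (b ∷ r) h {zero} i j = ⊥-elim (j tt)
countˢ-strict (false ∷ p) (true ∷ r) h {zero} i j = s≤s (countˢ-mono p r (h ∘ suc))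
countˢ-strict (true ∷ p) (true ∷ r) h {suc x} i j = s≤s (countˢ-strict p r (h ∘ suc) i j)
countˢ-strict (true ∷ p) (false ∷ r) h {suc x} i j = ⊥-elim (h zero tt)
countˢ-strict (false ∷ p) (true ∷ r) h {suc x} i j = m≤n⇒m≤1+n (countˢ-strict p r (h ∘ suc) i j)
countˢ-strict (false ∷ p) (false ∷ r) h {suc x} i j = countˢ-strict p r (h ∘ suc) i j

-- Equality of hypergraphs and uniqueness of connected components.

infix 4 _≐_

-- Edge sets are Boolean functions, so two constructions of the same hypergraph can be compared on
-- each edge but not identified by `≡`.
record _≐_ {n : ℕ} (G G′ : HG n) : Set where
  constructor mk≐
  field
    carrier≡ : carrier G ≡ carrier G′
    edge≡ : ∀ W → edge G W ≡ edge G′ W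
open _≐_

module _ {n : ℕ} where

  restrict-cong : {G G′ : HG n} → G ≐ G′ → ∀ X → restrict G X ≐ restrict G′ X
  restrict-cong (mk≐ c e) X = mk≐ (cong (X ∩ˢ_) c) (λ W → cong (_∧ (W ⊆ᵇ X)) (e W))

  ∖-cong : {G G′ : HG n} → G ≐ G′ → ∀ X → (G ∖ʰ X) ≐ (G′ ∖ʰ X)
  ∖-cong {hg c e} {hg .c e′} (mk≐ ≡-refl h) X = restrict-cong {hg c e} {hg c e′} (mk≐ ≡-refl h) (c −ˢ X)

  connectedᵇ-cong : {G G′ : HG n} → G ≐ G′ → connectedᵇ G ≡ connectedᵇ G′
  connectedᵇ-cong {hg c e} {hg .c e′} (mk≐ ≡-refl h) = cong not (anyᵇ-cong (λ X →
    cong (λ b → (X ⊆ᵇ c) ∧ nonemptyᵇ X ∧ nonemptyᵇ (c −ˢ X) ∧ b)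
      (allᵇ-cong (λ W → cong (λ b → not b ∨ (W ⊆ᵇ X) ∨ (W ⊆ᵇ (c −ˢ X))) (h W)) (allSubsets n))) (allSubsets n))

  isCompᵇ-cong : {G G′ : HG n} → G ≐ G′ → ∀ K → isCompᵇ G K ≡ isCompᵇ G′ K
  isCompᵇ-cong {hg c e} {hg .c e′} (mk≐ ≡-refl h) K =
    cong₂ (λ a b → nonemptyᵇ K ∧ (K ⊆ᵇ c) ∧ a ∧ b)
      (connectedᵇ-cong {restrict (hg c e) K} {restrict (hg c e′) K} (restrict-cong {hg c e} {hg c e′} (mk≐ ≡-refl h) K))
      (allᵇ-cong (λ W → cong (λ b → not (b ∧ meetsᵇ W K) ∨ (W ⊆ᵇ K)) (h W)) (allSubsets n))

  module _ (G : HG n) (K : Sub n) (comp : T (isCompᵇ G K)) where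
    private
      rest₁ = T-∧⁻ {nonemptyᵇ K} comp
      rest₂ = T-∧⁻ {K ⊆ᵇ carrier G} (proj₂ rest₁)
      rest₃ = T-∧⁻ {connectedᵇ (restrict G K)} (proj₂ rest₂)

    comp-nonempty : T (nonemptyᵇ K)
    comp-nonempty = proj₁ rest₁

    comp-⊆ : T (K ⊆ᵇ carrier G)
    comp-⊆ = proj₁ rest₂

    comp-connected : T (connectedᵇ (restrict G K))
    comp-connected = proj₁ rest₃

    comp-closed : ∀ W → T (edge G W) → T (meetsᵇ W K) → T (W ⊆ᵇ K)
    comp-closed W e m with T-∨⁻ {not (edge G W ∧ meetsᵇ W K)} (allᵇ⁻ _ (allSubsets n) (proj₂ rest₃) (∈-allSubsets W))
    ... | inj₁ ¬h = ⊥-elim (T-not⁻ ¬h (T-∧⁺ e m))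
    ... | inj₂ h = h

    comp-carrier : carrier (restrict G K) ≡ K
    comp-carrier = ∈ˢ-ext _ K (λ x → proj₁ ∘ ∈-∩⁻ K (carrier G)) (λ x i → ∈-∩⁺ K (carrier G) i (⊆ᵇ⁻ K (carrier G) comp-⊆ i))

  -- Otherwise K ∩ L and its complement in K are both nonempty and split `restrict G K`: an edge
  -- inside K that meets L lies in L, because L is a component, and an edge that misses L lies in
  -- the complement.
  comp-⊆-comp : ∀ (G : HG n) {K L x} → T (isCompᵇ G K) → T (isCompᵇ G L) → x ∈ˢ K → x ∈ˢ L → T (K ⊆ᵇ L)
  comp-⊆-comp G {K} {L} {x} cK cL x∈K x∈L with T? (K ⊆ᵇ L)
  ... | yes h = h
  ... | no K⊈L = ⊥-elim (T-not⁻ (comp-connected G K cK) (anyᵇ⁺ _ (∈-allSubsets (K ∩ˢ L))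
          (T-∧⁺ (⊆ᵇ⁺ (K ∩ˢ L) C (λ y → K⊆C y ∘ proj₁ ∘ ∈-∩⁻ K L))
          (T-∧⁺ (nonempty⁺ (K ∩ˢ L) (∈-∩⁺ K L x∈K x∈L))
          (T-∧⁺ ne (allᵇ⁺ _ (allSubsets n) (λ W _ → separates W)))))))
    where
    C = carrier (restrict G K)
    K⊆C : ∀ y → y ∈ˢ K → y ∈ˢ C
    K⊆C y = subst (y ∈ˢ_) (sym (comp-carrier G K cK))
    ne : T (nonemptyᵇ (C −ˢ (K ∩ˢ L)))
    ne with T? (nonemptyᵇ (C −ˢ (K ∩ˢ L)))
    ... | yes h = h
    ... | no e = ⊥-elim (K⊈L (⊆ᵇ⁺ K L inside))
      where
      inside : ∀ y → y ∈ˢ K → y ∈ˢ L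
      inside y y∈K with T? (lookup L y)
      ... | yes h = h
      ... | no h = ⊥-elim (e (nonempty⁺ (C −ˢ (K ∩ˢ L)) (∈-−⁺ C (K ∩ˢ L) (K⊆C y y∈K) (h ∘ proj₂ ∘ ∈-∩⁻ K L))))
    separates : ∀ W → T (not (edge G W ∧ (W ⊆ᵇ K)) ∨ (W ⊆ᵇ (K ∩ˢ L)) ∨ (W ⊆ᵇ (C −ˢ (K ∩ˢ L))))
    separates W with T? (edge G W ∧ (W ⊆ᵇ K))
    ... | no h = T-∨⁺ˡ (T-not⁺ h)
    ... | yes h with T-∧⁻ {edge G W} h | T? (meetsᵇ W L)
    ...   | e , W⊆K | yes m = T-∨⁺ʳ {not (edge G W ∧ (W ⊆ᵇ K))} (T-∨⁺ˡ (⊆ᵇ⁺ W (K ∩ˢ L)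
              (λ y i → ∈-∩⁺ K L (⊆ᵇ⁻ W K W⊆K i) (⊆ᵇ⁻ W L (comp-closed G L cL W e m) i))))
    ...   | e , W⊆K | no m = T-∨⁺ʳ {not (edge G W ∧ (W ⊆ᵇ K))} (T-∨⁺ʳ {W ⊆ᵇ (K ∩ˢ L)} (⊆ᵇ⁺ W (C −ˢ (K ∩ˢ L))
              (λ y i → ∈-−⁺ C (K ∩ˢ L) (K⊆C y (⊆ᵇ⁻ W K W⊆K i))
                         (λ j → m (nonempty⁺ (W ∩ˢ L) (∈-∩⁺ W L i (proj₂ (∈-∩⁻ K L j))))))))

  comp-unique : ∀ (G : HG n) {K L x} → T (isCompᵇ G K) → T (isCompᵇ G L) → x ∈ˢ K → x ∈ˢ L → K ≡ L
  comp-unique G {K} {L} cK cL i j = ∈ˢ-ext K L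
    (λ _ → ⊆ᵇ⁻ K L (comp-⊆-comp G {K} {L} cK cL i j)) (λ _ → ⊆ᵇ⁻ L K (comp-⊆-comp G {L} {K} cL cK j i))

  ∈-∖⁻ : ∀ (G : HG n) X {x} → x ∈ˢ carrier (G ∖ʰ X) → x ∈ˢ carrier G × ¬ x ∈ˢ X
  ∈-∖⁻ G X i = ∈-−⁻ (carrier G) X (proj₁ (∈-∩⁻ (carrier G −ˢ X) (carrier G) i))

  ∈-comp⁻ : ∀ (G : HG n) X K {x} → T (isCompᵇ (G ∖ʰ X) K) → x ∈ˢ K → x ∈ˢ carrier G × ¬ x ∈ˢ X
  ∈-comp⁻ G X K c i = ∈-∖⁻ G X (⊆ᵇ⁻ K (carrier (G ∖ʰ X)) (comp-⊆ (G ∖ʰ X) K c) i)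

  -- Delegations reduced to hypergraphs with roots; families that form a team.

  Rooted : Set
  Rooted = HG n × Sub n

  IsRooted : Rooted → Set
  IsRooted (G , X) = T (nonemptyᵇ X ∧ (X ⊆ᵇ carrier G))

  rootsUnion : List Rooted → Sub n
  rootsUnion s = bigUnion (map proj₂ s)

  kidHGs : Rooted → List (HG n)
  kidHGs (G , X) = map (restrict (G ∖ʰ X)) (keep (isCompᵇ (G ∖ʰ X)) (allSubsets n))

  ∈-kidHGs⁻ : ∀ g {G′} → G′ ∈ kidHGs g → ∃ λ K → T (isCompᵇ (proj₁ g ∖ʰ proj₂ g) K) × G′ ≡ restrict (proj₁ g ∖ʰ proj₂ g) K
  ∈-kidHGs⁻ (G , X) i with ∈-map⁻ (restrict (G ∖ʰ X)) i
  ... | K , j , e = K , proj₂ (∈-keep⁻ _ (allSubsets n) j) , e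

  ∈-kidHGs⁺ : ∀ g {K} → T (isCompᵇ (proj₁ g ∖ʰ proj₂ g) K) → restrict (proj₁ g ∖ʰ proj₂ g) K ∈ kidHGs g
  ∈-kidHGs⁺ (G , X) {K} c = ∈-map⁺ _ (∈-keep⁺ _ (∈-allSubsets K) c)

  kid-⊆ : ∀ g {G′ x} → G′ ∈ kidHGs g → x ∈ˢ carrier G′ → x ∈ˢ carrier (proj₁ g)
  kid-⊆ g@(G , X) i j with ∈-kidHGs⁻ g i
  ... | K , c , ≡-refl = proj₁ (∈-∖⁻ G X (proj₂ (∈-∩⁻ K (carrier (G ∖ʰ X)) j)))

  Disjoint : HG n → HG n → Set
  Disjoint G G′ = ∀ x → x ∈ˢ carrier G → x ∈ˢ carrier G′ → ⊥

  -- An existential rather than a function of H and Gs: the representing team matters only up to pointwise equality of edge sets.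
  record Supports (Ξ : Team n → Set) (H : HG n) (Gs : List (HG n)) : Set where
    field
      rep       : Team n
      rep∈Ξ     : Ξ rep
      target    : tgt rep ≐ H
      blocks⁻   : ∀ Z → T (blk rep Z) → ∃ λ G → G ∈ Gs × carrier G ≡ Z
      blocks⁺   : ∀ {G} → G ∈ Gs → T (blk rep (carrier G))
      members   : ∀ {G} → G ∈ Gs → member rep (carrier G) ≐ G
      inhabited : ∀ {G} → G ∈ Gs → T (nonemptyᵇ (carrier G))
      disjoint  : AllPairs Disjoint Gs

  Supports-↭ : ∀ {Ξ H Gs Gs′} → Gs ↭ Gs′ → Supports Ξ H Gs → Supports Ξ H Gs′
  Supports-↭ {Gs = Gs} {Gs′} π S = record
    { rep = rep ; rep∈Ξ = rep∈Ξ ; target = target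
    ; blocks⁻ = λ Z h → let (G , i , e) = blocks⁻ Z h in G , ∈-resp-↭ π i , e
    ; blocks⁺ = blocks⁺ ∘ back ; members = members ∘ back ; inhabited = inhabited ∘ back
    ; disjoint = AllPairs-↭ (λ d x i j → d x j i) π disjoint }
    where
    open Supports S
    back : ∀ {G} → G ∈ Gs′ → G ∈ Gs
    back = ∈-resp-↭ (↭-sym π)

-- Supported families are stable under grafting and opening.

module Clan {n : ℕ} {𝔘 : HG n → Set} {Ξ : Team n → Set}
            (clan : StrictClan 𝔘 Ξ) (assoc : Associative Ξ) (resp : RespectsTeamEq Ξ) where
  open StrictClan clan

  Supports-⊆ : ∀ {H Gs G x} → Supports Ξ H Gs → G ∈ Gs → x ∈ˢ carrier G → x ∈ˢ carrier H
  Supports-⊆ {x = x} S i j = subst (x ∈ˢ_) (carrier≡ target)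
    (subst (x ∈ˢ_) (sym (Preteam.cover (Strict.preteam (strict rep rep∈Ξ))))
      (∈-bigUnion⁺ (∈-keep⁺ (blk rep) (∈-allSubsets _) (blocks⁺ i)) j))
    where open Supports S

  -- Associativity carried over to lists. Members of Gs are nonempty and disjoint from G₀, while
  -- those of Gs′ lie inside G₀, so no carrier occurs in both families and the grafted team keeps
  -- the edges of each.
  Supports-graft : ∀ {H Gs G₀ Gs′} → Supports Ξ H (Gs ++ G₀ ∷ []) → Supports Ξ G₀ Gs′ → Supports Ξ H (Gs ++ Gs′)
  Supports-graft {H} {Gs} {G₀} {Gs′} S S′ = record
    { rep = graft S.rep a₀ (blk S′.rep) (mem S′.rep)
    ; rep∈Ξ = assoc S.rep a₀ (blk S′.rep) (mem S′.rep) S.rep∈Ξ (S.blocks⁺ G₀∈)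
        -- `Associative` asks for a team whose target is literally the member of `S.rep` at a₀; the
        -- target of `S′.rep` agrees with it only edge by edge.
        (resp S′.rep _ (carrier≡ S′.target)
          (λ W → ≡-trans (edge≡ S′.target W) (sym (edge≡ (S.members G₀∈) W)))
          (λ _ → ≡-refl) (λ _ _ _ → ≡-refl) S′.rep∈Ξ)
    ; target = S.target
    ; blocks⁻ = blocks⁻
    ; blocks⁺ = blocks⁺ ∘ ∈-++⁻ Gs
    ; members = members ∘ ∈-++⁻ Gs
    ; inhabited = inhabited ∘ ∈-++⁻ Gs
    ; disjoint = AllPairs-++⁺ (proj₁ apart) S′.disjoint
        (λ i j x x∈G x∈G′ → apart₀ i x x∈G (Supports-⊆ S′ j x∈G′))
    }
    where
    module S = Supports S
    module S′ = Supports S′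
    a₀ = carrier G₀
    G₀∈ : G₀ ∈ Gs ++ G₀ ∷ []
    G₀∈ = ∈-++⁺ʳ Gs (here ≡-refl)
    apart = AllPairs-++⁻ Gs S.disjoint
    apart₀ : ∀ {G} → G ∈ Gs → Disjoint G G₀
    apart₀ i = proj₂ (proj₂ apart) i (here ≡-refl)
    blocks⁻ : ∀ Z → T (restᵇ S.rep a₀ Z ∨ blk S′.rep Z) → ∃ λ G → G ∈ Gs ++ Gs′ × carrier G ≡ Z
    blocks⁻ Z h with T-∨⁻ {restᵇ S.rep a₀ Z} h
    ... | inj₂ b = let (G , i , e) = S′.blocks⁻ Z b in G , ∈-++⁺ʳ Gs i , e
    ... | inj₁ b with T-∧⁻ {blk S.rep Z} b
    ...   | b′ , Z≢ with S.blocks⁻ Z b′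
    ...     | G , i , e with ∈-++⁻ Gs i
    ...       | inj₁ j = G , ∈-++⁺ˡ j , e
    ...       | inj₂ (here ≡-refl) = ⊥-elim (T-not⁻ Z≢ (==ᵇ⁺ (sym e)))
    inhabited : ∀ {G} → G ∈ Gs ⊎ G ∈ Gs′ → T (nonemptyᵇ (carrier G))
    inhabited (inj₁ i) = S.inhabited (∈-++⁺ˡ i)
    inhabited (inj₂ i) = S′.inhabited i
    blocks⁺ : ∀ {G} → G ∈ Gs ⊎ G ∈ Gs′ → T (restᵇ S.rep a₀ (carrier G) ∨ blk S′.rep (carrier G))
    blocks⁺ {G} (inj₁ i) = T-∨⁺ˡ (T-∧⁺ (S.blocks⁺ (∈-++⁺ˡ i)) (T-not⁺ (λ e →
      let (x , x∈) = nonempty⁻ (carrier G) (inhabited (inj₁ i))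
      in apart₀ i x x∈ (subst (x ∈ˢ_) (==ᵇ⁻ (carrier G) a₀ e) x∈))))
    blocks⁺ {G} (inj₂ i) = T-∨⁺ʳ {restᵇ S.rep a₀ (carrier G)} (S′.blocks⁺ i)
    members : ∀ {G} → G ∈ Gs ⊎ G ∈ Gs′ → member (graft S.rep a₀ (blk S′.rep) (mem S′.rep)) (carrier G) ≐ G
    members {G} (inj₁ i) = mk≐ ≡-refl edges
      where
      -- The conditional in `graft` must take its old branch here: a grafted block with this carrier
      -- would lie inside a₀.
      outside : ¬ T (blk S′.rep (carrier G))
      outside b with S′.blocks⁻ _ b | nonempty⁻ (carrier G) (inhabited (inj₁ i))
      ... | G′ , j , e | x , x∈ = apart₀ i x x∈ (Supports-⊆ S′ j (subst (x ∈ˢ_) (sym e) x∈))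
      edges : ∀ W → (if blk S′.rep (carrier G) then mem S′.rep (carrier G) else mem S.rep (carrier G)) W ≡ edge G W
      edges W rewrite ¬T⇒≡ outside = edge≡ (S.members (∈-++⁺ˡ i)) W
    members {G} (inj₂ i) = mk≐ ≡-refl edges
      where
      edges : ∀ W → (if blk S′.rep (carrier G) then mem S′.rep (carrier G) else mem S.rep (carrier G)) W ≡ edge G W
      edges W rewrite T⇒≡ (S′.blocks⁺ i) = edge≡ (S′.members i) W

  -- One step of the recursion for ∗_B on the level of teams: the members in s are opened at their
  -- roots, those in r are passed down as they are.
  module Opening {H : HG n} (r : List (HG n)) (s : List Rooted) (S : Supports Ξ H (r ++ map proj₁ s))
                 (rooted : ∀ {g} → g ∈ s → IsRooted g) (s≢[] : s ≢ []) where
    open Supports S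

    private
      U : Sub n
      U = rootsUnion s

      B : Sub n → Bool
      B Z = anyᵇ (λ g → carrier (proj₁ g) ==ᵇ Z) s

      -- `Choice` wants the root as a function of the block. Blocks are disjoint and each root lies
      -- in its own block, so intersecting the union of all roots with a block recovers its root.
      X : Sub n → Sub n
      X Z = U ∩ˢ Z

      B⁺ : ∀ {g} → g ∈ s → T (B (carrier (proj₁ g)))
      B⁺ i = anyᵇ⁺ _ i (==ᵇ⁺ ≡-refl)

      B⁻ : ∀ Z → T (B Z) → ∃ λ g → g ∈ s × carrier (proj₁ g) ≡ Z
      B⁻ Z h with anyᵇ⁻ _ s h
      ... | g , i , e = g , i , ==ᵇ⁻ _ Z e

      in-s : ∀ {g} → g ∈ s → proj₁ g ∈ r ++ map proj₁ s
      in-s i = ∈-++⁺ʳ r (∈-map⁺ proj₁ i)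

      root-⊆ : ∀ {g x} → g ∈ s → x ∈ˢ proj₂ g → x ∈ˢ carrier (proj₁ g)
      root-⊆ {G , X′} i = ⊆ᵇ⁻ X′ (carrier G) (proj₂ (T-∧⁻ {nonemptyᵇ X′} (rooted i)))

      root-∈ : ∀ {g} → g ∈ s → ∃ λ x → x ∈ˢ proj₂ g
      root-∈ {G , X′} i = nonempty⁻ X′ (proj₁ (T-∧⁻ {nonemptyᵇ X′} (rooted i)))

      apart = AllPairs-++⁻ r disjoint
      apart-s : AllPairs (λ g h → Disjoint (proj₁ g) (proj₁ h)) s
      apart-s = AllPairs.map⁻ (proj₁ (proj₂ apart))

      same : ∀ {g h x} → g ∈ s → h ∈ s → x ∈ˢ carrier (proj₁ g) → x ∈ˢ carrier (proj₁ h) → g ≡ h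
      same i j x∈g x∈h = AllPairs-sym-unique apart-s i j (λ d → d _ x∈g x∈h) (λ d → d _ x∈h x∈g)

      ¬B : ∀ {G} → G ∈ r → ¬ T (B (carrier G))
      ¬B {G} i h with B⁻ _ h | nonempty⁻ (carrier G) (inhabited (∈-++⁺ˡ i))
      ... | g , j , e | x , x∈ = proj₂ (proj₂ apart) i (∈-map⁺ proj₁ j) x x∈ (subst (x ∈ˢ_) (sym e) x∈)

      X≡root : ∀ {g} → g ∈ s → X (carrier (proj₁ g)) ≡ proj₂ g
      X≡root {g} i = ∈ˢ-ext _ _ to (λ x j → ∈-∩⁺ U _ (∈-bigUnion⁺ (∈-map⁺ proj₂ i) j) (root-⊆ i j))
        where
        to : ∀ x → x ∈ˢ X (carrier (proj₁ g)) → x ∈ˢ proj₂ g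
        to x j with ∈-∩⁻ U (carrier (proj₁ g)) j
        ... | x∈U , x∈G with ∈-bigUnion⁻ (map proj₂ s) x∈U
        ...   | Z , k , x∈Z with ∈-map⁻ proj₂ k
        ...     | h , l , ≡-refl = subst (λ g′ → x ∈ˢ proj₂ g′) (same l i (root-⊆ l x∈Z) x∈G) x∈Z

      choice : Choice rep B X
      choice = record
        { B-ne = nonempty-B s s≢[] id
        ; B⊆A = λ b h → let (g , i , e) = B⁻ b h in subst (T ∘ blk rep) e (blocks⁺ (in-s i))
        ; X-ok = λ b h → let (g , i , e) = B⁻ b h
                             (x , x∈) = root-∈ i
                         in T-∧⁺ (nonempty⁺ (X b) (∈-∩⁺ U b (∈-bigUnion⁺ (∈-map⁺ proj₂ i) x∈)
                                                        (subst (x ∈ˢ_) e (root-⊆ i x∈))))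
                                 (⊆ᵇ⁺ (X b) b (λ y → proj₂ ∘ ∈-∩⁻ U b)) }
        where
        nonempty-B : ∀ t → t ≢ [] → (∀ {g} → g ∈ t → g ∈ s) → ∃ λ b → T (blk rep b) × T (B b)
        nonempty-B [] t≢[] _ = ⊥-elim (t≢[] ≡-refl)
        nonempty-B (g ∷ t) _ inc = carrier (proj₁ g) , blocks⁺ (in-s (inc (here ≡-refl))) , B⁺ (inc (here ≡-refl))

      Y≡U : Yof rep B X ≡ U
      Y≡U = ∈ˢ-ext _ _ to from
        where
        to : ∀ x → x ∈ˢ Yof rep B X → x ∈ˢ U
        to x i with ∈-bigUnion⁻ (map X (keep (λ b → blk rep b ∧ B b) (allSubsets n))) i
        ... | Z , j , x∈Z with ∈-map⁻ X j
        ...   | b , _ , ≡-refl = proj₁ (∈-∩⁻ U b x∈Z)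
        from : ∀ x → x ∈ˢ U → x ∈ˢ Yof rep B X
        from x i with ∈-bigUnion⁻ (map proj₂ s) i
        ... | Z , j , x∈Z with ∈-map⁻ proj₂ j
        ...   | g , k , ≡-refl = ∈-bigUnion⁺ (∈-map⁺ X (∈-keep⁺ (λ b → blk rep b ∧ B b) (∈-allSubsets _) (T-∧⁺ (blocks⁺ (in-s k)) (B⁺ k))))
                                             (∈-∩⁺ U _ i (root-⊆ k x∈Z))

      H≐ : (tgt rep ∖ʰ Yof rep B X) ≐ (H ∖ʰ U)
      H≐ = subst (λ V → (tgt rep ∖ʰ V) ≐ (H ∖ʰ U)) (sym Y≡U) (∖-cong target U)

      kid≐ : ∀ {g} → g ∈ s → (member rep (carrier (proj₁ g)) ∖ʰ X (carrier (proj₁ g))) ≐ (proj₁ g ∖ʰ proj₂ g)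
      kid≐ {g} i = subst (λ V → (member rep (carrier (proj₁ g)) ∖ʰ V) ≐ (proj₁ g ∖ʰ proj₂ g)) (sym (X≡root i)) (∖-cong (members (in-s i)) (proj₂ g))

      InComp⇒ : ∀ Z → InComp rep B X Z → ∃ λ K → T (isCompᵇ (H ∖ʰ U) K) × T (Z ⊆ᵇ K)
      InComp⇒ Z (K , c , h) = K , subst T (isCompᵇ-cong H≐ K) c , h

    opened : List (HG n)
    opened = r ++ concatMap kidHGs s

    opened-inhabited : ∀ {G} → G ∈ opened → T (nonemptyᵇ (carrier G))
    opened-inhabited i with ∈-++⁻ r i
    ... | inj₁ j = inhabited (∈-++⁺ˡ j)
    ... | inj₂ j with ∈-concatMap⁻ kidHGs s j
    ...   | g , k , l with ∈-kidHGs⁻ g l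
    ...     | K , c , ≡-refl = subst (T ∘ nonemptyᵇ) (sym (comp-carrier (proj₁ g ∖ʰ proj₂ g) K c)) (comp-nonempty (proj₁ g ∖ʰ proj₂ g) K c)

    opened-inComp : ∀ {G} → G ∈ opened → ∃ λ K → T (isCompᵇ (H ∖ʰ U) K) × T (carrier G ⊆ᵇ K)
    opened-inComp {G} i with ∈-++⁻ r i
    ... | inj₁ j = InComp⇒ (carrier G) (proj₂ (Strict.unchosen (strict rep rep∈Ξ) B X choice (carrier G) (blocks⁺ (∈-++⁺ˡ j)) (T-not⁺ (¬B j))))
    ... | inj₂ j with ∈-concatMap⁻ kidHGs s j
    ...   | g , k , l with ∈-kidHGs⁻ g l
    ...     | K , c , ≡-refl = InComp⇒ (carrier G) (subst (InComp rep B X) (carrier≡ (restrict-cong (kid≐ k) K))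
              (proj₂ (Strict.chosen (strict rep rep∈Ξ) B X choice _ (B⁺ k) K (subst T (sym (isCompᵇ-cong (kid≐ k) K)) c))))

    opened-disjoint : AllPairs Disjoint opened
    opened-disjoint = AllPairs-++⁺ (proj₁ apart) (concatMap-AllPairs kidHGs (λ {g} _ → siblings g)
        (AllPairs′.map (λ {g} {h} d _ _ i j x x∈ x∈′ → d x (kid-⊆ g i x∈) (kid-⊆ h j x∈′)) apart-s)) cross
      where
      siblings : ∀ g → AllPairs Disjoint (kidHGs g)
      siblings g@(G , X′) = AllPairs.map⁺ (go (allSubsets n) (allSubsets-unique n))
        where
        D = G ∖ʰ X′
        go : ∀ Ks → AllPairs _≢_ Ks → AllPairs (λ K L → Disjoint (restrict D K) (restrict D L)) (keep (isCompᵇ D) Ks)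
        go [] [] = []
        go (K ∷ Ks) (p ∷ ps) with isCompᵇ D K in eq
        ... | false = go Ks ps
        ... | true = All.tabulate (λ {L} i x x∈ x∈′ →
                let (j , c) = ∈-keep⁻ (isCompᵇ D) Ks i in
                All.lookup p j (comp-unique D (subst T (sym eq) tt) c (proj₁ (∈-∩⁻ K _ x∈)) (proj₁ (∈-∩⁻ L _ x∈′)))) ∷ go Ks ps
      cross : ∀ {G G′} → G ∈ r → G′ ∈ concatMap kidHGs s → Disjoint G G′
      cross i j x x∈ x∈′ with ∈-concatMap⁻ kidHGs s j
      ... | g , k , l = proj₂ (proj₂ apart) i (∈-map⁺ proj₁ k) x x∈ (kid-⊆ g l x∈′)

    -- Closure of the clan under `subteam`. The work lies in matching the blocks and edges of
    -- `subteam`, found there by a search over all subsets, with the entries of the list.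
    Supports-opened : ∀ K → T (isCompᵇ (H ∖ʰ U) K) →
      Supports Ξ (restrict (H ∖ʰ U) K) (keep (λ G → carrier G ⊆ᵇ K) opened)
    Supports-opened K cK = record
      { rep = subteam rep B X K
      ; rep∈Ξ = closed rep B X rep∈Ξ choice K (subst T (sym (isCompᵇ-cong H≐ K)) cK)
      ; target = restrict-cong H≐ K
      ; blocks⁻ = new-blocks⁻
      ; blocks⁺ = λ i → let (j , h) = ∈-keep⁻ within opened i in T-∧⁺ (new-blocks⁺ (∈-++⁻ r j)) h
      ; members = λ i → new-members (∈-++⁻ r (proj₁ (∈-keep⁻ within opened i)))
      ; inhabited = λ i → opened-inhabited (proj₁ (∈-keep⁻ within opened i))
      ; disjoint = keep-AllPairs within opened-disjoint }
      where
      within : HG n → Bool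
      within G = carrier G ⊆ᵇ K
      isNew : Sub n → Sub n → Bool
      isNew Z b = blk rep b ∧ B b ∧ isCompᵇ (member rep b ∖ʰ X b) Z
      isNew⁺ : ∀ {g Z} → g ∈ s → T (isCompᵇ (proj₁ g ∖ʰ proj₂ g) Z) → T (isNew Z (carrier (proj₁ g)))
      isNew⁺ {g} {Z} i c = T-∧⁺ (blocks⁺ (in-s i)) (T-∧⁺ (B⁺ i) (subst T (sym (isCompᵇ-cong (kid≐ i) Z)) c))
      isNew⁻ : ∀ {Z b} → T (isNew Z b) → ∃ λ g → g ∈ s × carrier (proj₁ g) ≡ b × T (isCompᵇ (proj₁ g ∖ʰ proj₂ g) Z)
      isNew⁻ {Z} {b} h with T-∧⁻ {B b} (proj₂ (T-∧⁻ {blk rep b} h))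
      ... | Bb , c with B⁻ b Bb
      ...   | g , i , ≡-refl = g , i , ≡-refl , subst T (isCompᵇ-cong (kid≐ i) Z) c
      new-blocks⁻ : ∀ Z → T (blk (subteam rep B X K) Z) → ∃ λ G → G ∈ keep within opened × carrier G ≡ Z
      new-blocks⁻ Z h with T-∧⁻ {(blk rep Z ∧ not (B Z)) ∨ anyᵇ (isNew Z) (allSubsets n)} h
      ... | h′ , Z⊆K with T-∨⁻ {blk rep Z ∧ not (B Z)} h′
      ...   | inj₁ old with T-∧⁻ {blk rep Z} old
      ...     | b , ¬Bz with blocks⁻ Z b
      ...       | G , i , ≡-refl with ∈-++⁻ r i
      ...         | inj₁ j = G , ∈-keep⁺ within (∈-++⁺ˡ j) Z⊆K , ≡-refl
      ...         | inj₂ j with ∈-map⁻ proj₁ j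
      ...           | g , k , ≡-refl = ⊥-elim (T-not⁻ ¬Bz (B⁺ k))
      new-blocks⁻ Z h | h′ , Z⊆K | inj₂ new with anyᵇ⁻ (isNew Z) (allSubsets n) new
      ...     | b , _ , isn with isNew⁻ {Z} {b} isn
      ...       | g , i , _ , c = restrict (proj₁ g ∖ʰ proj₂ g) Z ,
                    ∈-keep⁺ within (∈-++⁺ʳ r (∈-concatMap⁺ kidHGs i (∈-kidHGs⁺ g c))) (subst (λ V → T (V ⊆ᵇ K)) (sym e) Z⊆K) , e
                  where e = comp-carrier (proj₁ g ∖ʰ proj₂ g) Z c
      new-blocks⁺ : ∀ {G} → G ∈ r ⊎ G ∈ concatMap kidHGs s →
        T ((blk rep (carrier G) ∧ not (B (carrier G))) ∨ anyᵇ (isNew (carrier G)) (allSubsets n))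
      new-blocks⁺ (inj₁ i) = T-∨⁺ˡ (T-∧⁺ (blocks⁺ (∈-++⁺ˡ i)) (T-not⁺ (¬B i)))
      new-blocks⁺ {G} (inj₂ i) with ∈-concatMap⁻ kidHGs s i
      ... | g , j , k with ∈-kidHGs⁻ g k
      ...   | Z , c , ≡-refl = T-∨⁺ʳ {blk rep (carrier G) ∧ not (B (carrier G))} (anyᵇ⁺ (isNew (carrier G)) (∈-allSubsets _)
                (subst (λ V → T (isNew V (carrier (proj₁ g)))) (sym (comp-carrier (proj₁ g ∖ʰ proj₂ g) Z c)) (isNew⁺ {g} {Z} j c)))
      new-members : ∀ {G} → G ∈ r ⊎ G ∈ concatMap kidHGs s → member (subteam rep B X K) (carrier G) ≐ G
      new-members {G} (inj₁ i) = mk≐ ≡-refl edges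
        where
        edges : ∀ W → mem (subteam rep B X K) (carrier G) W ≡ edge G W
        edges W rewrite T⇒≡ (T-∧⁺ (blocks⁺ (∈-++⁺ˡ i)) (T-not⁺ (¬B i))) = edge≡ (members (∈-++⁺ˡ i)) W
      new-members {G} (inj₂ i) with ∈-concatMap⁻ kidHGs s i
      ... | g , j , k with ∈-kidHGs⁻ g k
      ...   | Z , c , ≡-refl = mk≐ ≡-refl (λ W → subst (λ V → mem (subteam rep B X K) V W ≡ edge G W) (sym e) (edges W))
        where
        D = proj₁ g ∖ʰ proj₂ g
        e = comp-carrier D Z c
        z = nonempty⁻ Z (comp-nonempty D Z c)
        z∈g : proj₁ z ∈ˢ carrier (proj₁ g)
        z∈g = proj₁ (∈-comp⁻ (proj₁ g) (proj₂ g) Z c (proj₂ z))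
        -- Z is nonempty and lies inside the opened member g, so an unopened block with carrier Z
        -- would meet g.
        not-old : ¬ T (blk rep Z ∧ not (B Z))
        not-old h with T-∧⁻ {blk rep Z} h
        ... | b , ¬Bz with blocks⁻ Z b
        ...   | G′ , i′ , e′ with ∈-++⁻ r i′
        ...     | inj₁ j′ = proj₂ (proj₂ apart) j′ (∈-map⁺ proj₁ j) (proj₁ z) (subst (proj₁ z ∈ˢ_) (sym e′) (proj₂ z)) z∈g
        ...     | inj₂ j′ with ∈-map⁻ proj₁ j′
        ...       | g′ , k′ , ≡-refl = T-not⁻ ¬Bz (subst (T ∘ B) e′ (B⁺ k′))
        edges : ∀ W → mem (subteam rep B X K) Z W ≡ edge G W
        edges W rewrite ¬T⇒≡ not-old = T-⇔-≡ to from
          where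
          to : T (anyᵇ (λ b → isNew Z b ∧ edge (restrict (member rep b ∖ʰ X b) Z) W) (allSubsets n)) → T (edge G W)
          to h with anyᵇ⁻ _ (allSubsets n) h
          ... | b , _ , h′ with T-∧⁻ {isNew Z b} h′
          ...   | isn , ed with isNew⁻ {Z} {b} isn
          -- A point of Z lies in only one opened member, so the search can only have found g.
          ...     | g′ , i′ , ≡-refl , c′
                      with same j i′ z∈g (proj₁ (∈-comp⁻ (proj₁ g′) (proj₂ g′) Z c′ (proj₂ z)))
          ...       | ≡-refl = subst T (edge≡ (restrict-cong (kid≐ i′) Z) W) ed
          from : T (edge G W) → T (anyᵇ (λ b → isNew Z b ∧ edge (restrict (member rep b ∖ʰ X b) Z) W) (allSubsets n))
          from h = anyᵇ⁺ _ (∈-allSubsets (carrier (proj₁ g))) (T-∧⁺ (isNew⁺ {g} {Z} j c) (subst T (sym (edge≡ (restrict-cong (kid≐ j) Z) W)) h))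

-- Scalar functions extended linearly to formal sums.

module Pairing {c ℓ} (R : CommutativeRing c ℓ) (q : CommutativeRing.Carrier R) where
  open CommutativeRing R using (Carrier; _≈_; _+_; _*_; 0#; 1#; setoid; reflexive; +-cong; +-congˡ; +-congʳ; +-assoc; +-comm; +-identityˡ; +-identityʳ; *-cong; *-congˡ; *-congʳ; *-assoc; *-comm; *-identityˡ; *-identityʳ; distribˡ; zeroˡ; zeroʳ) renaming (refl to ≈-refl; sym to ≈-sym; trans to ≈-trans)
  open Shuffle R q
  open import Relation.Binary.Reasoning.Setoid setoid

  +-interchange : ∀ a b c d → (a + b) + (c + d) ≈ (a + c) + (b + d)
  +-interchange a b c d = begin
    (a + b) + (c + d) ≈⟨ +-assoc a b (c + d) ⟩
    a + (b + (c + d)) ≈⟨ +-congˡ (≈-trans (≈-sym (+-assoc b c d)) (≈-trans (+-congʳ (+-comm b c)) (+-assoc c b d))) ⟩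
    a + (c + (b + d)) ≈⟨ ≈-sym (+-assoc a c (b + d)) ⟩
    (a + c) + (b + d) ∎

  *-exchange : ∀ a b c → a * (b * c) ≈ b * (a * c)
  *-exchange a b c = ≈-trans (≈-sym (*-assoc a b c)) (≈-trans (*-congʳ (*-comm a b)) (*-assoc b a c))

  -- The linear extension of a scalar function, evaluated at a formal sum. A is left general because
  -- formal sums of constructs, of families of subtrees and of delegations all occur.
  ⟨_,_⟩ : ∀ {a} {A : Set a} → List (Carrier × A) → (A → Carrier) → Carrier
  ⟨ [] , φ ⟩ = 0#
  ⟨ (a , x) ∷ L , φ ⟩ = a * φ x + ⟨ L , φ ⟩

  module _ {a} {A : Set a} where

    pair-cong : ∀ (L : List (Carrier × A)) {φ ψ} → (∀ x → φ x ≈ ψ x) → ⟨ L , φ ⟩ ≈ ⟨ L , ψ ⟩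
    pair-cong [] h = ≈-refl
    pair-cong ((a , x) ∷ L) h = +-cong (*-congˡ (h x)) (pair-cong L h)

    pair-++ : ∀ (L M : List (Carrier × A)) φ → ⟨ L ++ M , φ ⟩ ≈ ⟨ L , φ ⟩ + ⟨ M , φ ⟩
    pair-++ [] M φ = ≈-sym (+-identityˡ _)
    pair-++ ((a , x) ∷ L) M φ = ≈-trans (+-congˡ (pair-++ L M φ)) (≈-sym (+-assoc _ _ _))

    pair-+ : ∀ (L : List (Carrier × A)) φ ψ → ⟨ L , (λ x → φ x + ψ x) ⟩ ≈ ⟨ L , φ ⟩ + ⟨ L , ψ ⟩
    pair-+ [] φ ψ = ≈-sym (+-identityˡ _)
    pair-+ ((a , x) ∷ L) φ ψ = ≈-trans (+-cong (distribˡ _ _ _) (pair-+ L φ ψ)) (+-interchange _ _ _ _)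

    pair-* : ∀ (L : List (Carrier × A)) b φ → ⟨ L , (λ x → b * φ x) ⟩ ≈ b * ⟨ L , φ ⟩
    pair-* [] b φ = ≈-sym (zeroʳ b)
    pair-* ((a , x) ∷ L) b φ = ≈-trans (+-cong (*-exchange a b (φ x)) (pair-* L b φ)) (≈-sym (distribˡ b _ _))

    pair-0 : ∀ (L : List (Carrier × A)) {φ} → (∀ x → φ x ≈ 0#) → ⟨ L , φ ⟩ ≈ 0#
    pair-0 [] h = ≈-refl
    pair-0 ((a , x) ∷ L) h = ≈-trans (+-cong (≈-trans (*-congˡ (h x)) (zeroʳ a)) (pair-0 L h)) (+-identityˡ _)

  module _ {a b} {A : Set a} {B : Set b} where

    pair-swap : ∀ (L : List (Carrier × A)) (M : List (Carrier × B)) (φ : A → B → Carrier) →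
      ⟨ L , (λ x → ⟨ M , φ x ⟩) ⟩ ≈ ⟨ M , (λ y → ⟨ L , (λ x → φ x y) ⟩) ⟩
    pair-swap [] M φ = ≈-sym (pair-0 M (λ _ → ≈-refl))
    pair-swap ((a , x) ∷ L) M φ = ≈-sym (≈-trans (pair-+ M _ _) (+-cong (pair-* M a (φ x)) (≈-sym (pair-swap L M φ))))

    pair-bind : ∀ (F : Carrier × A → List (Carrier × B)) (φ : B → Carrier) (ψ : A → Carrier) →
      (∀ a x → ⟨ F (a , x) , φ ⟩ ≈ a * ψ x) → ∀ L → ⟨ concatMap F L , φ ⟩ ≈ ⟨ L , ψ ⟩
    pair-bind F φ ψ h [] = ≈-refl
    pair-bind F φ ψ h ((a , x) ∷ L) = ≈-trans (pair-++ (F (a , x)) _ φ) (+-cong (h a x) (pair-bind F φ ψ h L))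

    pair-scaled : ∀ (f : Carrier × A → Carrier × B) a (φ : B → Carrier) (ψ : A → Carrier) →
      (∀ b x → proj₁ (f (b , x)) ≈ a * b × φ (proj₂ (f (b , x))) ≈ ψ x) → ∀ L → ⟨ map f L , φ ⟩ ≈ a * ⟨ L , ψ ⟩
    pair-scaled f a φ ψ h [] = ≈-sym (zeroʳ a)
    pair-scaled f a φ ψ h ((b , x) ∷ L) = ≈-trans
      (+-cong (≈-trans (*-cong (proj₁ (h b x)) (proj₂ (h b x))) (*-assoc a b (ψ x))) (pair-scaled f a φ ψ h L))
      (≈-sym (distribˡ a _ _))

    pair-map : ∀ (f : Carrier × A → Carrier × B) (φ : B → Carrier) (ψ : A → Carrier) →
      (∀ b x → proj₁ (f (b , x)) ≈ b × φ (proj₂ (f (b , x))) ≈ ψ x) → ∀ L → ⟨ map f L , φ ⟩ ≈ ⟨ L , ψ ⟩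
    pair-map f φ ψ h L = ≈-trans (pair-scaled f 1# φ ψ (λ b x → ≈-trans (proj₁ (h b x)) (≈-sym (*-identityˡ b)) , proj₂ (h b x)) L)
      (*-identityˡ _)

  pair-scale : ∀ {n} {H : HG n} a (L : Lin H) φ → ⟨ scale a L , φ ⟩ ≈ a * ⟨ L , φ ⟩
  pair-scale a L φ = pair-scaled _ a φ φ (λ _ _ → ≈-refl , ≈-refl) L

  Π : ∀ {a} {A : Set a} → List A → (A → Carrier) → Carrier
  Π [] φ = 1#
  Π (x ∷ xs) φ = φ x * Π xs φ

  module _ {a} {A : Set a} where

    Π-cong : ∀ (xs : List A) {φ ψ} → (∀ x → x ∈ xs → φ x ≈ ψ x) → Π xs φ ≈ Π xs ψ
    Π-cong [] h = ≈-refl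
    Π-cong (x ∷ xs) h = *-cong (h x (here ≡-refl)) (Π-cong xs (λ y → h y ∘ there))

    Π-++ : ∀ (xs ys : List A) φ → Π (xs ++ ys) φ ≈ Π xs φ * Π ys φ
    Π-++ [] ys φ = ≈-sym (*-identityˡ _)
    Π-++ (x ∷ xs) ys φ = ≈-trans (*-congˡ (Π-++ xs ys φ)) (≈-sym (*-assoc _ _ _))

    Π-map : ∀ {b} {B : Set b} (f : B → A) xs φ → Π (map f xs) φ ≡ Π xs (φ ∘ f)
    Π-map f [] φ = ≡-refl
    Π-map f (x ∷ xs) φ = cong (φ (f x) *_) (Π-map f xs φ)

    -- Multilinearity of a product in one factor. `Unique` ensures that x₀ occurs only once, so d
    -- enters a single factor and the sum over d can be pulled out.
    Π-linear : ∀ {b} {B : Set b} (L : List (Carrier × B)) (u : A → Carrier) (v : A → B → Carrier) {xs x₀} →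
      Unique xs → x₀ ∈ xs → (∀ x → x ≢ x₀ → ∀ d → u x ≈ v x d) → u x₀ ≈ ⟨ L , v x₀ ⟩ →
      Π xs u ≈ ⟨ L , (λ d → Π xs (λ x → v x d)) ⟩
    Π-linear L u v {x ∷ xs} (p ∷ _) (here ≡-refl) const lin = begin
      u x * Π xs u                              ≈⟨ ≈-trans (*-congʳ lin) (*-comm _ _) ⟩
      Π xs u * ⟨ L , v x ⟩                      ≈⟨ ≈-sym (pair-* L _ _) ⟩
      ⟨ L , (λ d → Π xs u * v x d) ⟩            ≈⟨ pair-cong L (λ d → ≈-trans (*-comm _ _) (*-congˡ
                                                    (Π-cong xs (λ y i → const y (λ e → All.lookup p i (sym e)) d)))) ⟩
      ⟨ L , (λ d → v x d * Π xs (λ y → v y d)) ⟩ ∎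
    Π-linear L u v {x ∷ xs} (p ∷ ps) (there i) const lin = begin
      u x * Π xs u                                ≈⟨ *-congˡ (Π-linear L u v ps i const lin) ⟩
      u x * ⟨ L , (λ d → Π xs (λ y → v y d)) ⟩     ≈⟨ ≈-sym (pair-* L _ _) ⟩
      ⟨ L , (λ d → u x * Π xs (λ y → v y d)) ⟩     ≈⟨ pair-cong L (λ d → *-congʳ (const x (All.lookup p i) d)) ⟩
      ⟨ L , (λ d → v x d * Π xs (λ y → v y d)) ⟩   ∎

  Π-allSubsets-suc : ∀ m (φ : Sub (suc m) → Carrier) →
    Π (allSubsets (suc m)) φ ≈ Π (allSubsets m) (φ ∘ (true ∷_)) * Π (allSubsets m) (φ ∘ (false ∷_))
  Π-allSubsets-suc m φ = ≈-trans (Π-++ (map (true ∷_) (allSubsets m)) _ φ)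
    (reflexive (cong₂ _*_ (Π-map (true ∷_) (allSubsets m) φ) (Π-map (false ∷_) (allSubsets m) φ)))

  -- `single` and `join` name the families that `expandAll` builds by anonymous pattern matching;
  -- the two forms agree only pointwise.
  single : {F : Sub 0 → Set} → F [] → (K : Sub 0) → F K
  single x [] = x

  join : ∀ {m} {F : Sub (suc m) → Set} → ((K : Sub m) → F (true ∷ K)) → ((K : Sub m) → F (false ∷ K)) → (K : Sub (suc m)) → F K
  join g h (true ∷ K) = g K
  join g h (false ∷ K) = h K

  -- Functions on families have to respect pointwise equality, in the absence of function extensionality.
  Extensional : ∀ {m} {F : Sub m → Set} → (((K : Sub m) → F K) → Carrier) → Set ℓ
  Extensional {m} {F} Φ = ∀ g g′ → (∀ K → g K ≡ g′ K) → Φ g ≈ Φ g′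

  pair-expandAll-zero : ∀ {F : Sub 0 → Set} (f : (K : Sub 0) → List (Carrier × F K)) (Φ : ((K : Sub 0) → F K) → Carrier) →
    Extensional Φ → ⟨ expandAll 0 f , Φ ⟩ ≈ ⟨ f [] , (λ x → Φ (single x)) ⟩
  pair-expandAll-zero f Φ ext = pair-map _ Φ _ (λ b x → ≈-refl , ext _ _ λ { [] → ≡-refl }) (f [])

  pair-expandAll-suc : ∀ m {F : Sub (suc m) → Set} (f : (K : Sub (suc m)) → List (Carrier × F K)) (Φ : ((K : Sub (suc m)) → F K) → Carrier) →
    Extensional Φ → ⟨ expandAll (suc m) f , Φ ⟩ ≈
      ⟨ expandAll m (f ∘ (true ∷_)) , (λ g → ⟨ expandAll m (f ∘ (false ∷_)) , (λ h → Φ (join g h)) ⟩) ⟩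
  pair-expandAll-suc m f Φ ext = pair-bind _ Φ _ (λ a g → pair-scaled _ a Φ _
    (λ b h → ≈-refl , ext _ _ λ { (true ∷ K) → ≡-refl ; (false ∷ K) → ≡-refl }) (expandAll m (f ∘ (false ∷_)))) (expandAll m (f ∘ (true ∷_)))

  -- The distributive law: a sum over choice functions of a product of independent factors.
  pair-expandAll-Π : ∀ m {F : Sub m → Set} (f : (K : Sub m) → List (Carrier × F K)) (χ : (K : Sub m) → F K → Carrier) →
    ⟨ expandAll m f , (λ g → Π (allSubsets m) (λ K → χ K (g K))) ⟩ ≈ Π (allSubsets m) (λ K → ⟨ f K , χ K ⟩)
  pair-expandAll-Π zero f χ = begin
    _ ≈⟨ pair-expandAll-zero f _ (λ g g′ e → *-congʳ (reflexive (cong (χ []) (e [])))) ⟩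
    ⟨ f [] , (λ x → χ [] x * 1#) ⟩ ≈⟨ pair-cong (f []) (λ x → *-identityʳ _) ⟩
    ⟨ f [] , χ [] ⟩ ≈⟨ ≈-sym (*-identityʳ _) ⟩
    ⟨ f [] , χ [] ⟩ * 1# ∎
  pair-expandAll-Π (suc m) {F} f χ = begin
    _ ≈⟨ pair-expandAll-suc m f _ (λ g g′ e → Π-cong (allSubsets (suc m)) (λ K _ → reflexive (cong (χ K) (e K)))) ⟩
    ⟨ L , (λ g → ⟨ M , (λ h → Π (allSubsets (suc m)) (λ K → χ K (join {F = F} g h K))) ⟩) ⟩
      ≈⟨ pair-cong L (λ g → pair-cong M (λ h → Π-allSubsets-suc m _)) ⟩
    ⟨ L , (λ g → ⟨ M , (λ h → left g * right h) ⟩) ⟩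
      ≈⟨ pair-cong L (λ g → ≈-trans (pair-* M (left g) right) (*-comm _ _)) ⟩
    ⟨ L , (λ g → ⟨ M , right ⟩ * left g) ⟩ ≈⟨ pair-* L _ left ⟩
    ⟨ M , right ⟩ * ⟨ L , left ⟩ ≈⟨ *-comm _ _ ⟩
    ⟨ L , left ⟩ * ⟨ M , right ⟩ ≈⟨ *-cong (pair-expandAll-Π m _ _) (pair-expandAll-Π m _ _) ⟩
    _ ≈⟨ ≈-sym (Π-allSubsets-suc m _) ⟩
    Π (allSubsets (suc m)) (λ K → ⟨ f K , χ K ⟩) ∎
    where
    L = expandAll m (f ∘ (true ∷_))
    M = expandAll m (f ∘ (false ∷_))
    left = λ g → Π (allSubsets m) (λ K → χ (true ∷ K) (g K))
    right = λ h → Π (allSubsets m) (λ K → χ (false ∷ K) (h K))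

  -- Coefficients in a node with linear subtrees.

  ind : Bool → Carrier
  ind b = if b then 1# else 0#

  ind-∧ : ∀ a b → ind (a ∧ b) ≈ ind a * ind b
  ind-∧ true b = ≈-sym (*-identityˡ _)
  ind-∧ false b = ≈-sym (zeroˡ _)

  -- The factor 1 away from components lets products run over `allSubsets n`, matching the trivial
  -- entry that `slot` puts there.
  whenT : (b : Bool) → (.(T b) → Carrier) → Carrier
  whenT true k = k tt
  whenT false k = 1#

  whenT-yes : ∀ {b} (t : T b) (k : .(T b) → Carrier) → whenT b k ≡ k t
  whenT-yes {true} t k = ≡-refl

  whenT-no : ∀ {b} → ¬ T b → (k : .(T b) → Carrier) → whenT b k ≡ 1#
  whenT-no {true} ¬t k = ⊥-elim (¬t tt)
  whenT-no {false} ¬t k = ≡-refl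

  whenT-cong : ∀ b {k k′ : .(T b) → Carrier} → ((t : T b) → k t ≈ k′ t) → whenT b k ≈ whenT b k′
  whenT-cong true h = h tt
  whenT-cong false h = ≈-refl

  coef-pair : ∀ {n} {H : HG n} (C : Construct H) (L : Lin H) → coef C L ≈ ⟨ L , (λ C′ → ind (eqC C C′)) ⟩
  coef-pair C [] = ≈-refl
  coef-pair C ((a , C′) ∷ L) with eqC C C′
  ... | true = +-cong (≈-sym (*-identityʳ a)) (coef-pair C L)
  ... | false = ≈-trans (coef-pair C L) (≈-sym (≈-trans (+-congʳ (zeroʳ a)) (+-identityˡ _)))

  module _ {n : ℕ} {H : HG n} {Y : Sub n} where

    KidFamily : Set
    KidFamily = (K : Sub n) → .(T (isCompᵇ (H ∖ʰ Y) K)) → Construct (restrict (H ∖ʰ Y) K)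

    eqKids-Π : ∀ (f f′ : KidFamily) Ks →
      ind (eqKids H Y f f′ Ks) ≈ Π Ks (λ K → whenT (isCompᵇ (H ∖ʰ Y) K) (λ t → ind (eqC (f K t) (f′ K t))))
    eqKids-Π f f′ [] = ≈-refl
    eqKids-Π f f′ (K ∷ Ks) with T? (isCompᵇ (H ∖ʰ Y) K)
    ... | yes t = ≈-trans (ind-∧ (eqC (f K t) (f′ K t)) _)
            (*-cong (reflexive (sym (whenT-yes t (λ t → ind (eqC (f K t) (f′ K t)))))) (eqKids-Π f f′ Ks))
    ... | no ¬t = ≈-trans (eqKids-Π f f′ Ks)
            (≈-trans (≈-sym (*-identityˡ _)) (*-congʳ (reflexive (sym (whenT-no ¬t (λ t → ind (eqC (f K t) (f′ K t))))))))

    ChildLins : Set c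
    ChildLins = (K : Sub n) → .(T (isCompᵇ (H ∖ʰ Y) K)) → Lin (restrict (H ∖ʰ Y) K)

    record CompValue (K : Sub n) (b : Bool) : Set where
      constructor mkValue
      field value : isCompᵇ (H ∖ʰ Y) K ≡ b

    -- The case distinction inside slot also changes the domain T (isCompᵇ …) of the kids, hence the form of P.  Its
    -- equation is first turned into a variable and then wrapped, as otherwise its two sides would be abstracted together.
    module SlotCases {p}
      (P : (K : Sub n) (b : Bool) → isCompᵇ (H ∖ʰ Y) K ≡ b → List (Carrier × (.(T b) → Construct (restrict (H ∖ʰ Y) K))) → Set p)
      (ch : ChildLins)
      (yes-case : ∀ K (e : isCompᵇ (H ∖ʰ Y) K ≡ true) (f : Carrier × Construct (restrict (H ∖ʰ Y) K) → Carrier × (.(T true) → Construct (restrict (H ∖ʰ Y) K))) →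
         (∀ a C → proj₁ (f (a , C)) ≡ a × proj₂ (f (a , C)) ≡ (λ _ → C)) → P K true e (map f (ch K (subst T (sym e) tt))))
      (no-case : ∀ K (e : isCompᵇ (H ∖ʰ Y) K ≡ false) x → P K false e ((1# , x) ∷ [])) where

      mutual
        slot-elim : ∀ K → P K (isCompᵇ (H ∖ʰ Y) K) ≡-refl (slot H Y ch K)
        slot-elim K with ≡-refl {x = isCompᵇ (H ∖ʰ Y) K}
        ... | e = by-value K (mkValue e)

        by-value : ∀ K (v : CompValue K (isCompᵇ (H ∖ʰ Y) K)) → _
        by-value K v with isCompᵇ (H ∖ʰ Y) K | v
        ... | true | mkValue e = yes-case K e _ (λ _ _ → ≡-refl , ≡-refl)
        ... | false | mkValue e = no-case K e _

    open SlotCases using (slot-elim)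

    pair-slot : ∀ (ch : ChildLins) (φ : (K : Sub n) → .(T (isCompᵇ (H ∖ʰ Y) K)) → Construct (restrict (H ∖ʰ Y) K) → Carrier) K →
      ⟨ slot H Y ch K , (λ x → whenT (isCompᵇ (H ∖ʰ Y) K) (λ t → φ K t (x t))) ⟩ ≈ whenT (isCompᵇ (H ∖ʰ Y) K) (λ t → ⟨ ch K t , φ K t ⟩)
    pair-slot ch φ = slot-elim
      (λ K b e L → ⟨ L , (λ x → whenT b (λ t → φ K (subst T (sym e) t) (x t))) ⟩ ≈ whenT b (λ t → ⟨ ch K (subst T (sym e) t) , φ K (subst T (sym e) t) ⟩))
      ch
      (λ K e f h → pair-map f (λ x → φ K (subst T (sym e) tt) (x tt)) (φ K (subst T (sym e) tt)) (λ a C → reflexive (proj₁ (h a C)) , reflexive (cong (λ x → φ K (subst T (sym e) tt) (x tt)) (proj₂ (h a C)))) (ch K (subst T (sym e) tt)))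
      (λ K e x → ≈-trans (+-identityʳ _) (*-identityˡ _))

    pair-nodeL : ∀ .(p : T (nonemptyᵇ Y ∧ (Y ⊆ᵇ carrier H))) (ch : ChildLins) φ →
      ⟨ nodeL H Y p ch , φ ⟩ ≈ ⟨ expandAll n (slot H Y ch) , (λ g → φ (node Y p g)) ⟩
    pair-nodeL p ch φ = pair-map _ φ _ (λ _ _ → ≈-refl , ≈-refl) (expandAll n (slot H Y ch))

    -- Two constructs with the same root are equal exactly when their subtrees agree in every
    -- component. The indicator of equality is thus a product over components, and the distributive
    -- law applies to the multilinear expansion of the node.
    coef-nodeL : ∀ .p .p′ (f : KidFamily) (ch : ChildLins) →
      coef (node Y p f) (nodeL H Y p′ ch) ≈ Π (allSubsets n) (λ K → whenT (isCompᵇ (H ∖ʰ Y) K) (λ t → coef (f K t) (ch K t)))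
    coef-nodeL p p′ f ch = begin
      coef (node Y p f) (nodeL H Y p′ ch)                          ≈⟨ coef-pair (node Y p f) (nodeL H Y p′ ch) ⟩
      ⟨ nodeL H Y p′ ch , (λ C′ → ind (eqC (node Y p f) C′)) ⟩     ≈⟨ pair-nodeL p′ ch _ ⟩
      ⟨ L , (λ g → ind (eqC (node Y p f) (node Y p′ g))) ⟩         ≈⟨ pair-cong L eqC-Π ⟩
      ⟨ L , (λ g → Π (allSubsets n) (λ K → χ K (g K))) ⟩           ≈⟨ pair-expandAll-Π n (slot H Y ch) χ ⟩
      Π (allSubsets n) (λ K → ⟨ slot H Y ch K , χ K ⟩)
        ≈⟨ Π-cong (allSubsets n) (λ K _ → ≈-trans (pair-slot ch (λ K t C → ind (eqC (f K t) C)) K)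
             (whenT-cong (isCompᵇ (H ∖ʰ Y) K) (λ t → ≈-sym (coef-pair (f K t) (ch K t))))) ⟩
      Π (allSubsets n) (λ K → whenT (isCompᵇ (H ∖ʰ Y) K) (λ t → coef (f K t) (ch K t))) ∎
      where
      L = expandAll n (slot H Y ch)
      χ : (K : Sub n) → Kid H Y K → Carrier
      χ K x = whenT (isCompᵇ (H ∖ʰ Y) K) (λ t → ind (eqC (f K t) (x t)))
      eqC-Π : ∀ g → ind (eqC (node Y p f) (node Y p′ g)) ≈ Π (allSubsets n) (λ K → χ K (g K))
      eqC-Π g with ≡-dec Bool._≟_ Y Y
      ... | yes ≡-refl = eqKids-Π f g (allSubsets n)
      ... | no ¬e = ⊥-elim (¬e ≡-refl)

  coef-nodeL-≢ : ∀ {n} {H : HG n} {Y Y′ : Sub n} .p .p′ (f : KidFamily) (ch : ChildLins) → Y ≢ Y′ →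
    coef (node {H = H} Y p f) (nodeL H Y′ p′ ch) ≈ 0#
  coef-nodeL-≢ {n} {H} {Y} {Y′} p p′ f ch Y≢Y′ = ≈-trans (coef-pair (node Y p f) (nodeL H Y′ p′ ch))
    (≈-trans (pair-nodeL p′ ch _) (pair-0 (expandAll n (slot H Y′ ch)) unequal))
    where
    unequal : ∀ g → ind (eqC (node {H = H} Y p f) (node Y′ p′ g)) ≈ 0#
    unequal g with ≡-dec Bool._≟_ Y Y′
    ... | yes e = ⊥-elim (Y≢Y′ e)
    ... | no _ = ≈-refl

  -- Sums over the choices of members to be opened.

  module _ {a} {A : Set a} where

    -- In φ s r, s is the chosen part of the list and r the rest. The decision about x is moved into
    -- the summand, so inductions on the list only change φ.
    Σsplits : List A → (List A → List A → Carrier) → Carrier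
    Σsplits [] φ = φ [] []
    Σsplits (x ∷ xs) φ = Σsplits xs (λ s r → φ (x ∷ s) r + φ s (x ∷ r))

    Σsplits-cong : ∀ xs {φ ψ} → (∀ s r → s ++ r ↭ xs → φ s r ≈ ψ s r) → Σsplits xs φ ≈ Σsplits xs ψ
    Σsplits-cong [] h = h [] [] refl
    Σsplits-cong (x ∷ xs) h = Σsplits-cong xs (λ s r π → +-cong (h (x ∷ s) r (prep x π)) (h s (x ∷ r) (trans (shift x s r) (prep x π))))

    Σsplits-+ : ∀ xs φ ψ → Σsplits xs (λ s r → φ s r + ψ s r) ≈ Σsplits xs φ + Σsplits xs ψ
    Σsplits-+ [] φ ψ = ≈-refl
    Σsplits-+ (x ∷ xs) φ ψ = ≈-trans (Σsplits-cong xs (λ s r _ → +-interchange _ _ _ _))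
      (Σsplits-+ xs (λ s r → φ (x ∷ s) r + φ s (x ∷ r)) (λ s r → ψ (x ∷ s) r + ψ s (x ∷ r)))

    Σsplits-* : ∀ xs b φ → Σsplits xs (λ s r → b * φ s r) ≈ b * Σsplits xs φ
    Σsplits-* [] b φ = ≈-refl
    Σsplits-* (x ∷ xs) b φ = ≈-trans (Σsplits-cong xs (λ s r _ → ≈-sym (distribˡ b _ _)))
      (Σsplits-* xs b (λ s r → φ (x ∷ s) r + φ s (x ∷ r)))

    Σsplits-pair : ∀ {b} {B : Set b} (L : List (Carrier × B)) xs (φ : List A → List A → B → Carrier) →
      Σsplits xs (λ s r → ⟨ L , φ s r ⟩) ≈ ⟨ L , (λ d → Σsplits xs (λ s r → φ s r d)) ⟩
    Σsplits-pair L [] φ = ≈-refl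
    Σsplits-pair L (x ∷ xs) φ = ≈-trans (Σsplits-cong xs (λ s r _ → ≈-sym (pair-+ L _ _)))
      (Σsplits-pair L xs (λ s r d → φ (x ∷ s) r d + φ s (x ∷ r) d))

    Σsplits-++ : ∀ xs ys φ → Σsplits (xs ++ ys) φ ≈ Σsplits xs (λ s r → Σsplits ys (λ s′ r′ → φ (s ++ s′) (r ++ r′)))
    Σsplits-++ [] ys φ = ≈-refl
    Σsplits-++ (x ∷ xs) ys φ = ≈-trans (Σsplits-++ xs ys _) (Σsplits-cong xs (λ s r _ → Σsplits-+ ys _ _))

    Σsplits-↭ : ∀ φ → (∀ {s s′ r r′} → s ↭ s′ → r ↭ r′ → φ s r ≈ φ s′ r′) → ∀ {xs ys} → xs ↭ ys → Σsplits xs φ ≈ Σsplits ys φ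
    Σsplits-↭ φ inv refl = ≈-refl
    Σsplits-↭ φ inv (prep x π) = Σsplits-↭ _ (λ α β → +-cong (inv (prep x α) β) (inv α (prep x β))) π
    -- Interchanging the middle terms matches the choices of exactly one of x and y; invariance of φ
    -- matches the choices of both and of neither.
    Σsplits-↭ φ inv {_ ∷ _ ∷ xs} (swap x y π) = ≈-trans
      (Σsplits-cong xs (λ s r _ → ≈-trans (+-interchange _ _ _ _)
        (+-cong (+-congʳ (inv (swap x y refl) refl)) (+-congˡ (inv refl (swap x y refl))))))
      (Σsplits-↭ _ (λ α β → +-cong (+-cong (inv (prep y (prep x α)) β) (inv (prep x α) (prep y β)))
                                   (+-cong (inv (prep y α) (prep x β)) (inv α (prep y (prep x β))))) π)
    Σsplits-↭ φ inv (trans π ρ) = ≈-trans (Σsplits-↭ φ inv π) (Σsplits-↭ φ inv ρ)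

    -- Sets the empty choice apart. Since ψ vanishes there, what remains is again a sum over all
    -- splits and can be recognised as a shuffle product. This separates the B″ that avoid the
    -- grafted members from those that meet them.
    Σsplits-peel : ∀ xs φ ψ → (∀ r → ψ [] r ≈ 0#) → (∀ x s r → x ∷ s ++ r ↭ xs → φ (x ∷ s) r ≈ ψ (x ∷ s) r) →
      Σsplits xs φ ≈ φ [] xs + Σsplits xs ψ
    Σsplits-peel [] φ ψ z h = ≈-trans (≈-sym (+-identityʳ _)) (+-congˡ (≈-sym (z [])))
    Σsplits-peel (x ∷ xs) φ ψ z h = begin
      Σsplits xs (λ s r → φ (x ∷ s) r + φ s (x ∷ r))                               ≈⟨ Σsplits-+ xs _ _ ⟩
      Σsplits xs (λ s r → φ (x ∷ s) r) + Σsplits xs (λ s r → φ s (x ∷ r))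
        ≈⟨ +-cong (Σsplits-cong xs (λ s r π → h x s r (prep x π)))
                  (Σsplits-peel xs (λ s r → φ s (x ∷ r)) (λ s r → ψ s (x ∷ r)) (λ r → z (x ∷ r))
                    (λ y s r π → h y s (x ∷ r) (trans (shift x (y ∷ s) r) (prep x π)))) ⟩
      A′ + (φ [] (x ∷ xs) + B′)                                                       ≈⟨ ≈-sym (+-assoc A′ (φ [] (x ∷ xs)) B′) ⟩
      (A′ + φ [] (x ∷ xs)) + B′                                                       ≈⟨ +-congʳ (+-comm A′ _) ⟩
      (φ [] (x ∷ xs) + A′) + B′                                                       ≈⟨ +-assoc _ A′ B′ ⟩
      φ [] (x ∷ xs) + (A′ + B′)                                                       ≈⟨ +-congˡ (≈-sym (Σsplits-+ xs _ _)) ⟩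
      φ [] (x ∷ xs) + Σsplits xs (λ s r → ψ (x ∷ s) r + ψ s (x ∷ r))                ∎
      where
      A′ = Σsplits xs (λ s r → ψ (x ∷ s) r)
      B′ = Σsplits xs (λ s r → ψ s (x ∷ r))

  Σlist : ∀ {a} {A : Set a} → List A → (A → Carrier) → Carrier
  Σlist [] ψ = 0#
  Σlist (x ∷ xs) ψ = ψ x + Σlist xs ψ

  Σlist-++ : ∀ {a} {A : Set a} (xs ys : List A) ψ → Σlist (xs ++ ys) ψ ≈ Σlist xs ψ + Σlist ys ψ
  Σlist-++ [] ys ψ = ≈-sym (+-identityˡ _)
  Σlist-++ (x ∷ xs) ys ψ = ≈-trans (+-congˡ (Σlist-++ xs ys ψ)) (≈-sym (+-assoc _ _ _))

  Σlist-concatMap : ∀ {a b} {A : Set a} {B : Set b} (g : B → List A) ψ (ψ′ : B → Carrier) → (∀ b → Σlist (g b) ψ ≈ ψ′ b) →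
    ∀ bs → Σlist (concatMap g bs) ψ ≈ Σlist bs ψ′
  Σlist-concatMap g ψ ψ′ h [] = ≈-refl
  Σlist-concatMap g ψ ψ′ h (b ∷ bs) = ≈-trans (Σlist-++ (g b) _ ψ) (+-cong (h b) (Σlist-concatMap g ψ ψ′ h bs))

  Σlist-splits : ∀ {a} {A : Set a} (xs : List A) ψ → Σlist (splits xs) ψ ≈ Σsplits xs (λ s r → ψ (s , r))
  Σlist-splits [] ψ = +-identityʳ _
  Σlist-splits (x ∷ xs) ψ = ≈-trans
    (Σlist-concatMap _ ψ (λ { (s , r) → ψ (x ∷ s , r) + ψ (s , x ∷ r) }) (λ _ → +-congˡ (+-identityʳ _)) (splits xs))
    (Σlist-splits xs _)

  pair-concatMap-keep : ∀ {a b} {A : Set a} {B : Set b} (G : B → List (Carrier × A)) (P : B → Bool) φ ψ →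
    (∀ x → P x ≡ true → ⟨ G x , φ ⟩ ≈ ψ x) → (∀ x → P x ≡ false → ψ x ≈ 0#) →
    ∀ xs → ⟨ concatMap G (keep P xs) , φ ⟩ ≈ Σlist xs ψ
  pair-concatMap-keep G P φ ψ h z [] = ≈-refl
  pair-concatMap-keep G P φ ψ h z (x ∷ xs) with P x in eq
  ... | true = ≈-trans (pair-++ (G x) _ φ) (+-cong (h x eq) (pair-concatMap-keep G P φ ψ h z xs))
  ... | false = ≈-trans (pair-concatMap-keep G P φ ψ h z xs) (≈-trans (≈-sym (+-identityˡ _)) (+-congʳ (≈-sym (z x eq))))

  -- q^(|B|-1), and 0 for the excluded B = ∅
  weight : ∀ {a} {A : Set a} → List A → Carrier
  weight [] = 0#
  weight (_ ∷ s) = pow q (length s)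

  -- `starF` discards the empty choice and `weight` gives it the value 0, so the sum may run over
  -- all splits.
  pair-starF : ∀ {n} k (H : HG n) es φ → ⟨ starF k H es , φ ⟩ ≈ Σsplits es (λ s r → weight s * ⟨ splitF k H s r , φ ⟩)
  pair-starF k H es φ = ≈-trans
    (pair-concatMap-keep _ _ φ (λ { (s , r) → weight s * ⟨ splitF k H s r , φ ⟩ })
      (λ { ([] , r) () ; (x ∷ s , r) _ → pair-scale (pow q (length s)) (splitF k H (x ∷ s) r) φ })
      (λ { ([] , r) _ → zeroˡ _ ; (x ∷ s , r) () }) (splits es))
    (Σlist-splits es _)

  -- Coefficients of shuffle products by recursion on the target construct.

  within : ∀ {n} → Sub n → Ent n → Bool
  within K e = carrier (proj₁ e) ⊆ᵇ K

  mutual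
    -- The recursion of `starF`, directed by the target instead of by fuel. The admissibility test
    -- of `splitF` is absorbed by the comparison with Y, which is admissible as the root of a
    -- construct.
    coefStar : ∀ {n} {H : HG n} → Construct H → List (Ent n) → Carrier
    coefStar C es = Σsplits es (λ s r → weight s * coefSplit C s r)

    coefSplit : ∀ {n} {H : HG n} → Construct H → List (Ent n) → List (Ent n) → Carrier
    coefSplit (node Y p f) s r = ind (Y ==ᵇ rootsU s) * coefKids f (r ++ kids s)

    coefKids : ∀ {n} {H : HG n} {Y : Sub n} → KidFamily {n} {H} {Y} → List (Ent n) → Carrier
    coefKids {n} {H} {Y} f es = Π (allSubsets n) (λ K → whenT (isCompᵇ (H ∖ʰ Y) K) (λ t → coefStar (f K t) (keep (within K) es)))

  comp-countˢ : ∀ {n} (H : HG n) Y K {k} → T (nonemptyᵇ Y ∧ (Y ⊆ᵇ carrier H)) → T (isCompᵇ (H ∖ʰ Y) K) →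
    countˢ (carrier H) ≤ suc k → countˢ (carrier (restrict (H ∖ʰ Y) K)) ≤ k
  comp-countˢ H Y K p t h with T-∧⁻ {nonemptyᵇ Y} p
  ... | ne , Y⊆H with nonempty⁻ Y ne
  ...   | y , y∈Y = ≤-pred (≤-trans (countˢ-strict (carrier (restrict (H ∖ʰ Y) K)) (carrier H)
            (λ x i → proj₁ (∈-∖⁻ H Y (proj₂ (∈-∩⁻ K (carrier (H ∖ʰ Y)) i)))) (⊆ᵇ⁻ Y (carrier H) Y⊆H y∈Y)
            (λ i → proj₂ (∈-∖⁻ H Y (proj₂ (∈-∩⁻ K (carrier (H ∖ʰ Y)) i))) y∈Y)) h)

  root-valid : ∀ {n} {H : HG n} (C : Construct H) → T (nonemptyᵇ (root C) ∧ (root C ⊆ᵇ carrier H))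
  root-valid (node Y p f) = recompute (T? _) p

  root-count : ∀ {n} (H : HG n) Y → T (nonemptyᵇ Y ∧ (Y ⊆ᵇ carrier H)) → ¬ countˢ (carrier H) ≤ 0
  root-count H Y p h with T-∧⁻ {nonemptyᵇ Y} p
  ... | ne , Y⊆H with nonempty⁻ Y ne
  ...   | y , y∈Y = n≮0 (≤-trans (countˢ-strict ∅ˢ (carrier H) (λ x i → ⊥-elim (∉-∅ˢ x i)) (⊆ᵇ⁻ Y (carrier H) Y⊆H y∈Y) (∉-∅ˢ y)) h)

  ==ᵇ-false : ∀ {n} {Y Y′ : Sub n} → Y ≢ Y′ → ∀ x → ind (Y ==ᵇ Y′) * x ≈ 0#
  ==ᵇ-false {Y = Y} {Y′} ne x = ≈-trans (*-congʳ (reflexive (cong ind (¬T⇒≡ (ne ∘ ==ᵇ⁻ Y Y′))))) (zeroˡ x)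

  -- A record, since case analysis on the test inside splitF would otherwise unfold rootsU in these statements.
  record SplitCases {p n} (k : ℕ) (H : HG n) (s r : List (Ent n)) (P : Lin H → Set p) : Set p where
    field
      invalid : ¬ T (nonemptyᵇ (rootsU s) ∧ (rootsU s ⊆ᵇ carrier H)) → P []
      valid   : (t : T (nonemptyᵇ (rootsU s) ∧ (rootsU s ⊆ᵇ carrier H))) →
                P (nodeL H (rootsU s) t (λ K _ → starF k (restrict (H ∖ʰ rootsU s) K) (keep (within K) (r ++ kids s))))

  splitF-elim : ∀ {p n} k (H : HG n) s r (P : Lin H → Set p) → SplitCases k H s r P → P (splitF (suc k) H s r)
  splitF-elim k H s r P cases with T? (nonemptyᵇ (rootsU s) ∧ (rootsU s ⊆ᵇ carrier H))
  ... | no ¬t = SplitCases.invalid cases ¬t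
  ... | yes t = SplitCases.valid cases t

  mutual
    -- Each level removes a nonempty root, so fuel bounding the size of the carrier suffices. If the
    -- chosen roots fail the test in `splitF`, their union differs from the root of C and both
    -- coefficients are 0.
    coef-starF : ∀ k {n} {H : HG n} (C : Construct H) es → countˢ (carrier H) ≤ k → coef C (starF k H es) ≈ coefStar C es
    coef-starF k {H = H} C es h = ≈-trans (coef-pair C (starF k H es)) (≈-trans (pair-starF k H es _)
      (Σsplits-cong es (λ s r _ → *-congˡ (≈-trans (≈-sym (coef-pair C (splitF k H s r))) (coef-splitF k C s r h)))))

    coef-splitF : ∀ k {n} {H : HG n} (C : Construct H) s r → countˢ (carrier H) ≤ k → coef C (splitF k H s r) ≈ coefSplit C s r
    coef-splitF zero {H = H} (node Y p f) s r h = ⊥-elim (root-count H Y (root-valid (node {H = H} Y p f)) h)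
    coef-splitF (suc k) {n} {H} (node Y p f) s r h = splitF-elim k H s r (λ L → coef (node Y p f) L ≈ coefSplit (node Y p f) s r) record
      { invalid = λ ¬t → ≈-sym (==ᵇ-false {Y = Y} {rootsU s} (λ e → ¬t (subst (λ V → T (nonemptyᵇ V ∧ (V ⊆ᵇ carrier H))) e (root-valid (node {H = H} Y p f)))) _)
      ; valid = λ t → coef-node k p f (rootsU s) t (r ++ kids s) h }

    coef-node : ∀ k {n} {H : HG n} {Y} .p (f : KidFamily {n} {H} {Y}) Y′ (t : T (nonemptyᵇ Y′ ∧ (Y′ ⊆ᵇ carrier H))) es → countˢ (carrier H) ≤ suc k →
      coef (node Y p f) (nodeL H Y′ t (λ K _ → starF k (restrict (H ∖ʰ Y′) K) (keep (within K) es))) ≈ ind (Y ==ᵇ Y′) * coefKids f es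
    coef-node k {n} {H} {Y} p f Y′ t es h with ≡-dec Bool._≟_ Y Y′
    ... | no Y≢ = ≈-trans (coef-nodeL-≢ p t f _ Y≢) (≈-sym (zeroˡ _))
    ... | yes ≡-refl = ≈-trans (coef-nodeL p t f _) (≈-trans
              (Π-cong (allSubsets n) (λ K _ → whenT-cong (isCompᵇ (H ∖ʰ Y) K)
                 (λ t′ → coef-starF k (f K t′) (keep (within K) es) (comp-countˢ H Y K t t′ h))))
              (≈-sym (*-identityˡ _)))

-- Rearranging lists of members, their roots and their subtrees.

module _ {a} {A : Set a} where

  ++-exchange-↭ : ∀ (xs ys zs : List A) → (xs ++ ys) ++ zs ↭ (xs ++ zs) ++ ys
  ++-exchange-↭ xs ys zs = ↭-trans (↭-reflexive (++-assoc xs ys zs))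
    (↭-trans (++⁺ˡ xs (++-comm ys zs)) (↭-reflexive (sym (++-assoc xs zs ys))))

  -- Matching on b instead of on `T? b` allows b to be generalised to a variable together with the
  -- type of its proof, as the case distinction on `slot` demands.
  pickᵇ : (b : Bool) → (.(T b) → A) → List A
  pickᵇ true k = k tt ∷ []
  pickᵇ false k = []

  pickᵇ-yes : ∀ {b} (t : T b) (k : .(T b) → A) → pickᵇ b k ≡ k t ∷ []
  pickᵇ-yes {true} t k = ≡-refl

  pickᵇ-no : ∀ {b} → ¬ T b → (k : .(T b) → A) → pickᵇ b k ≡ []
  pickᵇ-no {true} ¬t k = ⊥-elim (¬t tt)
  pickᵇ-no {false} ¬t k = ≡-refl

  concatMap-↭ : ∀ {b} {B : Set b} (f : A → List B) {xs ys} → xs ↭ ys → concatMap f xs ↭ concatMap f ys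
  concatMap-↭ f refl = refl
  concatMap-↭ f (prep x π) = ++⁺ˡ (f x) (concatMap-↭ f π)
  concatMap-↭ f {_ ∷ _ ∷ xs} (swap x y π) = ↭-trans (↭-reflexive (sym (++-assoc (f x) (f y) _)))
    (↭-trans (++⁺ (++-comm (f x) (f y)) (concatMap-↭ f π)) (↭-reflexive (++-assoc (f y) (f x) _)))
  concatMap-↭ f (trans π ρ) = trans (concatMap-↭ f π) (concatMap-↭ f ρ)

map-pickᵇ : ∀ {a b} {A : Set a} {B : Set b} (f : A → B) b (k : .(T b) → A) → map f (pickᵇ b k) ≡ pickᵇ b (λ t → f (k t))
map-pickᵇ f true k = ≡-refl
map-pickᵇ f false k = ≡-refl

concatMap-pickᵇ : ∀ {a b} {A : Set a} {B : Set b} (P : A → Bool) (f : A → B) xs →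
  concatMap (λ x → pickᵇ (P x) (λ _ → f x)) xs ≡ map f (keep P xs)
concatMap-pickᵇ P f [] = ≡-refl
concatMap-pickᵇ P f (x ∷ xs) with P x
... | true = cong (f x ∷_) (concatMap-pickᵇ P f xs)
... | false = concatMap-pickᵇ P f xs

concatMap-allSubsets-suc : ∀ {b} {B : Set b} m (f : Sub (suc m) → List B) →
  concatMap f (allSubsets (suc m)) ≡ concatMap (f ∘ (true ∷_)) (allSubsets m) ++ concatMap (f ∘ (false ∷_)) (allSubsets m)
concatMap-allSubsets-suc m f = ≡-trans (concatMap-++ f (map (true ∷_) (allSubsets m)) (map (false ∷_) (allSubsets m)))
  (cong₂ _++_ (concatMap-map f (true ∷_) (allSubsets m)) (concatMap-map f (false ∷_) (allSubsets m)))

bigUnion-↭ : ∀ {n} {L L′ : List (Sub n)} → L ↭ L′ → bigUnion L ≡ bigUnion L′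
bigUnion-↭ {L = L} {L′} π = ∈ˢ-ext _ _ (λ x → along L π) (λ x → along L′ (↭-sym π))
  where
  along : ∀ M {M′} {x} → M ↭ M′ → x ∈ˢ bigUnion M → x ∈ˢ bigUnion M′
  along M π i with ∈-bigUnion⁻ M i
  ... | Z , j , k = ∈-bigUnion⁺ (∈-resp-↭ π j) k

bigUnion-++ : ∀ {n} (L M : List (Sub n)) → bigUnion (L ++ M) ≡ bigUnion L ∪ˢ bigUnion M
bigUnion-++ L M = ∈ˢ-ext _ _ to from
  where
  to : ∀ x → x ∈ˢ bigUnion (L ++ M) → x ∈ˢ (bigUnion L ∪ˢ bigUnion M)
  to x i with ∈-bigUnion⁻ (L ++ M) i
  ... | Z , j , k with ∈-++⁻ L j
  ...   | inj₁ l = ∈-∪⁺ (bigUnion L) (bigUnion M) (inj₁ (∈-bigUnion⁺ l k))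
  ...   | inj₂ l = ∈-∪⁺ (bigUnion L) (bigUnion M) (inj₂ (∈-bigUnion⁺ l k))
  from : ∀ x → x ∈ˢ (bigUnion L ∪ˢ bigUnion M) → x ∈ˢ bigUnion (L ++ M)
  from x i with ∈-∪⁻ (bigUnion L) (bigUnion M) i
  ... | inj₁ j with ∈-bigUnion⁻ L j
  ...   | Z , k , l = ∈-bigUnion⁺ (∈-++⁺ˡ k) l
  from x i | inj₂ j with ∈-bigUnion⁻ M j
  ...   | Z , k , l = ∈-bigUnion⁺ (∈-++⁺ʳ L k) l

bigUnion-[_] : ∀ {n} (Z : Sub n) → bigUnion (Z ∷ []) ≡ Z
bigUnion-[ Z ] = ∈ˢ-ext _ _ to (λ x i → ∈-∪⁺ Z ∅ˢ (inj₁ i))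
  where
  to : ∀ x → x ∈ˢ bigUnion (Z ∷ []) → x ∈ˢ Z
  to x i with ∈-∪⁻ Z ∅ˢ i
  ... | inj₁ j = j
  ... | inj₂ j = ⊥-elim (∉-∅ˢ x j)

module _ {n : ℕ} where

  hgs : List (Ent n) → List (HG n)
  hgs = map proj₁

  rooteds : List (Ent n) → List (Rooted {n})
  rooteds = map (λ e → proj₁ e , root (proj₂ e))

  rootsU-↭ : ∀ {s s′ : List (Ent n)} → s ↭ s′ → rootsU s ≡ rootsU s′
  rootsU-↭ π = bigUnion-↭ (map⁺ (λ e → root (proj₂ e)) π)

  rootsU-++ : ∀ (s t : List (Ent n)) → rootsU (s ++ t) ≡ rootsU s ∪ˢ rootsU t
  rootsU-++ s t = ≡-trans (cong bigUnion (map-++ (λ e → root (proj₂ e)) s t)) (bigUnion-++ (map (λ e → root (proj₂ e)) s) (map (λ e → root (proj₂ e)) t))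

  rootsUnion-rooteds : ∀ s → rootsUnion (rooteds s) ≡ rootsU s
  rootsUnion-rooteds [] = ≡-refl
  rootsUnion-rooteds (e ∷ s) = cong (root (proj₂ e) ∪ˢ_) (rootsUnion-rooteds s)

  rooteds-hgs : ∀ s → map proj₁ (rooteds s) ≡ hgs s
  rooteds-hgs [] = ≡-refl
  rooteds-hgs (e ∷ s) = cong (proj₁ e ∷_) (rooteds-hgs s)

  pickEnt : (P : Sub n → Bool) (G : Sub n → HG n) → ((Z : Sub n) → .(T (P Z)) → Construct (G Z)) → Sub n → List (Ent n)
  pickEnt P G C Z = pickᵇ (P Z) (λ t → G Z , C Z t)

  mutual
    ents-pick : ∀ P G C → ents P G C ≡ concatMap (pickEnt P G C) (allSubsets n)
    ents-pick P G C = concatMap-cong (ents-pick-at P G C) (allSubsets n)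

    -- The left side is the local function of `ents`, which has no name outside; it is inferred from
    -- the use in `ents-pick`.
    ents-pick-at : ∀ (P : Sub n → Bool) (G : Sub n → HG n) (C : (Z : Sub n) → .(T (P Z)) → Construct (G Z)) Z → _ ≡ pickEnt P G C Z
    ents-pick-at P G C Z with T? (P Z)
    ... | yes t = sym (pickᵇ-yes t (λ t → G Z , C Z t))
    ... | no ¬t = sym (pickᵇ-no ¬t (λ t → G Z , C Z t))

  hgs-ents : ∀ P G C → hgs (ents P G C) ≡ map G (keep P (allSubsets n))
  hgs-ents P G C = ≡-trans (cong hgs (ents-pick P G C)) (≡-trans (map-concatMap proj₁ (pickEnt P G C) (allSubsets n))
    (≡-trans (concatMap-cong (λ Z → map-pickᵇ proj₁ (P Z) (λ t → G Z , C Z t)) (allSubsets n)) (concatMap-pickᵇ P G (allSubsets n))))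

  kidsE : Ent n → List (Ent n)
  kidsE (G , node X p f) = kidsOf G X f

  kids-concatMap : ∀ es → kids es ≡ concatMap kidsE es
  kids-concatMap [] = ≡-refl
  kids-concatMap ((G , node X p f) ∷ es) = cong (kidsOf G X f ++_) (kids-concatMap es)

  kids-++ : ∀ s t → kids (s ++ t) ≡ kids s ++ kids t
  kids-++ s t = ≡-trans (kids-concatMap (s ++ t)) (≡-trans (concatMap-++ kidsE s t) (sym (cong₂ _++_ (kids-concatMap s) (kids-concatMap t))))

  kids-↭ : ∀ {s t} → s ↭ t → kids s ↭ kids t
  kids-↭ {s} {t} π = ↭-trans (↭-reflexive (kids-concatMap s)) (↭-trans (concatMap-↭ kidsE π) (↭-reflexive (sym (kids-concatMap t))))

  hgs-kids : ∀ s → hgs (kids s) ≡ concatMap kidHGs (rooteds s)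
  hgs-kids [] = ≡-refl
  hgs-kids ((G , node X p f) ∷ s) = ≡-trans (map-++ proj₁ (kidsOf G X f) (kids s)) (cong₂ _++_ (hgs-ents (isCompᵇ (G ∖ʰ X)) (restrict (G ∖ʰ X)) f) (hgs-kids s))

  hgs-keep : ∀ K es → keep (λ G → carrier G ⊆ᵇ K) (hgs es) ≡ hgs (keep (λ e → carrier (proj₁ e) ⊆ᵇ K) es)
  hgs-keep K es = keep-map (λ G → carrier G ⊆ᵇ K) proj₁ es

-- Independence of the order of members; simultaneous substitution.

module Invariance {c ℓ} (R : CommutativeRing c ℓ) (q : CommutativeRing.Carrier R) where
  open CommutativeRing R using (Carrier; _≈_; _+_; _*_; setoid; reflexive; *-cong; *-congˡ; *-assoc; *-identityˡ) renaming (refl to ≈-refl; sym to ≈-sym; trans to ≈-trans)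
  open Shuffle R q
  open Pairing R q
  open import Relation.Binary.Reasoning.Setoid setoid

  weight-↭ : ∀ {a} {A : Set a} {s s′ : List A} → s ↭ s′ → weight s ≈ weight s′
  weight-↭ {s = []} {[]} π = ≈-refl
  weight-↭ {s = []} {_ ∷ _} π with () ← ↭-length π
  weight-↭ {s = _ ∷ _} {[]} π with () ← ↭-length π
  weight-↭ {s = _ ∷ s} {_ ∷ s′} π = reflexive (cong (pow q) (suc-injective (↭-length π)))

  pow-+ : ∀ a m → pow q (a ℕ.+ m) ≈ pow q a * pow q m
  pow-+ zero m = ≈-sym (*-identityˡ _)
  pow-+ (suc a) m = ≈-trans (*-congˡ (pow-+ a m)) (≈-sym (*-assoc q _ _))

  -- In the application s is B without a₀ and x ∷ t is B′, so the two exponents are |B| - 1 and |B′|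
  -- - 1.
  weight-++ : ∀ {a} {A : Set a} (s : List A) x t → weight (s ++ x ∷ t) ≈ pow q (length s) * pow q (length t)
  weight-++ [] x t = ≈-sym (*-identityˡ _)
  weight-++ (y ∷ s) x t = ≈-trans (reflexive (cong (pow q) (≡-trans (length-++ s) (+-suc (length s) (length t))))) (pow-+ (suc (length s)) (length t))

  mutual
    coefStar-↭ : ∀ {n} {H : HG n} (C : Construct H) {es es′} → es ↭ es′ → coefStar C es ≈ coefStar C es′
    coefStar-↭ C = Σsplits-↭ (λ s r → weight s * coefSplit C s r) (λ α β → *-cong (weight-↭ α) (coefSplit-↭ C α β))

    coefSplit-↭ : ∀ {n} {H : HG n} (C : Construct H) {s s′ r r′} → s ↭ s′ → r ↭ r′ → coefSplit C s r ≈ coefSplit C s′ r′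
    coefSplit-↭ (node Y p f) α β = *-cong (reflexive (cong (λ U → ind (Y ==ᵇ U)) (rootsU-↭ α))) (coefKids-↭ f (++⁺ β (kids-↭ α)))

    coefKids-↭ : ∀ {n} {H : HG n} {Y} (f : KidFamily {n} {H} {Y}) {es es′} → es ↭ es′ → coefKids f es ≈ coefKids f es′
    coefKids-↭ {n} {H} {Y} f π = Π-cong (allSubsets n) (λ K _ → whenT-cong (isCompᵇ (H ∖ʰ Y) K) (λ t → coefStar-↭ (f K t) (keep-↭ (within K) π)))

  -- Both sides vanish unless Y = U, so this equation may be assumed. It identifies the components
  -- below the root of C with those obtained by opening the chosen members.
  ind-pair : ∀ {a n} {A : Set a} (Y U : Sub n) {x} (L : List (Carrier × A)) (φ : A → Carrier) →
    (Y ≡ U → x ≈ ⟨ L , φ ⟩) → ind (Y ==ᵇ U) * x ≈ ⟨ L , (λ d → ind (Y ==ᵇ U) * φ d) ⟩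
  ind-pair Y U {x} L φ h with T? (Y ==ᵇ U)
  ... | yes t = ≈-trans (*-congˡ (h (==ᵇ⁻ Y U t))) (≈-sym (pair-* L _ φ))
  ... | no ¬t = ≈-trans (==ᵇ-false (¬t ∘ ==ᵇ⁺) x) (≈-sym (pair-0 L (λ d → ==ᵇ-false (¬t ∘ ==ᵇ⁺) (φ d))))

  -- Substituting in all slots at once reduces to substituting in one slot at a time, in any order.
  module _ {n : ℕ} (Inv : List (HG n) → Set) (Inv-↭ : ∀ {hs hs′} → hs ↭ hs′ → Inv hs → Inv hs′)
           (Φ : List (Ent n) → Carrier) (Φ-↭ : ∀ {es es′} → es ↭ es′ → Φ es ≈ Φ es′) where

    pair-expandAll-subst : ∀ m {F : Sub m → Set} (fs : (K : Sub m) → List (Carrier × F K))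
      (w : Sub m → List (Ent n)) (zh : Sub m → List (HG n)) (z : (K : Sub m) → F K → List (Ent n)) →
      (∀ K x → hgs (z K x) ≡ zh K) →
      (∀ hs K → Inv (hs ++ zh K) → Inv (hs ++ hgs (w K))) →
      (∀ base K → Inv (hgs base ++ zh K) → Φ (base ++ w K) ≈ ⟨ fs K , (λ x → Φ (base ++ z K x)) ⟩) →
      ∀ base → Inv (hgs base ++ concatMap zh (allSubsets m)) →
      Φ (base ++ concatMap w (allSubsets m)) ≈ ⟨ expandAll m fs , (λ g → Φ (base ++ concatMap (λ K → z K (g K)) (allSubsets m))) ⟩
    pair-expandAll-subst zero {F} fs w zh z hz graft step base inv = begin
      Φ (base ++ (w [] ++ [])) ≈⟨ reflexive (cong (λ l → Φ (base ++ l)) (++-identityʳ (w []))) ⟩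
      Φ (base ++ w []) ≈⟨ step base [] (subst (λ l → Inv (hgs base ++ l)) (++-identityʳ (zh [])) inv) ⟩
      ⟨ fs [] , (λ x → Φ (base ++ z [] x)) ⟩ ≈⟨ pair-cong (fs []) (λ x → reflexive (cong (λ l → Φ (base ++ l)) (sym (++-identityʳ (z [] x))))) ⟩
      ⟨ fs [] , (λ x → Φ (base ++ (z [] x ++ []))) ⟩
        ≈⟨ ≈-sym (pair-expandAll-zero fs (λ g → Φ (base ++ (z [] (g []) ++ []))) (λ g g′ e → reflexive (cong (λ x → Φ (base ++ (z [] x ++ []))) (e [])))) ⟩
      _ ∎
    pair-expandAll-subst (suc m) {F} fs w zh z hz graft step base inv = begin
      Φ (base ++ concatMap w (allSubsets (suc m)))
        ≈⟨ reflexive (cong Φ (≡-trans (cong (base ++_) (concatMap-allSubsets-suc m w)) (sym (++-assoc base Wt Wf)))) ⟩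
      Φ ((base ++ Wt) ++ Wf)
        -- `w K` are the fine members in slot K, `z K x` the single construct put in their place,
        -- and `zh K` its hypergraph. The false half is replaced while the true half is still fine;
        -- `Inv` for this mixed family comes from grafting the whole true half.
        ≈⟨ pair-expandAll-subst m (fs ∘ (false ∷_)) (w ∘ (false ∷_)) (zh ∘ (false ∷_)) (λ K → z (false ∷ K)) (λ K → hz (false ∷ K))
             (λ hs K → graft hs (false ∷ K)) (λ b K → step b (false ∷ K)) (base ++ Wt) inv-Wt ⟩
      ⟨ M , (λ h → Φ ((base ++ Wt) ++ zf h)) ⟩ ≈⟨ pair-cong M (λ h → Φ-↭ (++-exchange-↭ base Wt (zf h))) ⟩
      ⟨ M , (λ h → Φ ((base ++ zf h) ++ Wt)) ⟩
        ≈⟨ pair-cong M (λ h → pair-expandAll-subst m (fs ∘ (true ∷_)) (w ∘ (true ∷_)) (zh ∘ (true ∷_)) (λ K → z (true ∷ K)) (λ K → hz (true ∷ K))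
             (λ hs K → graft hs (true ∷ K)) (λ b K → step b (true ∷ K)) (base ++ zf h) (inv-zf h)) ⟩
      -- The false half was summed first, whereas `expandAll` has the true half outermost.
      ⟨ M , (λ h → ⟨ L , (λ g → Φ ((base ++ zf h) ++ zt g)) ⟩) ⟩ ≈⟨ pair-swap M L _ ⟩
      ⟨ L , (λ g → ⟨ M , (λ h → Φ ((base ++ zf h) ++ zt g)) ⟩) ⟩ ≈⟨ pair-cong L (λ g → pair-cong M (λ h → Φ-↭ (merge g h))) ⟩
      ⟨ L , (λ g → ⟨ M , (λ h → Φ (base ++ concatMap (λ K → z K (join {F = F} g h K)) (allSubsets (suc m)))) ⟩) ⟩
        ≈⟨ ≈-sym (pair-expandAll-suc m fs (λ g → Φ (base ++ concatMap (λ K → z K (g K)) (allSubsets (suc m))))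
             (λ g g′ e → reflexive (cong (λ l → Φ (base ++ l)) (concatMap-cong (λ K → cong (z K) (e K)) (allSubsets (suc m)))))) ⟩
      ⟨ expandAll (suc m) fs , (λ g → Φ (base ++ concatMap (λ K → z K (g K)) (allSubsets (suc m)))) ⟩ ∎
      where
      L = expandAll m (fs ∘ (true ∷_))
      M = expandAll m (fs ∘ (false ∷_))
      Wt = concatMap (w ∘ (true ∷_)) (allSubsets m)
      Wf = concatMap (w ∘ (false ∷_)) (allSubsets m)
      Zt = concatMap (zh ∘ (true ∷_)) (allSubsets m)
      Zf = concatMap (zh ∘ (false ∷_)) (allSubsets m)
      zt : ((K : Sub m) → F (true ∷ K)) → List (Ent n)
      zt g = concatMap (λ K → z (true ∷ K) (g K)) (allSubsets m)
      zf : ((K : Sub m) → F (false ∷ K)) → List (Ent n)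
      zf h = concatMap (λ K → z (false ∷ K) (h K)) (allSubsets m)
      merge : ∀ g h → (base ++ zf h) ++ zt g ↭ base ++ concatMap (λ K → z K (join {F = F} g h K)) (allSubsets (suc m))
      merge g h = ↭-trans (++-exchange-↭ base (zf h) (zt g)) (↭-reflexive (≡-trans (++-assoc base (zt g) (zf h))
        (cong (base ++_) (sym (concatMap-allSubsets-suc m (λ K → z K (join {F = F} g h K)))))))
      inv₁ : Inv ((hgs base ++ Zt) ++ Zf)
      inv₁ = subst Inv (≡-trans (cong (hgs base ++_) (concatMap-allSubsets-suc m zh)) (sym (++-assoc (hgs base) Zt Zf))) inv
      graft-all : ∀ hs Ks → Inv (hs ++ concatMap (zh ∘ (true ∷_)) Ks) → Inv (hs ++ hgs (concatMap (w ∘ (true ∷_)) Ks))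
      graft-all hs [] i = i
      graft-all hs (K ∷ Ks) i = subst Inv
        (≡-trans (++-assoc hs _ _) (cong (hs ++_) (sym (map-++ proj₁ (w (true ∷ K)) (concatMap (w ∘ (true ∷_)) Ks)))))
        (graft-all (hs ++ hgs (w (true ∷ K))) Ks
          (Inv-↭ (++-exchange-↭ hs (concatMap (zh ∘ (true ∷_)) Ks) (hgs (w (true ∷ K))))
            (graft (hs ++ concatMap (zh ∘ (true ∷_)) Ks) (true ∷ K)
              (Inv-↭ (↭-trans (↭-reflexive (sym (++-assoc hs (zh (true ∷ K)) _))) (++-exchange-↭ hs (zh (true ∷ K)) _)) i))))
      inv-Wt : Inv (hgs (base ++ Wt) ++ Zf)
      inv-Wt = subst (λ l → Inv (l ++ Zf)) (sym (map-++ proj₁ base Wt))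
        (Inv-↭ (++-exchange-↭ (hgs base) Zf (hgs Wt)) (graft-all (hgs base ++ Zf) (allSubsets m) (Inv-↭ (++-exchange-↭ (hgs base) Zt Zf) inv₁)))
      inv-zf : ∀ h → Inv (hgs (base ++ zf h) ++ Zt)
      inv-zf h = subst (λ l → Inv (l ++ Zt))
        (sym (≡-trans (map-++ proj₁ base (zf h)) (cong (hgs base ++_) (≡-trans (map-concatMap proj₁ (λ K → z (false ∷ K) (h K)) (allSubsets m))
          (concatMap-cong (λ K → hz (false ∷ K) (h K)) (allSubsets m))))))
        (Inv-↭ (++-exchange-↭ (hgs base) Zt Zf) inv₁)

-- The substitution formula for coefficients.

module Substitution {c ℓ} (R : CommutativeRing c ℓ) (q : CommutativeRing.Carrier R)
  {n : ℕ} {𝔘 : HG n → Set} {Ξ : Team n → Set} (clan : StrictClan 𝔘 Ξ) (assoc : Associative Ξ) (resp : RespectsTeamEq Ξ) where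
  open CommutativeRing R using (Carrier; _≈_; _+_; _*_; setoid; reflexive; +-cong; +-congʳ; +-comm; +-identityʳ; *-cong; *-congˡ; *-assoc; *-identityˡ; *-identityʳ; zeroˡ; zeroʳ) renaming (refl to ≈-refl; sym to ≈-sym; trans to ≈-trans)
  open Shuffle R q
  open Pairing R q
  open Invariance R q
  open Clan clan assoc resp
  open import Relation.Binary.Reasoning.Setoid setoid

  withinHG : Sub n → HG n → Bool
  withinHG K G = carrier G ⊆ᵇ K

  -- The situation just below a root Y: every member lies in a component of H minus Y, and each
  -- component supports its share. Stating this for the whole list allows permuting and grafting
  -- before the list is cut into components.
  record Layer (H : HG n) (Y : Sub n) (hs : List (HG n)) : Set where
    field
      supports : ∀ K → T (isCompᵇ (H ∖ʰ Y) K) → Supports Ξ (restrict (H ∖ʰ Y) K) (keep (withinHG K) hs)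
      placed   : ∀ {G} → G ∈ hs → ∃ λ K → T (isCompᵇ (H ∖ʰ Y) K) × T (carrier G ⊆ᵇ K)

    inhabited : ∀ {G} → G ∈ hs → T (nonemptyᵇ (carrier G))
    inhabited i with placed i
    ... | K , t , h = Supports.inhabited (supports K t) (∈-keep⁺ (withinHG K) i h)

  module _ {H : HG n} {Y : Sub n} where
    open Layer

    Layer-↭ : ∀ {hs hs′} → hs ↭ hs′ → Layer H Y hs → Layer H Y hs′
    Layer-↭ π Λ = record
      { supports = λ K t → Supports-↭ (keep-↭ (withinHG K) π) (supports Λ K t)
      ; placed = λ i → placed Λ (∈-resp-↭ (↭-sym π) i) }

    comp-determined : ∀ {G G′ : HG n} {K K′} → T (isCompᵇ (H ∖ʰ Y) K) → T (isCompᵇ (H ∖ʰ Y) K′) → T (nonemptyᵇ (carrier G′)) →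
      T (carrier G ⊆ᵇ K) → (∀ x → x ∈ˢ carrier G′ → x ∈ˢ carrier G) → T (carrier G′ ⊆ᵇ K′) → K′ ≡ K
    comp-determined {G} {G′} {K} {K′} t t′ ne G⊆K G′⊆G G′⊆K′ with nonempty⁻ (carrier G′) ne
    ... | x , x∈ = comp-unique (H ∖ʰ Y) t′ t (⊆ᵇ⁻ (carrier G′) K′ G′⊆K′ x∈) (⊆ᵇ⁻ (carrier G) K G⊆K (G′⊆G x x∈))

    -- In the component containing G₀ its team is grafted. Any other component contains neither G₀
    -- nor a member of Gs′, as these are nonempty and lie inside G₀.
    Layer-graft : ∀ hs {G₀ Gs′} → Layer H Y (hs ++ G₀ ∷ []) → Supports Ξ G₀ Gs′ → Layer H Y (hs ++ Gs′)
    Layer-graft hs {G₀} {Gs′} Λ S with placed Λ (∈-++⁺ʳ hs (here ≡-refl))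
    ... | K₀ , t₀ , G₀⊆K₀ = record { supports = sup ; placed = pl ∘ ∈-++⁻ hs }
      where
      inside : ∀ {G} → G ∈ Gs′ → T (carrier G ⊆ᵇ K₀)
      inside {G} i = ⊆ᵇ⁺ (carrier G) K₀ (λ x x∈ → ⊆ᵇ⁻ (carrier G₀) K₀ G₀⊆K₀ (Supports-⊆ S i x∈))
      pl : ∀ {G} → G ∈ hs ⊎ G ∈ Gs′ → ∃ λ K → T (isCompᵇ (H ∖ʰ Y) K) × T (carrier G ⊆ᵇ K)
      pl (inj₁ i) = placed Λ (∈-++⁺ˡ i)
      pl (inj₂ i) = K₀ , t₀ , inside i
      sup : ∀ K → T (isCompᵇ (H ∖ʰ Y) K) → Supports Ξ (restrict (H ∖ʰ Y) K) (keep (withinHG K) (hs ++ Gs′))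
      sup K t with T? (carrier G₀ ⊆ᵇ K)
      ... | yes G₀⊆K = subst (Supports Ξ _)
              (sym (≡-trans (keep-++ (withinHG K) hs Gs′) (cong (keep (withinHG K) hs ++_) (keep-all (withinHG K) Gs′
                (λ G i → ⊆ᵇ⁺ (carrier G) K (λ x x∈ → ⊆ᵇ⁻ (carrier G₀) K G₀⊆K (Supports-⊆ S i x∈)))))))
              (Supports-graft (subst (Supports Ξ _)
                (≡-trans (keep-++ (withinHG K) hs (G₀ ∷ [])) (cong (keep (withinHG K) hs ++_) (keep-all (withinHG K) (G₀ ∷ []) (λ { G (here ≡-refl) → G₀⊆K }))))
                (supports Λ K t)) S)
      ... | no G₀⊈K = subst (Supports Ξ _)
              (≡-trans (keep-++ (withinHG K) hs (G₀ ∷ [])) (≡-trans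
                (cong (keep (withinHG K) hs ++_) (≡-trans (keep-none (withinHG K) (G₀ ∷ []) (λ { G (here ≡-refl) → G₀⊈K }))
                  (sym (keep-none (withinHG K) Gs′ (λ G i h → G₀⊈K (subst (λ L → T (carrier G₀ ⊆ᵇ L))
                    (sym (comp-determined {G₀} {G} t₀ t (Supports.inhabited S i) G₀⊆K₀ (λ x → Supports-⊆ S i) h)) G₀⊆K₀))))))
                (sym (keep-++ (withinHG K) hs Gs′))))
              (supports Λ K t)

  Layer-opened : ∀ {H : HG n} r s → Supports Ξ H (r ++ map proj₁ s) → (∀ {g} → g ∈ s → IsRooted g) → s ≢ [] →
    Layer H (rootsUnion s) (r ++ concatMap kidHGs s)
  Layer-opened r s S rooted s≢[] = record { supports = Supports-opened ; placed = opened-inComp }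
    where open Opening r s S rooted s≢[]

  rooteds-rooted : ∀ (s : List (Ent n)) {g} → g ∈ rooteds s → IsRooted g
  rooteds-rooted (e ∷ s) (here ≡-refl) = root-valid (proj₂ e)
  rooteds-rooted (e ∷ s) (there i) = rooteds-rooted s i

  rooteds-≢[] : ∀ (s : List (Ent n)) → s ≢ [] → rooteds s ≢ []
  rooteds-≢[] [] h _ = h ≡-refl
  rooteds-≢[] (_ ∷ _) h ()

  -- The coefficient form of ∗(δ″) = ∗(δ[∗(δ′)]). The fuel k may be any bound, since a recursive
  -- call of `starF` receives the fuel of its parent minus one, which can exceed the size of the
  -- component.
  Subst : {H : HG n} → Construct H → Set ℓ
  Subst {H} C = ∀ rest G₀ es′ k → countˢ (carrier G₀) ≤ k → Supports Ξ H (hgs rest ++ G₀ ∷ []) → Supports Ξ G₀ (hgs es′) →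
    coefStar C (rest ++ es′) ≈ ⟨ starF k G₀ es′ , (λ D → coefStar C (rest ++ (G₀ , D) ∷ [])) ⟩

  module _ {H : HG n} {Y : Sub n} (f : KidFamily {n} {H} {Y}) (ih : ∀ K (t : T (isCompᵇ (H ∖ʰ Y) K)) → Subst (f K t)) where

    -- This step serves both cases of the theorem: G₀ is the block a₀ if it stays unopened, and
    -- otherwise a component of a₀ minus the chosen roots. Away from the component K₀ containing G₀,
    -- the filter removes both `es′` and D, so the product is linear in one factor.
    coefKids-subst : ∀ base G₀ es′ k → countˢ (carrier G₀) ≤ k → Layer H Y (hgs base ++ G₀ ∷ []) → Supports Ξ G₀ (hgs es′) →
      coefKids f (base ++ es′) ≈ ⟨ starF k G₀ es′ , (λ D → coefKids f (base ++ (G₀ , D) ∷ [])) ⟩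
    coefKids-subst base G₀ es′ k count Λ S with Layer.placed Λ (∈-++⁺ʳ (hgs base) (here ≡-refl))
    ... | K₀ , t₀ , G₀⊆K₀ = Π-linear (starF k G₀ es′) (λ K → factor K (base ++ es′)) (λ K D → factor K (base ++ (G₀ , D) ∷ []))
            (allSubsets-unique n) (∈-allSubsets K₀) constant linear
      where
      factor : Sub n → List (Ent n) → Carrier
      factor K es = whenT (isCompᵇ (H ∖ʰ Y) K) (λ t → coefStar (f K t) (keep (within K) es))
      member-⊆ : ∀ {e} → e ∈ es′ → ∀ x → x ∈ˢ carrier (proj₁ e) → x ∈ˢ carrier G₀
      member-⊆ i x = Supports-⊆ S (∈-map⁺ proj₁ i)
      constant : ∀ K → K ≢ K₀ → ∀ D → factor K (base ++ es′) ≈ factor K (base ++ (G₀ , D) ∷ [])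
      constant K K≢ D = whenT-cong (isCompᵇ (H ∖ʰ Y) K) (λ t → reflexive (cong (coefStar (f K t)) (same t)))
        where
        same : T (isCompᵇ (H ∖ʰ Y) K) → keep (within K) (base ++ es′) ≡ keep (within K) (base ++ (G₀ , D) ∷ [])
        same t = ≡-trans (keep-++ (within K) base es′) (≡-trans (cong (keep (within K) base ++_) (≡-trans
          (keep-none (within K) es′ (λ e i h → K≢ (comp-determined {G = G₀} {proj₁ e} t₀ t (Supports.inhabited S (∈-map⁺ proj₁ i)) G₀⊆K₀ (member-⊆ i) h)))
          (sym (keep-none (within K) ((G₀ , D) ∷ []) λ { e (here ≡-refl) h →
            K≢ (comp-determined {G = G₀} {G₀} t₀ t (Layer.inhabited Λ (∈-++⁺ʳ (hgs base) (here ≡-refl))) G₀⊆K₀ (λ x → id) h) }))))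
          (sym (keep-++ (within K) base ((G₀ , D) ∷ []))))
      linear : factor K₀ (base ++ es′) ≈ ⟨ starF k G₀ es′ , (λ D → factor K₀ (base ++ (G₀ , D) ∷ [])) ⟩
      linear = begin
        factor K₀ (base ++ es′) ≈⟨ reflexive (whenT-yes t₀ (λ t → coefStar (f K₀ t) (keep (within K₀) (base ++ es′)))) ⟩
        coefStar (f K₀ t₀) (keep (within K₀) (base ++ es′)) ≈⟨ reflexive (cong (coefStar (f K₀ t₀)) (≡-trans (keep-++ (within K₀) base es′)
          (cong (keep (within K₀) base ++_) (keep-all (within K₀) es′
            (λ e i → ⊆ᵇ⁺ (carrier (proj₁ e)) K₀ (λ x → ⊆ᵇ⁻ (carrier G₀) K₀ G₀⊆K₀ ∘ member-⊆ i x)))))) ⟩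
        coefStar (f K₀ t₀) (keep (within K₀) base ++ es′) ≈⟨ ih K₀ t₀ (keep (within K₀) base) G₀ es′ k count
          (subst (Supports Ξ _) (≡-trans (keep-++ (withinHG K₀) (hgs base) (G₀ ∷ []))
            (cong₂ _++_ (hgs-keep K₀ base) (keep-all (withinHG K₀) (G₀ ∷ []) (λ { G (here ≡-refl) → G₀⊆K₀ })))) (Layer.supports Λ K₀ t₀)) S ⟩
        ⟨ starF k G₀ es′ , (λ D → coefStar (f K₀ t₀) (keep (within K₀) base ++ (G₀ , D) ∷ [])) ⟩
          ≈⟨ pair-cong (starF k G₀ es′) (λ D → reflexive (sym (≡-trans
               (whenT-yes t₀ (λ t → coefStar (f K₀ t) (keep (within K₀) (base ++ (G₀ , D) ∷ []))))
               (cong (coefStar (f K₀ t₀)) (≡-trans (keep-++ (within K₀) base ((G₀ , D) ∷ []))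
                 (cong (keep (within K₀) base ++_) (keep-all (within K₀) ((G₀ , D) ∷ []) (λ { e (here ≡-refl) → G₀⊆K₀ })))))))) ⟩
        ⟨ starF k G₀ es′ , (λ D → factor K₀ (base ++ (G₀ , D) ∷ [])) ⟩ ∎

    -- Expanding a node at G₀ means an independent choice of subtree in every component of G₀ minus
    -- U. The members `es′` are sorted by these components, and `coefKids-subst` is applied with one
    -- component at a time in place of G₀.
    coefKids-opened : ∀ base G₀ U es′ k → T (nonemptyᵇ U ∧ (U ⊆ᵇ carrier G₀)) → countˢ (carrier G₀) ≤ suc k →
      Layer H Y (hgs base ++ kidHGs (G₀ , U)) → Layer G₀ U (hgs es′) →
      coefKids f (base ++ es′) ≈
        ⟨ expandAll n (slot G₀ U (λ K _ → starF k (restrict (G₀ ∖ʰ U) K) (keep (within K) es′))) , (λ g → coefKids f (base ++ kidsOf G₀ U g)) ⟩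
    coefKids-opened base G₀ U es′ k t count Λ Λ′ = begin
      coefKids f (base ++ es′) ≈⟨ coefKids-↭ f (++⁺ˡ base (↭-sym regroup)) ⟩
      coefKids f (base ++ concatMap w (allSubsets n))
        ≈⟨ pair-expandAll-subst (Layer H Y) Layer-↭ (coefKids f) (coefKids-↭ f) n (slot G₀ U ch) w zh z hz graft-at step base
             (subst (λ l → Layer H Y (hgs base ++ l)) (sym (concatMap-pickᵇ comp (restrict (G₀ ∖ʰ U)) (allSubsets n))) Λ) ⟩
      ⟨ expandAll n (slot G₀ U ch) , (λ g → coefKids f (base ++ concatMap (λ K → z K (g K)) (allSubsets n))) ⟩
        ≈⟨ pair-cong (expandAll n (slot G₀ U ch)) (λ g → reflexive (cong (λ l → coefKids f (base ++ l)) (sym (ents-pick comp (restrict (G₀ ∖ʰ U)) g)))) ⟩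
      ⟨ expandAll n (slot G₀ U ch) , (λ g → coefKids f (base ++ kidsOf G₀ U g)) ⟩ ∎
      where
      comp : Sub n → Bool
      comp = isCompᵇ (G₀ ∖ʰ U)
      ch : ChildLins {n} {G₀} {U}
      ch K _ = starF k (restrict (G₀ ∖ʰ U) K) (keep (within K) es′)
      -- The test `comp K` leaves subsets that are not components without members, in accordance
      -- with the placeholder of coefficient 1 in `slot`.
      w : Sub n → List (Ent n)
      w K = keep (λ e → comp K ∧ within K e) es′
      zh : Sub n → List (HG n)
      zh K = pickᵇ (comp K) (λ _ → restrict (G₀ ∖ʰ U) K)
      z : (K : Sub n) → Kid G₀ U K → List (Ent n)
      z K x = pickᵇ (comp K) (λ t → restrict (G₀ ∖ʰ U) K , x t)
      hz : ∀ K x → hgs (z K x) ≡ zh K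
      hz K x = map-pickᵇ proj₁ (comp K) (λ t → restrict (G₀ ∖ʰ U) K , x t)
      regroup : concatMap w (allSubsets n) ↭ es′
      regroup = concatMap-keep-↭ (λ K e → comp K ∧ within K e) (allSubsets n) (allSubsets-unique n) es′ located
        where
        located : ∀ e → e ∈ es′ → ∃ λ K → K ∈ allSubsets n × T (comp K ∧ within K e) × (∀ L → T (comp L ∧ within L e) → L ≡ K)
        located e i with Layer.placed Λ′ (∈-map⁺ proj₁ i)
        ... | K , tK , e⊆K = K , ∈-allSubsets K , T-∧⁺ tK e⊆K , λ L h →
              let (tL , e⊆L) = T-∧⁻ {comp L} h
              in comp-determined {G = proj₁ e} {proj₁ e} tK tL (Layer.inhabited Λ′ (∈-map⁺ proj₁ i)) e⊆K (λ x → id) e⊆L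
      kid-supports : ∀ K → T (comp K) → Supports Ξ (restrict (G₀ ∖ʰ U) K) (hgs (keep (within K) es′))
      kid-supports K tK = subst (Supports Ξ _) (hgs-keep K es′) (Layer.supports Λ′ K tK)
      graft-at : ∀ hs K → Layer H Y (hs ++ zh K) → Layer H Y (hs ++ hgs (w K))
      graft-at hs K Λ₁ with T? (comp K)
      ... | yes tK = subst (λ l → Layer H Y (hs ++ hgs l)) (keep-cong es′ (λ e _ → sym (cong (_∧ within K e) (T⇒≡ tK))))
              (Layer-graft hs (subst (λ l → Layer H Y (hs ++ l)) (pickᵇ-yes tK (λ _ → restrict (G₀ ∖ʰ U) K)) Λ₁) (kid-supports K tK))
      ... | no ¬tK = subst (λ l → Layer H Y (hs ++ l)) (≡-trans (pickᵇ-no ¬tK (λ _ → restrict (G₀ ∖ʰ U) K))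
              (cong hgs (sym (keep-none (λ e → comp K ∧ within K e) es′ (λ e _ h → ¬tK (proj₁ (T-∧⁻ h))))))) Λ₁
      step : ∀ b K → Layer H Y (hgs b ++ zh K) → coefKids f (b ++ w K) ≈ ⟨ slot G₀ U ch K , (λ x → coefKids f (b ++ z K x)) ⟩
      step b K = SlotCases.slot-elim
        (λ K v e L → Layer H Y (hgs b ++ pickᵇ v (λ _ → restrict (G₀ ∖ʰ U) K)) → coefKids f (b ++ keep (λ e → v ∧ within K e) es′) ≈
           ⟨ L , (λ x → coefKids f (b ++ pickᵇ v (λ t → restrict (G₀ ∖ʰ U) K , x t))) ⟩)
        ch
        (λ K e g h Λ₁ → let tK = subst T (sym e) tt in ≈-trans
          (coefKids-subst b (restrict (G₀ ∖ʰ U) K) (keep (within K) es′) k (comp-countˢ G₀ U K t tK count) Λ₁ (kid-supports K tK))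
          (≈-sym (pair-map g (λ x → coefKids f (b ++ (restrict (G₀ ∖ʰ U) K , x tt) ∷ [])) (λ D → coefKids f (b ++ (restrict (G₀ ∖ʰ U) K , D) ∷ []))
            (λ a C → reflexive (proj₁ (h a C)) , reflexive (cong (λ x → coefKids f (b ++ (restrict (G₀ ∖ʰ U) K , x tt) ∷ [])) (proj₂ (h a C)))) (ch K tK))))
        (λ K e x Λ₁ → ≈-trans (reflexive (cong (λ l → coefKids f (b ++ l)) (keep-none (λ _ → false) es′ (λ _ _ ()))))
          (≈-sym (≈-trans (+-identityʳ _) (*-identityˡ _))))
        K

  module _ {H : HG n} {Y : Sub n} .(p : T (nonemptyᵇ Y ∧ (Y ⊆ᵇ carrier H))) (f : KidFamily {n} {H} {Y})
           (ih : ∀ K (t : T (isCompᵇ (H ∖ʰ Y) K)) → Subst (f K t)) where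
    private
      C : Construct H
      C = node Y p f

    -- Since s is nonempty, H is opened and strictness places the unopened G₀ inside one component.
    -- Both `es′` and D are passed down unchanged, so the sum over D moves below the root.
    coefSplit-unopened : ∀ s r G₀ es′ k → s ≢ [] → countˢ (carrier G₀) ≤ k → Supports Ξ H (hgs (s ++ r) ++ G₀ ∷ []) → Supports Ξ G₀ (hgs es′) →
      coefSplit C s (r ++ es′) ≈ ⟨ starF k G₀ es′ , (λ D → coefSplit C s (r ++ (G₀ , D) ∷ [])) ⟩
    coefSplit-unopened s r G₀ es′ k s≢[] count S S′ = ind-pair Y (rootsU s) (starF k G₀ es′) _ (λ e → begin
      coefKids f ((r ++ es′) ++ kids s) ≈⟨ coefKids-↭ f (++-exchange-↭ r es′ (kids s)) ⟩
      coefKids f ((r ++ kids s) ++ es′) ≈⟨ coefKids-subst f ih (r ++ kids s) G₀ es′ k count (layer e) S′ ⟩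
      ⟨ starF k G₀ es′ , (λ D → coefKids f ((r ++ kids s) ++ (G₀ , D) ∷ [])) ⟩
        ≈⟨ pair-cong (starF k G₀ es′) (λ D → coefKids-↭ f (++-exchange-↭ r (kids s) ((G₀ , D) ∷ []))) ⟩
      ⟨ starF k G₀ es′ , (λ D → coefKids f ((r ++ (G₀ , D) ∷ []) ++ kids s)) ⟩ ∎)
      where
      arranged : Supports Ξ H ((hgs r ++ G₀ ∷ []) ++ map proj₁ (rooteds s))
      arranged = Supports-↭ (↭-trans (++⁺ʳ (G₀ ∷ []) (↭-trans (↭-reflexive (map-++ proj₁ s r)) (++-comm (hgs s) (hgs r))))
        (↭-trans (++-exchange-↭ (hgs r) (hgs s) (G₀ ∷ [])) (↭-reflexive (cong ((hgs r ++ G₀ ∷ []) ++_) (sym (rooteds-hgs s)))))) S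
      layer : Y ≡ rootsU s → Layer H Y (hgs (r ++ kids s) ++ G₀ ∷ [])
      layer e = subst₂ (Layer H) (≡-trans (rootsUnion-rooteds s) (sym e)) (cong (_++ G₀ ∷ []) (sym (≡-trans (map-++ proj₁ r (kids s)) (cong (hgs r ++_) (hgs-kids s)))))
        (Layer-↭ (++-exchange-↭ (hgs r) (G₀ ∷ []) (concatMap kidHGs (rooteds s)))
          (Layer-opened (hgs r ++ G₀ ∷ []) (rooteds s) arranged (rooteds-rooted s) (rooteds-≢[] s s≢[])))

    coefSplit-node : ∀ s r G₀ U .t g → coefSplit C (s ++ (G₀ , node U t g) ∷ []) r
      ≈ ind (Y ==ᵇ (rootsU s ∪ˢ U)) * coefKids f ((r ++ kids s) ++ kidsOf G₀ U g)
    coefSplit-node s r G₀ U t g = reflexive (cong₂ (λ V l → ind (Y ==ᵇ V) * coefKids f l)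
      (≡-trans (rootsU-++ s ((G₀ , node U t g) ∷ [])) (cong (rootsU s ∪ˢ_) bigUnion-[ U ]))
      (≡-trans (cong (r ++_) (≡-trans (kids-++ s ((G₀ , node U t g) ∷ [])) (cong (kids s ++_) (++-identityʳ (kidsOf G₀ U g)))))
        (sym (++-assoc r (kids s) (kidsOf G₀ U g)))))

    -- Guarantees that the test in `splitF` succeeds for a supported family, so ∗_B′(δ′) is a
    -- genuine node and not the default value 0.
    roots-valid : ∀ {G₀} s′ r′ → Supports Ξ G₀ (hgs (s′ ++ r′)) → s′ ≢ [] → T (nonemptyᵇ (rootsU s′) ∧ (rootsU s′ ⊆ᵇ carrier G₀))
    roots-valid [] r′ S h = ⊥-elim (h ≡-refl)
    roots-valid {G₀} s′@(e₀ ∷ s₀) r′ S h = T-∧⁺ (nonempty⁺ (rootsU s′) (∈-bigUnion⁺ {L = map (λ e → root (proj₂ e)) s′} (here ≡-refl) (proj₂ y)))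
      (⊆ᵇ⁺ (rootsU s′) (carrier G₀) inside)
      where
      y = nonempty⁻ (root (proj₂ e₀)) (proj₁ (T-∧⁻ {nonemptyᵇ (root (proj₂ e₀))} (root-valid (proj₂ e₀))))
      root-⊆ : ∀ (e : Ent n) {x} → x ∈ˢ root (proj₂ e) → x ∈ˢ carrier (proj₁ e)
      root-⊆ e = ⊆ᵇ⁻ (root (proj₂ e)) (carrier (proj₁ e)) (proj₂ (T-∧⁻ {nonemptyᵇ (root (proj₂ e))} (root-valid (proj₂ e))))
      inside : ∀ x → x ∈ˢ rootsU s′ → x ∈ˢ carrier G₀
      inside x i = let (Z , j , x∈Z) = ∈-bigUnion⁻ (map (λ e → root (proj₂ e)) s′) i
                       (e , k , eq) = ∈-map⁻ (λ e → root (proj₂ e)) {xs = s′} j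
                   in Supports-⊆ S (∈-map⁺ proj₁ (∈-++⁺ˡ k)) (root-⊆ e {x} (subst (x ∈ˢ_) eq x∈Z))

    -- All constructs D in ∗_B′(δ′) have the same root U, the union of the roots of s′. Choosing D
    -- along with s hence produces the same root of H as choosing s ++ s′ in the grafted family, and
    -- `coefKids-opened` compares what lies below.
    coefSplit-opened : ∀ s r G₀ s′ r′ k → s′ ≢ [] → countˢ (carrier G₀) ≤ k → Supports Ξ H (hgs (s ++ r) ++ G₀ ∷ []) → Supports Ξ G₀ (hgs (s′ ++ r′)) →
      coefSplit C (s ++ s′) (r ++ r′) ≈ ⟨ splitF k G₀ s′ r′ , (λ D → coefSplit C (s ++ (G₀ , D) ∷ []) r) ⟩
    coefSplit-opened s r G₀ s′ r′ zero s′≢[] count S S′ = ⊥-elim (root-count G₀ (rootsU s′) (roots-valid s′ r′ S′ s′≢[]) count)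
    coefSplit-opened s r G₀ s′ r′ (suc k) s′≢[] count S S′ = splitF-elim k G₀ s′ r′
      (λ L → coefSplit C (s ++ s′) (r ++ r′) ≈ ⟨ L , (λ D → coefSplit C (s ++ (G₀ , D) ∷ []) r) ⟩) record
      { invalid = λ ¬t → ⊥-elim (¬t (roots-valid s′ r′ S′ s′≢[]))
      ; valid = valid }
      where
      valid : (t : T (nonemptyᵇ (rootsU s′) ∧ (rootsU s′ ⊆ᵇ carrier G₀))) → coefSplit C (s ++ s′) (r ++ r′) ≈
        ⟨ nodeL G₀ (rootsU s′) t (λ K _ → starF k (restrict (G₀ ∖ʰ rootsU s′) K) (keep (within K) (r′ ++ kids s′))) , (λ D → coefSplit C (s ++ (G₀ , D) ∷ []) r) ⟩
      valid t = begin
        ind (Y ==ᵇ rootsU (s ++ s′)) * coefKids f ((r ++ r′) ++ kids (s ++ s′))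
          ≈⟨ *-cong (reflexive (cong (λ V → ind (Y ==ᵇ V)) (rootsU-++ s s′))) (coefKids-↭ f rearrange) ⟩
        ind (Y ==ᵇ (rootsU s ∪ˢ U)) * coefKids f ((r ++ kids s) ++ (r′ ++ kids s′))
          ≈⟨ ind-pair Y (rootsU s ∪ˢ U) L (λ g → coefKids f ((r ++ kids s) ++ kidsOf G₀ U g))
               (λ e → coefKids-opened f ih (r ++ kids s) G₀ U (r′ ++ kids s′) k t count (layer e) layer′) ⟩
        ⟨ L , (λ g → ind (Y ==ᵇ (rootsU s ∪ˢ U)) * coefKids f ((r ++ kids s) ++ kidsOf G₀ U g)) ⟩
          ≈⟨ pair-cong L (λ g → ≈-sym (coefSplit-node s r G₀ U t g)) ⟩
        ⟨ L , (λ g → coefSplit C (s ++ (G₀ , node U t g) ∷ []) r) ⟩ ≈⟨ ≈-sym (pair-nodeL t ch _) ⟩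
        ⟨ nodeL G₀ U t ch , (λ D → coefSplit C (s ++ (G₀ , D) ∷ []) r) ⟩ ∎
        where
        U = rootsU s′
        ch : ChildLins {n} {G₀} {U}
        ch K _ = starF k (restrict (G₀ ∖ʰ U) K) (keep (within K) (r′ ++ kids s′))
        L = expandAll n (slot G₀ U ch)
        rearrange : (r ++ r′) ++ kids (s ++ s′) ↭ (r ++ kids s) ++ (r′ ++ kids s′)
        rearrange = ↭-trans (↭-reflexive (≡-trans (cong ((r ++ r′) ++_) (kids-++ s s′)) (sym (++-assoc (r ++ r′) (kids s) (kids s′)))))
          (↭-trans (++⁺ʳ (kids s′) (++-exchange-↭ r r′ (kids s))) (↭-reflexive (++-assoc (r ++ kids s) r′ (kids s′))))
        g₀ : List (Rooted {n})
        g₀ = (G₀ , U) ∷ []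
        arranged : Supports Ξ H (hgs r ++ map proj₁ (rooteds s ++ g₀))
        arranged = Supports-↭ (↭-trans (++⁺ʳ (G₀ ∷ []) (↭-trans (↭-reflexive (map-++ proj₁ s r)) (++-comm (hgs s) (hgs r))))
          (↭-reflexive (≡-trans (++-assoc (hgs r) (hgs s) (G₀ ∷ [])) (cong (hgs r ++_)
            (sym (≡-trans (map-++ proj₁ (rooteds s) g₀) (cong (_++ G₀ ∷ []) (rooteds-hgs s)))))))) S
        arranged′ : Supports Ξ G₀ (hgs r′ ++ map proj₁ (rooteds s′))
        arranged′ = Supports-↭ (↭-trans (↭-reflexive (map-++ proj₁ s′ r′)) (↭-trans (++-comm (hgs s′) (hgs r′)) (↭-reflexive (cong (hgs r′ ++_) (sym (rooteds-hgs s′)))))) S′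
        rooted₀ : ∀ {g} → g ∈ rooteds s ⊎ g ∈ g₀ → IsRooted g
        rooted₀ (inj₁ i) = rooteds-rooted s i
        rooted₀ (inj₂ (here ≡-refl)) = t
        -- Two openings enter: H with G₀ as a single member rooted at U, and G₀ itself with the
        -- members of s′.
        layer : Y ≡ rootsU s ∪ˢ U → Layer H Y (hgs (r ++ kids s) ++ kidHGs (G₀ , U))
        layer e = subst₂ (Layer H)
          (≡-trans (cong bigUnion (map-++ proj₂ (rooteds s) g₀)) (≡-trans (bigUnion-++ (map proj₂ (rooteds s)) (U ∷ []))
            (≡-trans (cong₂ _∪ˢ_ (rootsUnion-rooteds s) bigUnion-[ U ]) (sym e))))
          (≡-trans (cong (hgs r ++_) (≡-trans (concatMap-++ kidHGs (rooteds s) g₀) (cong₂ _++_ (sym (hgs-kids s)) (++-identityʳ (kidHGs (G₀ , U))))))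
            (≡-trans (sym (++-assoc (hgs r) (hgs (kids s)) (kidHGs (G₀ , U)))) (cong (_++ kidHGs (G₀ , U)) (sym (map-++ proj₁ r (kids s))))))
          (Layer-opened (hgs r) (rooteds s ++ g₀) arranged (rooted₀ ∘ ∈-++⁻ (rooteds s)) (nonnil (rooteds s)))
          where
          nonnil : ∀ (l : List (Rooted {n})) → l ++ g₀ ≢ []
          nonnil [] ()
          nonnil (_ ∷ _) ()
        layer′ : Layer G₀ U (hgs (r′ ++ kids s′))
        layer′ = subst₂ (Layer G₀) (rootsUnion-rooteds s′) (sym (≡-trans (map-++ proj₁ r′ (kids s′)) (cong (hgs r′ ++_) (hgs-kids s′))))
          (Layer-opened (hgs r′) (rooteds s′) arranged′ (rooteds-rooted s′) (rooteds-≢[] s′ s′≢[]))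

    -- A choice in the grafted family is a choice s among the untouched members and a choice s′
    -- among the grafted ones. For fixed s, the term with s′ empty corresponds to D unchosen, and
    -- all terms with s′ nonempty together correspond to D chosen.
    coefStar-subst-step : Subst C
    coefStar-subst-step rest G₀ es′ k count S S′ = begin
      coefStar C (rest ++ es′) ≈⟨ Σsplits-++ rest es′ _ ⟩
      Σsplits rest (λ s r → Σsplits es′ (φ s r)) ≈⟨ Σsplits-cong rest (λ s r π → at s r (Supports-↭ (++⁺ʳ (G₀ ∷ []) (map⁺ proj₁ (↭-sym π))) S)) ⟩
      Σsplits rest (λ s r → ⟨ star₀ , (λ D → Σsplits ((G₀ , D) ∷ []) (φ s r)) ⟩) ≈⟨ Σsplits-pair star₀ rest _ ⟩
      ⟨ star₀ , (λ D → Σsplits rest (λ s r → Σsplits ((G₀ , D) ∷ []) (φ s r))) ⟩ ≈⟨ pair-cong star₀ (λ D → ≈-sym (Σsplits-++ rest ((G₀ , D) ∷ []) _)) ⟩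
      ⟨ star₀ , (λ D → coefStar C (rest ++ (G₀ , D) ∷ [])) ⟩ ∎
      where
      star₀ = starF k G₀ es′
      φ : (s r s′ r′ : List (Ent n)) → Carrier
      φ s r s′ r′ = weight (s ++ s′) * coefSplit C (s ++ s′) (r ++ r′)
      at : ∀ s r → Supports Ξ H (hgs (s ++ r) ++ G₀ ∷ []) → Σsplits es′ (φ s r) ≈ ⟨ star₀ , (λ D → Σsplits ((G₀ , D) ∷ []) (φ s r)) ⟩
      at s r S₁ = begin
        Σsplits es′ (φ s r) ≈⟨ Σsplits-peel es′ (φ s r) ψ (λ _ → ≈-trans (*-congˡ (zeroˡ _)) (zeroʳ _)) opened ⟩
        φ s r [] es′ + Σsplits es′ ψ ≈⟨ +-cong (unopened s S₁)
          (≈-trans (Σsplits-* es′ (pow q (length s)) _) (≈-trans (*-congˡ (≈-sym (pair-starF k G₀ es′ χ))) (≈-sym (pair-* star₀ _ χ)))) ⟩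
        ⟨ star₀ , (λ D → φ s r [] ((G₀ , D) ∷ [])) ⟩ + ⟨ star₀ , (λ D → pow q (length s) * χ D) ⟩ ≈⟨ +-comm _ _ ⟩
        ⟨ star₀ , (λ D → pow q (length s) * χ D) ⟩ + ⟨ star₀ , (λ D → φ s r [] ((G₀ , D) ∷ [])) ⟩ ≈⟨ ≈-sym (pair-+ star₀ _ _) ⟩
        ⟨ star₀ , (λ D → pow q (length s) * χ D + φ s r [] ((G₀ , D) ∷ [])) ⟩
          ≈⟨ pair-cong star₀ (λ D → +-congʳ (*-cong (≈-sym (≈-trans (weight-++ s (G₀ , D) []) (*-identityʳ _)))
               (reflexive (cong (coefSplit C (s ++ (G₀ , D) ∷ [])) (sym (++-identityʳ r)))))) ⟩
        ⟨ star₀ , (λ D → Σsplits ((G₀ , D) ∷ []) (φ s r)) ⟩ ∎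
        where
        χ : Construct G₀ → Carrier
        χ D = coefSplit C (s ++ (G₀ , D) ∷ []) r
        ψ : (s′ r′ : List (Ent n)) → Carrier
        ψ s′ r′ = pow q (length s) * (weight s′ * ⟨ splitF k G₀ s′ r′ , χ ⟩)
        opened : ∀ x s′ r′ → x ∷ s′ ++ r′ ↭ es′ → φ s r (x ∷ s′) r′ ≈ ψ (x ∷ s′) r′
        opened x s′ r′ π = ≈-trans (*-cong (weight-++ s x s′)
          (coefSplit-opened s r G₀ (x ∷ s′) r′ k (λ ()) count S₁ (Supports-↭ (map⁺ proj₁ (↭-sym π)) S′))) (*-assoc _ _ _)
        unopened : ∀ s → Supports Ξ H (hgs (s ++ r) ++ G₀ ∷ []) → φ s r [] es′ ≈ ⟨ star₀ , (λ D → φ s r [] ((G₀ , D) ∷ [])) ⟩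
        -- Nothing at all is chosen: there is no root to open, and `weight` makes both sides 0.
        unopened [] _ = ≈-trans (zeroˡ _) (≈-sym (pair-0 star₀ (λ _ → zeroˡ _)))
        unopened s@(_ ∷ _) S₂ = ≈-trans (*-congˡ (≈-trans (reflexive (cong (λ l → coefSplit C l (r ++ es′)) (++-identityʳ s)))
          (≈-trans (coefSplit-unopened s r G₀ es′ k (λ ()) count S₂ S′)
            (pair-cong star₀ (λ D → reflexive (cong (λ l → coefSplit C l (r ++ (G₀ , D) ∷ [])) (sym (++-identityʳ s))))))))
          (≈-sym (pair-* star₀ _ _))

  coefStar-subst : {H : HG n} (C : Construct H) → Subst C
  coefStar-subst (node Y p f) = coefStar-subst-step p f (λ K t → coefStar-subst (f K t))

-- From teams to supported families; the case of an empty block.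

module _ {n : ℕ} {𝔘 : HG n → Set} {Ξ : Team n → Set} (clan : StrictClan 𝔘 Ξ) where
  open StrictClan clan

  -- The starting point of the induction. `Preteam` admits an empty block, hence the separate
  -- assumption of nonemptiness.
  Supports-team : ∀ τ → Ξ τ → ∀ Zs → AllPairs _≢_ Zs → (∀ Z → T (blk τ Z) → Z ∈ Zs) → (∀ {Z} → Z ∈ Zs → T (blk τ Z)) →
    (∀ {Z} → Z ∈ Zs → T (nonemptyᵇ Z)) → Supports Ξ (tgt τ) (map (member τ) Zs)
  Supports-team τ τ∈Ξ Zs unique complete sound nonempty = record
    { rep = τ
    ; rep∈Ξ = τ∈Ξ
    ; target = mk≐ ≡-refl (λ _ → ≡-refl)
    ; blocks⁻ = λ Z b → member τ Z , ∈-map⁺ (member τ) (complete Z b) , ≡-refl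
    ; blocks⁺ = λ i → along i (λ Z → T (blk τ (carrier Z))) sound
    ; members = λ i → along i (λ G → member τ (carrier G) ≐ G) (λ _ → mk≐ ≡-refl (λ _ → ≡-refl))
    ; inhabited = λ i → along i (λ G → T (nonemptyᵇ (carrier G))) nonempty
    ; disjoint = AllPairs.map⁺ (pairs Zs id unique) }
    where
    along : ∀ {G} → G ∈ map (member τ) Zs → (P : HG n → Set) → (∀ {Z} → Z ∈ Zs → P (member τ Z)) → P G
    along i P h with ∈-map⁻ (member τ) i
    ... | Z , j , ≡-refl = h j
    apart : ∀ {Z Z′} → Z ∈ Zs → Z′ ∈ Zs → Z ≢ Z′ → Disjoint (member τ Z) (member τ Z′)
    apart {Z} {Z′} i j ne x x∈ x∈′ = T-not⁻ (Preteam.disjoint (Strict.preteam (strict τ τ∈Ξ)) Z Z′ (sound i) (sound j) ne)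
      (nonempty⁺ (Z ∩ˢ Z′) (∈-∩⁺ Z Z′ x∈ x∈′))
    pairs : ∀ Ys → (∀ {Z} → Z ∈ Ys → Z ∈ Zs) → AllPairs _≢_ Ys → AllPairs (λ Z Z′ → Disjoint (member τ Z) (member τ Z′)) Ys
    pairs [] inc [] = []
    pairs (Z ∷ Ys) inc (p ∷ ps) = All.tabulate (λ i → apart (inc (here ≡-refl)) (inc (there i)) (All.lookup p i)) ∷ pairs Ys (inc ∘ there) ps

  block-⊆ : ∀ {τ} → Ξ τ → ∀ {Z x} → T (blk τ Z) → x ∈ˢ Z → x ∈ˢ carrier (tgt τ)
  block-⊆ {τ} τ∈Ξ {Z} {x} b i = subst (x ∈ˢ_) (sym (Preteam.cover (Strict.preteam (strict τ τ∈Ξ)))) (∈-bigUnion⁺ (∈-keep⁺ (blk τ) (∈-allSubsets Z) b) i)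

  -- Opening all other blocks completely leaves no component in which the empty block could lie.
  empty-block-alone : ∀ {τ} → Ξ τ → ∀ {a₀} → T (blk τ a₀) → ¬ T (nonemptyᵇ a₀) → (∀ Z → T (restᵇ τ a₀ Z) → T (nonemptyᵇ Z)) →
    ∀ Z → ¬ T (restᵇ τ a₀ Z)
  empty-block-alone {τ} τ∈Ξ {a₀} b₀ a₀-empty nonempty Z Z-rest = absurd
    (proj₂ (Strict.unchosen (strict τ τ∈Ξ) (restᵇ τ a₀) id choice a₀ b₀ (T-not⁺ (λ h → T-not⁻ (proj₂ (T-∧⁻ {blk τ a₀} h)) (==ᵇ⁺ ≡-refl)))))
    where
    choice : Choice τ (restᵇ τ a₀) id
    choice = record
      { B-ne = Z , proj₁ (T-∧⁻ Z-rest) , Z-rest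
      ; B⊆A = λ b h → proj₁ (T-∧⁻ h)
      ; X-ok = λ b h → T-∧⁺ (nonempty b h) (⊆ᵇ⁺ b b (λ _ → id)) }
    covered : ∀ {x} → x ∈ˢ carrier (tgt τ) → x ∈ˢ Yof τ (restᵇ τ a₀) id
    covered {x} i with ∈-bigUnion⁻ (keep (blk τ) (allSubsets n)) (subst (x ∈ˢ_) (Preteam.cover (Strict.preteam (strict τ τ∈Ξ))) i)
    ... | Z′ , j , x∈Z′ with T? (Z′ ==ᵇ a₀)
    ...   | yes e = ⊥-elim (a₀-empty (nonempty⁺ a₀ (subst (x ∈ˢ_) (==ᵇ⁻ Z′ a₀ e) x∈Z′)))
    ...   | no ¬e = let b = proj₂ (∈-keep⁻ (blk τ) (allSubsets n) j)
                    in ∈-bigUnion⁺ (∈-map⁺ id (∈-keep⁺ (λ b → blk τ b ∧ restᵇ τ a₀ b) (∈-allSubsets Z′) (T-∧⁺ b (T-∧⁺ b (T-not⁺ ¬e))))) x∈Z′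
    absurd : ¬ InComp τ (restᵇ τ a₀) id a₀
    absurd (K , t , _) with nonempty⁻ K (comp-nonempty _ K t)
    ... | x , x∈K with ∈-comp⁻ (tgt τ) (Yof τ (restᵇ τ a₀) id) K t x∈K
    ...   | x∈H , x∉Y = x∉Y (covered x∈H)

construct-nonempty : ∀ {n} {H : HG n} → Construct H → T (nonemptyᵇ (carrier H))
construct-nonempty {H = H} (node Y p f) = let (ne , Y⊆H) = T-∧⁻ {nonemptyᵇ Y} (recompute (T? _) p)
                                              (y , y∈Y) = nonempty⁻ Y ne
                                          in nonempty⁺ (carrier H) (⊆ᵇ⁻ Y (carrier H) Y⊆H y∈Y)

module _ {n : ℕ} (P : Sub n → Bool) (G : Sub n → HG n) (C : (Z : Sub n) → .(T (P Z)) → Construct (G Z)) where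

  ∈-ents⁺ : ∀ {Z} → T (P Z) → ∃ λ e → e ∈ ents P G C × proj₁ e ≡ G Z
  ∈-ents⁺ {Z} h with ∈-map⁻ proj₁ (subst (G Z ∈_) (sym (hgs-ents P G C)) (∈-map⁺ G (∈-keep⁺ P (∈-allSubsets Z) h)))
  ... | e , i , eq = e , i , sym eq

  ∈-ents⁻ : ∀ {e} → e ∈ ents P G C → ∃ λ Z → T (P Z) × proj₁ e ≡ G Z
  ∈-ents⁻ i with ∈-map⁻ G (subst (_ ∈_) (hgs-ents P G C) (∈-map⁺ proj₁ i))
  ... | Z , j , eq = Z , proj₂ (∈-keep⁻ P (allSubsets n) j) , eq

  ents-none : (∀ Z → ¬ T (P Z)) → ents P G C ≡ []
  ents-none h = nil (ents P G C) (≡-trans (hgs-ents P G C) (cong (map G) (keep-none P (allSubsets n) (λ Z _ → h Z))))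
    where
    nil : ∀ (es : List (Ent n)) → map proj₁ es ≡ [] → es ≡ []
    nil [] _ = ≡-refl

-- Multilinear extension in one member.

module Multilinear {c ℓ} (R : CommutativeRing c ℓ) (q : CommutativeRing.Carrier R) where
  open CommutativeRing R using (Carrier; _≈_; 1#; +-identityʳ; *-identityˡ; *-identityʳ; *-congʳ; *-congˡ; reflexive) renaming (refl to ≈-refl; sym to ≈-sym; trans to ≈-trans)
  open Shuffle R q
  open Pairing R q

  -- All entries except the last are single constructs with coefficient 1, so the expansion follows
  -- that of L.
  pair-expandEnts : ∀ {n} (rest : List (Ent n)) {G₀} (L : Lin G₀) (Φ : List (Ent n) → Carrier) →
    ⟨ expandEnts (map lift rest ++ (G₀ , L) ∷ []) , Φ ⟩ ≈ ⟨ L , (λ D → Φ (rest ++ (G₀ , D) ∷ [])) ⟩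
  pair-expandEnts [] {G₀} L Φ = pair-bind _ Φ _ (λ a D → ≈-trans (+-identityʳ _) (*-congʳ (*-identityʳ a))) L
  pair-expandEnts ((G , C) ∷ rest) {G₀} L Φ = ≈-trans (pair-++ (map _ E) [] Φ) (≈-trans (+-identityʳ _)
    (≈-trans (pair-scaled _ 1# Φ (λ es → Φ ((G , C) ∷ es)) (λ _ _ → ≈-refl , ≈-refl) E)
    (≈-trans (*-identityˡ _) (pair-expandEnts rest L (λ es → Φ ((G , C) ∷ es))))))
    where E = expandEnts (map lift rest ++ (G₀ , L) ∷ [])

  -- The function F is abstract so that `starL` and `starBL` are covered at once.
  coef-multilinear : ∀ {n} {H : HG n} (F : Carrier × List (Ent n) → Lin H) (F₀ : List (Ent n) → Lin H) → (∀ a es → F (a , es) ≡ scale a (F₀ es)) →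
    ∀ (rest : List (Ent n)) {G₀} (L : Lin G₀) C →
    coef C (concatMap F (expandEnts (map lift rest ++ (G₀ , L) ∷ []))) ≈ ⟨ L , (λ D → coef C (F₀ (rest ++ (G₀ , D) ∷ []))) ⟩
  coef-multilinear F F₀ h rest {G₀} L C = ≈-trans (coef-pair C (concatMap F E)) (≈-trans
    (pair-bind F (λ C′ → ind (eqC C C′)) (λ es → coef C (F₀ es))
      (λ a es → ≈-trans (reflexive (cong (λ M → ⟨ M , (λ C′ → ind (eqC C C′)) ⟩) (h a es))) (≈-trans (pair-scale a (F₀ es) _) (*-congˡ (≈-sym (coef-pair C (F₀ es)))))) E)
    (pair-expandEnts rest L (λ es → coef C (F₀ es))))
    where E = expandEnts (map lift rest ++ (G₀ , L) ∷ [])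

-- The polydendriform equation.

module Polydendriform {c ℓ} (R : CommutativeRing c ℓ) (q : CommutativeRing.Carrier R) {n : ℕ}
  {𝔘 : HG n → Set} {Ξ : Team n → Set} (clan : StrictClan 𝔘 Ξ) (assoc : Associative Ξ) (resp : RespectsTeamEq Ξ)
  (τ : Team n) (τ∈Ξ : Ξ τ) (a₀ : Sub n) (a₀∈A : T (blk τ a₀)) (blk′ : Sub n → Bool) (mem′ : Sub n → Sub n → Bool)
  (τ′∈Ξ : Ξ (team (member τ a₀) blk′ mem′))
  (Cτ : (Z : Sub n) → .(T (restᵇ τ a₀ Z)) → Construct (member τ Z))
  (C′ : (Z : Sub n) → .(T (blk′ Z)) → Construct (member (team (member τ a₀) blk′ mem′) Z)) where
  open CommutativeRing R using (_≈_; reflexive; zeroˡ) renaming (sym to ≈-sym; trans to ≈-trans)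
  open Shuffle R q
  open Pairing R q
  open Substitution R q clan assoc resp
  open Multilinear R q

  τ′ : Team n
  τ′ = team (member τ a₀) blk′ mem′

  H G₀ : HG n
  H = tgt τ
  G₀ = member τ a₀

  δrest δ′ : List (Ent n)
  δrest = ents (restᵇ τ a₀) (member τ) Cτ
  δ′ = ents blk′ (member τ′) C′

  rest-nonempty : ∀ Z → T (restᵇ τ a₀ Z) → T (nonemptyᵇ Z)
  rest-nonempty Z h = construct-nonempty (Cτ Z h)

  blk′-nonempty : ∀ Z → T (blk′ Z) → T (nonemptyᵇ Z)
  blk′-nonempty Z h = construct-nonempty (C′ Z h)

  blk′-a₀ : ∀ Z → T (blk′ Z) → T (nonemptyᵇ a₀)
  blk′-a₀ Z h with nonempty⁻ Z (blk′-nonempty Z h)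
  ... | x , x∈ = nonempty⁺ a₀ (block-⊆ clan τ′∈Ξ h x∈)

  -- Members are indexed by their carriers, so an index of A and one of A′ could be confused in A″.
  -- But blocks of τ′ lie inside a₀, which is disjoint from the other blocks of τ, and a block
  -- carrying a construct is nonempty.
  not-both : ∀ Z → T (blk′ Z) → ¬ T (restᵇ τ a₀ Z)
  not-both Z h′ h with T-∧⁻ {blk τ Z} h | nonempty⁻ Z (rest-nonempty Z h)
  ... | b , Z≢a₀ | x , x∈ = T-not⁻ (Preteam.disjoint (Strict.preteam (StrictClan.strict clan τ τ∈Ξ)) Z a₀ b a₀∈A (λ e → T-not⁻ Z≢a₀ (==ᵇ⁺ e)))
        (nonempty⁺ (Z ∩ˢ a₀) (∈-∩⁺ Z a₀ x∈ (block-⊆ clan τ′∈Ξ h′ x∈)))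

  a₀-not-rest : ¬ T (restᵇ τ a₀ a₀)
  a₀-not-rest h = T-not⁻ (proj₂ (T-∧⁻ {blk τ a₀} h)) (==ᵇ⁺ ≡-refl)

  δ′-supported : Supports Ξ G₀ (hgs δ′)
  δ′-supported = subst (Supports Ξ G₀) (sym (hgs-ents blk′ (member τ′) C′))
    (Supports-team clan τ′ τ′∈Ξ (keep blk′ (allSubsets n)) (keep-AllPairs blk′ (allSubsets-unique n))
      (λ Z h → ∈-keep⁺ blk′ (∈-allSubsets Z) h) inb (λ i → blk′-nonempty _ (inb i)))
    where
    inb : ∀ {Z} → Z ∈ keep blk′ (allSubsets n) → T (blk′ Z)
    inb i = proj₂ (∈-keep⁻ blk′ (allSubsets n) i)

  δrest-supported : T (nonemptyᵇ a₀) → Supports Ξ H (hgs δrest ++ G₀ ∷ [])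
  δrest-supported ne = subst (Supports Ξ H)
    (≡-trans (map-++ (member τ) rests (a₀ ∷ [])) (cong (_++ G₀ ∷ []) (sym (hgs-ents (restᵇ τ a₀) (member τ) Cτ))))
    (Supports-team clan τ τ∈Ξ (rests ++ a₀ ∷ [])
      (AllPairs-++⁺ (keep-AllPairs (restᵇ τ a₀) (allSubsets-unique n)) ([] ∷ []) (λ { i (here ≡-refl) e → a₀-not-rest (subst (T ∘ restᵇ τ a₀) e (inr i)) }))
      complete (λ i → sound (∈-++⁻ rests i)) (λ i → nonempty (∈-++⁻ rests i)))
    where
    rests = keep (restᵇ τ a₀) (allSubsets n)
    inr : ∀ {Z} → Z ∈ rests → T (restᵇ τ a₀ Z)
    inr i = proj₂ (∈-keep⁻ (restᵇ τ a₀) (allSubsets n) i)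
    complete : ∀ Z → T (blk τ Z) → Z ∈ rests ++ a₀ ∷ []
    complete Z b with T? (Z ==ᵇ a₀)
    ... | yes e = ∈-++⁺ʳ rests (here (==ᵇ⁻ Z a₀ e))
    ... | no ¬e = ∈-++⁺ˡ (∈-keep⁺ (restᵇ τ a₀) (∈-allSubsets Z) (T-∧⁺ b (T-not⁺ ¬e)))
    sound : ∀ {Z} → Z ∈ rests ⊎ Z ∈ a₀ ∷ [] → T (blk τ Z)
    sound (inj₁ i) = proj₁ (T-∧⁻ (inr i))
    sound (inj₂ (here ≡-refl)) = a₀∈A
    nonempty : ∀ {Z} → Z ∈ rests ⊎ Z ∈ a₀ ∷ [] → T (nonemptyᵇ Z)
    nonempty (inj₁ i) = rest-nonempty _ (inr i)
    nonempty (inj₂ (here ≡-refl)) = ne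

  -- For nonempty a₀ this is the substitution formula. For empty a₀ there are no members in δ′, and
  -- by `empty-block-alone` none in δrest, so both sides are 0.
  coefStar-δ : (C : Construct H) → coefStar C (δrest ++ δ′) ≈ ⟨ star G₀ δ′ , (λ D → coefStar C (δrest ++ (G₀ , D) ∷ [])) ⟩
  coefStar-δ C = by-cases (T? (nonemptyᵇ a₀))
    where
    by-cases : Dec (T (nonemptyᵇ a₀)) → coefStar C (δrest ++ δ′) ≈ ⟨ star G₀ δ′ , (λ D → coefStar C (δrest ++ (G₀ , D) ∷ [])) ⟩
    by-cases (yes ne) = coefStar-subst C δrest G₀ δ′ (countˢ a₀) ≤-refl (δrest-supported ne) δ′-supported
    by-cases (no ¬ne) = subst₂ (λ es es′ → coefStar C (es ++ es′) ≈ ⟨ star G₀ es′ , (λ D → coefStar C (es ++ (G₀ , D) ∷ [])) ⟩)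
      (sym (ents-none (restᵇ τ a₀) (member τ) Cτ (empty-block-alone clan τ∈Ξ a₀∈A ¬ne rest-nonempty)))
      (sym (ents-none blk′ (member τ′) C′ (λ Z → ¬ne ∘ blk′-a₀ Z)))
      (zeroˡ _)

  star-associative : star H (δrest ++ δ′) ≋ starL H (plug τ a₀ δrest (star G₀ δ′))
  star-associative C = ≈-trans (coef-starF _ C (δrest ++ δ′) ≤-refl) (≈-trans (coefStar-δ C) (≈-sym
    (≈-trans (coef-multilinear _ (star H) (λ _ _ → ≡-refl) δrest (star G₀ δ′) C)
      (pair-cong (star G₀ δ′) (λ D → coef-starF _ C (δrest ++ (G₀ , D) ∷ []) ≤-refl)))))

  module _ (B″ : Sub n → Bool) (B″≢∅ : ∃ λ Z → T (B″ Z) × T (blk (graft τ a₀ blk′ mem′) Z))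
           (B″⊆A″ : ∀ Z → T (B″ Z) → T (blk (graft τ a₀ blk′ mem′) Z)) where
    private
      chosen : (Sub n → Bool) → Ent n → Bool
      chosen B e = B (carrier (proj₁ e))

      s r s′ r′ : List (Ent n)
      s = keep (chosen B″) δrest
      r = keep (not ∘ chosen B″) δrest
      s′ = keep (chosen B″) δ′
      r′ = keep (not ∘ chosen B″) δ′

      B″⊆A∖a₀ : Bool
      B″⊆A∖a₀ = allᵇ (λ Z → not (B″ Z) ∨ restᵇ τ a₀ Z) (allSubsets n)

      a₀-nonempty : T (nonemptyᵇ a₀)
      a₀-nonempty = by-cases (T? (nonemptyᵇ a₀)) (T-∨⁻ {restᵇ τ a₀ (proj₁ B″≢∅)} (proj₂ (proj₂ B″≢∅)))
        where
        by-cases : Dec (T (nonemptyᵇ a₀)) → T (restᵇ τ a₀ (proj₁ B″≢∅)) ⊎ T (blk′ (proj₁ B″≢∅)) → T (nonemptyᵇ a₀)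
        by-cases (yes ne) _ = ne
        by-cases (no ¬ne) (inj₁ h) = ⊥-elim (empty-block-alone clan τ∈Ξ a₀∈A ¬ne rest-nonempty _ h)
        by-cases (no ¬ne) (inj₂ h) = blk′-a₀ _ h

      supported : Supports Ξ H (hgs (s ++ r) ++ G₀ ∷ [])
      supported = Supports-↭ (++⁺ʳ (G₀ ∷ []) (map⁺ proj₁ (↭-sym (keep-complement-↭ (chosen B″) δrest)))) (δrest-supported a₀-nonempty)

      supported′ : Supports Ξ G₀ (hgs (s′ ++ r′))
      supported′ = Supports-↭ (map⁺ proj₁ (↭-sym (keep-complement-↭ (chosen B″) δ′))) δ′-supported

      coef-starB : ∀ B C es → coef C (starB H B es) ≈ coefSplit C (keep (chosen B) es) (keep (not ∘ chosen B) es)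
      coef-starB B C es = coef-splitF _ C (keep (chosen B) es) (keep (not ∘ chosen B) es) ≤-refl

      coef-starB-δ : ∀ C → coef C (starB H B″ (δrest ++ δ′)) ≈ coefSplit C (s ++ s′) (r ++ r′)
      coef-starB-δ C = ≈-trans (coef-starB B″ C (δrest ++ δ′))
        (reflexive (cong₂ (coefSplit C) (keep-++ (chosen B″) δrest δ′) (keep-++ (not ∘ chosen B″) δrest δ′)))

      keep-nonempty : ∀ {es e} → e ∈ es → T (chosen B″ e) → keep (chosen B″) es ≢ []
      keep-nonempty {es} i h eq with () ← subst (_ ∈_) eq (∈-keep⁺ (chosen B″) i h)

      coefSplit-unopened′ : ∀ (C : Construct H) → s ≢ [] → coefSplit C s (r ++ δ′) ≈ ⟨ star G₀ δ′ , (λ D → coefSplit C s (r ++ (G₀ , D) ∷ [])) ⟩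
      coefSplit-unopened′ (node Y p f) ne =
        coefSplit-unopened p f (λ K t → coefStar-subst (f K t)) s r G₀ δ′ (countˢ a₀) ne ≤-refl supported δ′-supported

      coefSplit-opened′ : ∀ (C : Construct H) → s′ ≢ [] → coefSplit C (s ++ s′) (r ++ r′) ≈
        ⟨ splitF (countˢ a₀) G₀ s′ r′ , (λ D → coefSplit C (s ++ (G₀ , D) ∷ []) r) ⟩
      coefSplit-opened′ (node Y p f) ne =
        coefSplit-opened p f (λ K t → coefStar-subst (f K t)) s r G₀ s′ r′ (countˢ a₀) ne ≤-refl supported supported′

    -- B″ chooses neither a₀ nor any member of δ′. The two delegations are therefore split alike,
    -- except that the unchosen part contains δ′ in one and D in the other.
    polydendriform-unopened : T B″⊆A∖a₀ → starB H B″ (δrest ++ δ′) ≋ starBL H B″ (plug τ a₀ δrest (star G₀ δ′))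
    polydendriform-unopened sub C = begin
      coef C (starB H B″ (δrest ++ δ′)) ≈⟨ coef-starB-δ C ⟩
      coefSplit C (s ++ s′) (r ++ r′) ≈⟨ reflexive (cong₂ (coefSplit C) (≡-trans (cong (s ++_) s′≡[]) (++-identityʳ s)) (cong (r ++_) r′≡δ′)) ⟩
      coefSplit C s (r ++ δ′) ≈⟨ coefSplit-unopened′ C s≢[] ⟩
      ⟨ star G₀ δ′ , (λ D → coefSplit C s (r ++ (G₀ , D) ∷ [])) ⟩ ≈⟨ pair-cong (star G₀ δ′) (λ D → ≈-sym (unchanged D)) ⟩
      ⟨ star G₀ δ′ , (λ D → coef C (starB H B″ (δrest ++ (G₀ , D) ∷ []))) ⟩ ≈⟨ ≈-sym (coef-multilinear _ (starB H B″) (λ _ _ → ≡-refl) δrest (star G₀ δ′) C) ⟩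
      coef C (starBL H B″ (plug τ a₀ δrest (star G₀ δ′))) ∎
      where
      open import Relation.Binary.Reasoning.Setoid (CommutativeRing.setoid R)
      B″-rest : ∀ Z → T (B″ Z) → T (restᵇ τ a₀ Z)
      B″-rest Z h with T-∨⁻ {not (B″ Z)} (allᵇ⁻ _ (allSubsets n) sub (∈-allSubsets Z))
      ... | inj₁ ¬h = ⊥-elim (T-not⁻ ¬h h)
      ... | inj₂ h′ = h′
      δ′-unchosen : ∀ e → e ∈ δ′ → ¬ T (chosen B″ e)
      δ′-unchosen e i h with ∈-ents⁻ blk′ (member τ′) C′ i
      ... | Z , b , ≡-refl = not-both Z b (B″-rest Z h)
      s′≡[] : s′ ≡ []
      s′≡[] = keep-none (chosen B″) δ′ δ′-unchosen
      r′≡δ′ : r′ ≡ δ′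
      r′≡δ′ = keep-all (not ∘ chosen B″) δ′ (λ e i → T-not⁺ (δ′-unchosen e i))
      s≢[] : s ≢ []
      s≢[] with ∈-ents⁺ (restᵇ τ a₀) (member τ) Cτ (B″-rest _ (proj₁ (proj₂ B″≢∅)))
      ... | e , i , eq = keep-nonempty i (subst (λ G → T (B″ (carrier G))) (sym eq) (proj₁ (proj₂ B″≢∅)))
      ¬B″a₀ : ¬ T (B″ a₀)
      ¬B″a₀ h = a₀-not-rest (B″-rest a₀ h)
      unchanged : ∀ D → coef C (starB H B″ (δrest ++ (G₀ , D) ∷ [])) ≈ coefSplit C s (r ++ (G₀ , D) ∷ [])
      unchanged D = ≈-trans (coef-starB B″ C (δrest ++ (G₀ , D) ∷ [])) (reflexive (cong₂ (coefSplit C)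
        (≡-trans (keep-++ (chosen B″) δrest ((G₀ , D) ∷ [])) (≡-trans (cong (s ++_) (keep-none (chosen B″) ((G₀ , D) ∷ []) (λ { e (here ≡-refl) → ¬B″a₀ }))) (++-identityʳ s)))
        (≡-trans (keep-++ (not ∘ chosen B″) δrest ((G₀ , D) ∷ [])) (cong (r ++_) (keep-all (not ∘ chosen B″) ((G₀ , D) ∷ []) (λ { e (here ≡-refl) → T-not⁺ ¬B″a₀ }))))))

    -- B′ agrees with B″ on δ′ and B agrees with B″ on δrest, while B also chooses a₀. So s and r
    -- are common to both sides, and D joins s.
    polydendriform-opened : T (not B″⊆A∖a₀) → starB H B″ (δrest ++ δ′) ≋
      starBL H (λ Z → (B″ Z ∧ restᵇ τ a₀ Z) ∨ (Z ==ᵇ a₀)) (plug τ a₀ δrest (starB G₀ (λ Z → B″ Z ∧ blk′ Z) δ′))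
    polydendriform-opened notsub C = begin
      coef C (starB H B″ (δrest ++ δ′)) ≈⟨ coef-starB-δ C ⟩
      coefSplit C (s ++ s′) (r ++ r′) ≈⟨ coefSplit-opened′ C s′≢[] ⟩
      ⟨ splitF (countˢ a₀) G₀ s′ r′ , (λ D → coefSplit C (s ++ (G₀ , D) ∷ []) r) ⟩
        ≈⟨ reflexive (cong₂ (λ u v → ⟨ splitF (countˢ a₀) G₀ u v , (λ D → coefSplit C (s ++ (G₀ , D) ∷ []) r) ⟩)
             (keep-cong δ′ (λ e i → sym (B′≡ e i))) (keep-cong δ′ (λ e i → cong not (sym (B′≡ e i))))) ⟩
      ⟨ starB G₀ B′ δ′ , (λ D → coefSplit C (s ++ (G₀ , D) ∷ []) r) ⟩ ≈⟨ pair-cong (starB G₀ B′ δ′) (λ D → ≈-sym (with-a₀ D)) ⟩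
      ⟨ starB G₀ B′ δ′ , (λ D → coef C (starB H B (δrest ++ (G₀ , D) ∷ []))) ⟩ ≈⟨ ≈-sym (coef-multilinear _ (starB H B) (λ _ _ → ≡-refl) δrest (starB G₀ B′ δ′) C) ⟩
      coef C (starBL H B (plug τ a₀ δrest (starB G₀ B′ δ′))) ∎
      where
      open import Relation.Binary.Reasoning.Setoid (CommutativeRing.setoid R)
      B B′ : Sub n → Bool
      B Z = (B″ Z ∧ restᵇ τ a₀ Z) ∨ (Z ==ᵇ a₀)
      B′ Z = B″ Z ∧ blk′ Z
      B′≡ : ∀ e → e ∈ δ′ → chosen B′ e ≡ chosen B″ e
      B′≡ e i with ∈-ents⁻ blk′ (member τ′) C′ i
      ... | Z , b , ≡-refl = T-⇔-≡ (λ h → proj₁ (T-∧⁻ h)) (λ h → T-∧⁺ h b)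
      B≡ : ∀ e → e ∈ δrest → chosen B e ≡ chosen B″ e
      B≡ e i with ∈-ents⁻ (restᵇ τ a₀) (member τ) Cτ i
      ... | Z , h , ≡-refl = T-⇔-≡ to (λ b → T-∨⁺ˡ (T-∧⁺ b h))
        where
        to : T (B Z) → T (B″ Z)
        to b with T-∨⁻ {B″ Z ∧ restᵇ τ a₀ Z} b
        ... | inj₁ c = proj₁ (T-∧⁻ c)
        ... | inj₂ e = ⊥-elim (T-not⁻ (proj₂ (T-∧⁻ {blk τ Z} h)) e)
      Ba₀ : T (B a₀)
      Ba₀ = T-∨⁺ʳ {B″ a₀ ∧ restᵇ τ a₀ a₀} (==ᵇ⁺ ≡-refl)
      -- If B″ chose no member of δ′, it would be contained in A minus a₀, contrary to the case
      -- assumption.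
      s′≢[] : s′ ≢ []
      s′≢[] s′≡[] = T-not⁻ notsub (allᵇ⁺ _ (allSubsets n) (λ Z _ → inside Z))
        where
        inside : ∀ Z → T (not (B″ Z) ∨ restᵇ τ a₀ Z)
        inside Z with T? (B″ Z)
        ... | no ¬h = T-∨⁺ˡ (T-not⁺ ¬h)
        ... | yes h with T-∨⁻ {restᵇ τ a₀ Z} (B″⊆A″ Z h)
        ...   | inj₁ h′ = T-∨⁺ʳ {not (B″ Z)} h′
        ...   | inj₂ b with ∈-ents⁺ blk′ (member τ′) C′ b
        ...     | e , i , eq = ⊥-elim (keep-nonempty i (subst (λ G → T (B″ (carrier G))) (sym eq) h) s′≡[])
      with-a₀ : ∀ D → coef C (starB H B (δrest ++ (G₀ , D) ∷ [])) ≈ coefSplit C (s ++ (G₀ , D) ∷ []) r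
      with-a₀ D = ≈-trans (coef-starB B C (δrest ++ (G₀ , D) ∷ [])) (reflexive (cong₂ (coefSplit C)
        (≡-trans (keep-++ (chosen B) δrest ((G₀ , D) ∷ [])) (cong₂ _++_ (keep-cong δrest B≡) (keep-all (chosen B) ((G₀ , D) ∷ []) (λ { e (here ≡-refl) → Ba₀ }))))
        (≡-trans (keep-++ (not ∘ chosen B) δrest ((G₀ , D) ∷ [])) (≡-trans (cong₂ _++_ (keep-cong δrest (λ e i → cong not (B≡ e i)))
          (keep-none (not ∘ chosen B) ((G₀ , D) ∷ []) (λ { e (here ≡-refl) h → T-not⁻ h Ba₀ }))) (++-identityʳ r)))))

theorem4p15 :
  ∀ {c ℓ} (R : CommutativeRing c ℓ) (q : CommutativeRing.Carrier R) (n : ℕ)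
    (𝔘 : HG n → Set) → Universe 𝔘 →
    (Ξ : Team n → Set) → StrictClan 𝔘 Ξ → Associative Ξ → RespectsTeamEq Ξ →
    (τ : Team n) → Ξ τ → (a₀ : Sub n) → T (blk τ a₀) →
    (blk' : Sub n → Bool) (mem' : Sub n → Sub n → Bool) →
    Ξ (team (member τ a₀) blk' mem') →
    (Cτ : (Z : Sub n) → .(T (restᵇ τ a₀ Z)) → Construct (member τ Z)) →
    (C' : (Z : Sub n) → .(T (blk' Z)) → Construct (member (team (member τ a₀) blk' mem') Z)) →
    let open Shuffle R q
        τ'    = team (member τ a₀) blk' mem'
        H     = tgt τ
        δrest = ents (restᵇ τ a₀) (member τ) Cτ
        δ'    = ents blk' (member τ') C'
        δ''   = δrest ++ δ'
        A''   = blk (graft τ a₀ blk' mem')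
        B''⊆A∖a₀ = λ (B'' : Sub n → Bool) → allᵇ (λ Z → not (B'' Z) ∨ restᵇ τ a₀ Z) (allSubsets n)
    in ((B'' : Sub n → Bool) →
          (∃ λ Z → T (B'' Z) × T (A'' Z)) → (∀ Z → T (B'' Z) → T (A'' Z)) →
          (T (B''⊆A∖a₀ B'') →
             starB H B'' δ'' ≋ starBL H B'' (plug τ a₀ δrest (star (tgt τ') δ')))
          × (T (not (B''⊆A∖a₀ B'')) →
             starB H B'' δ''
               ≋ starBL H (λ Z → (B'' Z ∧ restᵇ τ a₀ Z) ∨ (Z ==ᵇ a₀))
                        (plug τ a₀ δrest (starB (tgt τ') (λ Z → B'' Z ∧ blk' Z) δ'))))
       × (star H δ'' ≋ starL H (plug τ a₀ δrest (star (tgt τ') δ')))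
theorem4p15 R q n 𝔘 _ Ξ clan assoc resp τ τ∈Ξ a₀ a₀∈A blk' mem' τ'∈Ξ Cτ C' =
  (λ B'' B''≢∅ B''⊆A'' → polydendriform-unopened B'' B''≢∅ B''⊆A'' , polydendriform-opened B'' B''≢∅ B''⊆A'') , star-associative
  where open Polydendriform R q clan assoc resp τ τ∈Ξ a₀ a₀∈A blk' mem' τ'∈Ξ Cτ C'
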